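{- Let $G$ be a finite simple graph that is $\{\mathrm{ISK4},\mathrm{wheel}\}$-free. Then at least one of the following holds: (i) $G$ is series-parallel; (ii) $G$ is the line graph of a chordless graph with maximum degree at most three; (iii) $G$ is a complete bipartite graph; (iv) $G$ has a clique-cutset or a proper 2-cutset.
   Context: An ISK4 in a graph $G$ is an induced subgraph of $G$ isomorphic to a subdivision of $K_4$. A wheel is a graph consisting of a chordless cycle together with a vertex that has at least three neighbors in the cycle. $G$ is $\{\mathrm{ISK4},\mathrm{wheel}\}$-free if it has no ISK4 and no induced subgraph isomorphic to a wheel. A graph is series-parallel if it contains no subdivision of $K_4$ as a (not necessarily induced) subgraph. The line graph $L(H)$ of a graph $H$ has vertex set $E(H)$, two vertices adjacent iff the corresponding edges share an endpoint. A graph is chordless if all its cycles are induced. A cutset of $G$ is a (possibly empty) set of vertices whose deletion yields a disconnected graph; a clique-cutset is a clique (possibly empty) that is a cutset (so a disconnected graph has the empty clique-cutset). A proper 2-cutset of $G$ is a cutset $\{a,b\}$ consisting of two non-adjacent vertices such that $V(G)\setminus\{a,b\}$ can be partitioned into two non-empty sets $X,Y$ with no edge between $X$ and $Y$ and such that neither $G[X\cup\{a,b\}]$ nor $G[Y\cup\{a,b\}]$ is a path between $a$ and $b$. -}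

module Defs where

open import Data.Nat using (ℕ; _≤_)
open import Data.Fin using (Fin; _<_)
open import Data.Bool using (Bool; true; false; _xor_)
open import Data.List using (List; []; _∷_; _++_; length; filterᵇ; allFin)
open import Data.List.Membership.Propositional using (_∈_; _∉_)
open import Data.List.Relation.Unary.Unique.Propositional using (Unique)
open import Data.Product using (Σ; ∃; _×_; _,_; proj₁; proj₂)
open import Data.Sum using (_⊎_)
open import Data.Unit using (⊤)
open import Relation.Nullary using (¬_)
open import Relation.Binary.PropositionalEquality using (_≡_; _≢_)
open import Function.Bundles using (_⇔_)

record Graph : Set where
  field
    n       : ℕ
    adj     : Fin n → Fin n → Bool
    adj-sym : ∀ x y → adj x y ≡ adj y x
    adj-irr : ∀ x → adj x x ≡ false

open Graph public

E : (G : Graph) → Fin (n G) → Fin (n G) → Set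
E G x y = adj G x y ≡ true

Consec : {A : Set} → (A → A → Set) → List A → Set
Consec R []           = ⊤
Consec R (x ∷ [])     = ⊤
Consec R (x ∷ y ∷ l)  = R x y × Consec R (y ∷ l)

ConsecIn : {A : Set} → List A → A → A → Set
ConsecIn {A} l u v =
  Σ (List A) λ p → Σ (List A) λ q →
    (l ≡ p ++ u ∷ v ∷ q) ⊎ (l ≡ p ++ v ∷ u ∷ q)

-- l is a path of G from a to b (a ≠ b forced by Unique)
IsPath : (G : Graph) → Fin (n G) → Fin (n G) → List (Fin (n G)) → Set
IsPath G a b l =
  (Σ (List (Fin (n G))) λ inner → l ≡ a ∷ inner ++ b ∷ [])
  × Unique l × Consec (E G) l

IsCycle : (G : Graph) → List (Fin (n G)) → Set
IsCycle G c =
  Σ (Fin (n G)) λ x → Σ (List (Fin (n G))) λ rest →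
    (c ≡ x ∷ rest) × (2 ≤ length rest) × Unique c × Consec (E G) (c ++ x ∷ [])

CycleChordless : (G : Graph) → List (Fin (n G)) → Set
CycleChordless G [] = ⊤
CycleChordless G (x ∷ rest) =
  ∀ u v → u ∈ (x ∷ rest) → v ∈ (x ∷ rest) → E G u v →
    ConsecIn (x ∷ rest ++ x ∷ []) u v

ChordlessGraph : Graph → Set
ChordlessGraph G = ∀ c → IsCycle G c → CycleChordless G c

record K4Subdivision (G : Graph) : Set where
  field
    br      : Fin 4 → Fin (n G)
    br-inj  : ∀ i j → br i ≡ br j → i ≡ j
    P       : Fin 4 → Fin 4 → List (Fin (n G))
    P-path  : ∀ i j → i < j → IsPath G (br i) (br j) (P i j)
    P-br    : ∀ i j m → i < j → br m ∈ P i j → (m ≡ i) ⊎ (m ≡ j)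
    P-disj  : ∀ i j k l → i < j → k < l → ¬ ((i ≡ k) × (j ≡ l)) →
                ∀ v → v ∈ P i j → v ∈ P k l → Σ (Fin 4) λ m → v ≡ br m

InSub : {G : Graph} → K4Subdivision G → Fin (n G) → Set
InSub S v = Σ (Fin 4) λ i → Σ (Fin 4) λ j → (i < j) × (v ∈ K4Subdivision.P S i j)

InducedSub : {G : Graph} → K4Subdivision G → Set
InducedSub {G} S = ∀ u v → InSub S u → InSub S v → E G u v →
  Σ (Fin 4) λ i → Σ (Fin 4) λ j → (i < j) × ConsecIn (K4Subdivision.P S i j) u v

HasISK4 : Graph → Set
HasISK4 G = Σ (K4Subdivision G) InducedSub

SeriesParallel : Graph → Set
SeriesParallel G = ¬ K4Subdivision G

HasWheel : Graph → Set
HasWheel G = Σ (List (Fin (n G))) λ c → IsCycle G c × CycleChordless G c ×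
  Σ (Fin (n G)) λ x → (x ∉ c) × (3 ≤ length (filterᵇ (adj G x) c))

ShareEnd : {m : ℕ} → Fin m × Fin m → Fin m × Fin m → Set
ShareEnd (a , b) (c , d) = (a ≡ c) ⊎ (a ≡ d) ⊎ (b ≡ c) ⊎ (b ≡ d)

IsLineGraphOf : Graph → Graph → Set
IsLineGraphOf G H =
  Σ (Fin (n G) → Fin (n H) × Fin (n H)) λ e →
    (∀ v → (proj₁ (e v) < proj₂ (e v)) × E H (proj₁ (e v)) (proj₂ (e v)))
    × (∀ u v → e u ≡ e v → u ≡ v)
    × (∀ a b → a < b → E H a b → Σ (Fin (n G)) λ v → e v ≡ (a , b))
    × (∀ u v → E G u v ⇔ ((u ≢ v) × ShareEnd (e u) (e v)))

MaxDegree≤3 : Graph → Set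
MaxDegree≤3 H = ∀ a → length (filterᵇ (adj H a) (allFin (n H))) ≤ 3

CompleteBipartite : Graph → Set
CompleteBipartite G = Σ (Fin (n G) → Bool) λ side →
  (Σ (Fin (n G)) λ u → side u ≡ true) × (Σ (Fin (n G)) λ v → side v ≡ false)
  × (∀ u v → adj G u v ≡ (side u xor side v))

data Reach (G : Graph) (ok : Fin (n G) → Set) : Fin (n G) → Fin (n G) → Set where
  here : ∀ {u} → Reach G ok u u
  step : ∀ {u v w} → E G u v → ok v → Reach G ok v w → Reach G ok u w

IsCliqueCutset : (G : Graph) → (Fin (n G) → Bool) → Set
IsCliqueCutset G K =
  (∀ x y → K x ≡ true → K y ≡ true → x ≢ y → E G x y)
  × (Σ (Fin (n G)) λ u → Σ (Fin (n G)) λ v →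
       (K u ≡ false) × (K v ≡ false) × ¬ Reach G (λ w → K w ≡ false) u v)

HasCliqueCutset : Graph → Set
HasCliqueCutset G = Σ (Fin (n G) → Bool) λ K → IsCliqueCutset G K

InducedPathOn : (G : Graph) → Fin (n G) → Fin (n G) → (Fin (n G) → Set) → Set
InducedPathOn G a b S = Σ (List (Fin (n G))) λ l →
  IsPath G a b l × (∀ v → S v ⇔ v ∈ l)
  × (∀ u v → u ∈ l → v ∈ l → E G u v → ConsecIn l u v)

IsProper2Cutset : (G : Graph) → Fin (n G) → Fin (n G) → Set
IsProper2Cutset G a b =
  (a ≢ b) × (adj G a b ≡ false) ×
  Σ (Fin (n G) → Bool) λ side →
    let inX : Fin (n G) → Set
        inX v = (v ≢ a) × (v ≢ b) × (side v ≡ true)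
        inY : Fin (n G) → Set
        inY v = (v ≢ a) × (v ≢ b) × (side v ≡ false)
    in (Σ (Fin (n G)) inX) × (Σ (Fin (n G)) inY)
       × (∀ u v → inX u → inY v → ¬ E G u v)
       × ¬ InducedPathOn G a b (λ v → (v ≡ a) ⊎ (v ≡ b) ⊎ inX v)
       × ¬ InducedPathOn G a b (λ v → (v ≡ a) ⊎ (v ≡ b) ⊎ inY v)

HasProper2Cutset : Graph → Set
HasProper2Cutset G = Σ (Fin (n G)) λ a → Σ (Fin (n G)) λ b → IsProper2Cutset G a b

{-# OPTIONS --safe #-}
module Submission where

-- Assume that there is neither a clique cutset nor a proper 2-cutset; then every edge lies in at most one triangle, since
-- a path joining two common neighbours of b and c in the graph without b and c closes up to a wheel.
--
-- Suppose first that there is a triangle abc. By connectivity it lies in a prism; take one whose path R from a to the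
-- opposite triangle is shortest. A path outside the prism that joins R to the two other paths either stays at one of
-- the two triangles, or it yields an ISK4, a wheel, or a prism with a shorter R. Hence the ends of R form a 2-cutset,
-- unless a has degree 3 and the inner vertices of R have degree 2. Walking along such paths from triangle to triangle
-- exhausts the graph, which is therefore claw-free. A claw-free graph all of whose edges lie in at most one triangle is
-- the line graph of a graph of maximum degree at most three, and a chord of a cycle of the latter is the hub of a wheel.
--
-- Suppose now that there is no triangle, and take a subdivision of K4 with the fewest vertices. If it is not induced, a
-- chord either leads to a smaller one, or to a wheel, or to a K3,3. The vertices with two neighbours in one side of a
-- K3,3 form a complete bipartite graph, and a component of the rest sees at most one vertex on each side: a clique.
--
-- Cutsets, claws and bipartitions are found by finite search, and being series-parallel is a negation; so every
-- structural argument derives a contradiction and may use case distinctions on undecided propositions.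

-- With triangles present, one observation does most of the work: when a path leads from a corner of
-- a triangle to a hole through the opposite edge, its last vertex sees either a single end of that
-- edge or exactly two consecutive vertices of the hole; everything else is an ISK4 or a wheel. A
-- consecutive pair splits the hole into two rungs, which is where prisms come from, and inside a
-- prism it reroutes two rungs and shortens the third. This is why a single rung is minimised and
-- not the whole prism. Without triangles the key fact is that K3,3 minus an edge is a subdivision
-- of K4, so a smallest subdivision with a chord between opposite paths has nothing to lose and is
-- K3,3 itself. The obstacle is bookkeeping: each surgery rearranges up to nine paths, and the
-- result must have distinct vertices and fewer of them. Both demands are inequalities between
-- additive functions of lists (occurrences of a vertex, length), so one computation on formal
-- concatenations settles them.

open import Defs
open import Data.Bool using (Bool; true; false; if_then_else_; T; _xor_)
import Data.Bool.Properties as Bool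
open import Data.Bool.Properties using (T?)
open import Data.Empty using (⊥; ⊥-elim)
open import Data.Fin using (Fin; zero; suc; _↑ˡ_; _↑ʳ_; splitAt)
import Data.Fin as F
open import Data.Fin.Patterns
open import Data.Fin.Properties using (_≟_; any?; all?; splitAt-↑ˡ; splitAt-↑ʳ; toℕ-injective; ¬∀⟶∃¬) renaming (<-cmp to <ꟳ-cmp)
open import Data.Fin.Subset using (Subset)
open import Data.Fin.Subset.Properties using (anySubset?)
open import Data.List using (List; []; _∷_; _++_; [_]; length; reverse; filterᵇ; tabulate; allFin)
open import Data.List.Membership.Propositional using (_∈_; _∉_)
open import Data.List.Membership.Propositional.Properties using (∈-++⁺ˡ; ∈-++⁺ʳ; ∈-++⁻; ∈-∃++; ∈-length; ∈-allFin)
open import Data.List.Properties using (++-assoc; unfold-reverse; reverse-++; length-++; length-reverse; reverse-involutive; ++-identityʳ; ∷-injective; ∷-injectiveˡ; ∷-injectiveʳ)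
open import Data.List.Relation.Binary.Subset.Propositional using (_⊆_)
open import Data.List.Relation.Unary.All as All using ([]; _∷_)
open import Data.List.Relation.Unary.All.Properties using (tabulate⁺)
open import Data.List.Relation.Unary.AllPairs using ([]; _∷_)
import Data.List.Relation.Unary.AllPairs.Properties as AP
open import Data.List.Relation.Unary.Any as Any using (Any; here; there)
open import Data.List.Relation.Unary.Any.Properties using (reverse⁺; reverse⁻)
open import Data.List.Relation.Unary.Unique.Propositional using (Unique)
import Data.List.Relation.Unary.Unique.Propositional.Properties as UP
open import Data.Maybe using (Maybe; just; nothing)
open import Data.Nat using (ℕ; zero; suc; _+_; _≤_; _<_; z≤n; s≤s; _≤?_)
open import Data.Nat.Properties using (≤-trans; ≤-refl; ≤-reflexive; ≤-antisym; ≤∧≢⇒<; ≮⇒≥; <-irrefl; <-asym; +-assoc; +-comm; +-identityʳ; +-monoʳ-≤; +-mono-≤; m≤n+m; m<m+n; suc-injective)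
open import Data.Product using (Σ; _×_; _,_; proj₁; proj₂)
open import Data.Sum using (_⊎_; inj₁; inj₂)
open import Data.Unit using (⊤; tt)
open import Data.Vec as Vec using (Vec; []; _∷_; lookup)
open import Data.Vec.Properties using (lookup∘tabulate)
open import Function using (_∘_; id; case_of_)
open import Function.Bundles using (Equivalence; mk⇔)
open import Relation.Binary.Definitions using (tri<; tri≈; tri>)
open import Relation.Binary.PropositionalEquality using (_≡_; _≢_; refl; sym; trans; cong; cong₂; subst; subst₂; ≢-sym)
open import Relation.Nullary using (¬_; Dec; yes; no; does)
open import Relation.Nullary.Decidable using (_⊎-dec_; _×-dec_; _→-dec_; ¬?; from-yes; decidable-stable; dec-true; dec-false)

-- Induced paths and holes

module _ {A : Set} where

  firstSat : {P : A → Set} → (∀ x → Dec (P x)) → ∀ {l} → Any P l →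
    Σ (List A) λ p → Σ A λ x → Σ (List A) λ q → (l ≡ p ++ x ∷ q) × P x × (∀ {y} → y ∈ p → ¬ P y)
  firstSat P? {x ∷ l} a with P? x
  ... | yes px = [] , x , l , refl , px , λ ()
  firstSat P? {x ∷ l} (here px) | no ¬px = ⊥-elim (¬px px)
  firstSat P? {x ∷ l} (there a) | no ¬px with firstSat P? a
  ... | p , y , q , refl , py , h = x ∷ p , y , q , refl , py , λ { (here refl) → ¬px ; (there i) → h i }

  lastSat : {P : A → Set} → (∀ x → Dec (P x)) → ∀ {l} → Any P l →
    Σ (List A) λ p → Σ A λ x → Σ (List A) λ q → (l ≡ p ++ x ∷ q) × P x × (∀ {y} → y ∈ q → ¬ P y)
  lastSat {P} P? {x ∷ l} a with Any.any? P? l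
  ... | yes b with lastSat P? b
  ... | p , y , q , refl , py , h = x ∷ p , y , q , refl , py , h
  lastSat P? {x ∷ l} (here px) | no ¬b = [] , x , l , refl , px , λ i py → ¬b (Any.map (λ { refl → py }) i)
  lastSat P? {x ∷ l} (there a) | no ¬b = ⊥-elim (¬b a)

  ∈⇒Any : {P : A → Set} → ∀ {x l} → x ∈ l → P x → Any P l
  ∈⇒Any {P} i px = Any.map (λ e → subst P e px) i

  Any⇒∈ : {P : A → Set} → ∀ {l} → Any P l → Σ A λ x → (x ∈ l) × P x
  Any⇒∈ (here px) = _ , here refl , px
  Any⇒∈ (there a) = let x , i , px = Any⇒∈ a in x , there i , px

  three⇒3≤length : ∀ {x y z : A} {l} → x ≢ y → x ≢ z → y ≢ z → x ∈ l → y ∈ l → z ∈ l → 3 ≤ length l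
  three⇒3≤length {l = a ∷ []} xy xz yz (here refl) (here refl) k = ⊥-elim (xy refl)
  three⇒3≤length {l = a ∷ b ∷ []} xy xz yz (here refl) (here refl) k = ⊥-elim (xy refl)
  three⇒3≤length {l = a ∷ b ∷ []} xy xz yz (here refl) (there (here refl)) (here refl) = ⊥-elim (xz refl)
  three⇒3≤length {l = a ∷ b ∷ []} xy xz yz (here refl) (there (here refl)) (there (here refl)) = ⊥-elim (yz refl)
  three⇒3≤length {l = a ∷ b ∷ []} xy xz yz (there (here refl)) (there (here refl)) k = ⊥-elim (xy refl)
  three⇒3≤length {l = a ∷ b ∷ []} xy xz yz (there (here refl)) (here refl) (here refl) = ⊥-elim (yz refl)
  three⇒3≤length {l = a ∷ b ∷ []} xy xz yz (there (here refl)) (here refl) (there (here refl)) = ⊥-elim (xz refl)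
  three⇒3≤length {l = a ∷ b ∷ c ∷ l} xy xz yz i j k = s≤s (s≤s (s≤s z≤n))

  ∈-filterᵇ⁺ : ∀ (f : A → Bool) {x l} → x ∈ l → f x ≡ true → x ∈ filterᵇ f l
  ∈-filterᵇ⁺ f {x} {y ∷ l} (here refl) e with f x
  ... | true = here refl
  ∈-filterᵇ⁺ f {x} {y ∷ l} (here refl) () | false
  ∈-filterᵇ⁺ f {x} {y ∷ l} (there i) e with f y
  ... | true  = there (∈-filterᵇ⁺ f i e)
  ... | false = ∈-filterᵇ⁺ f i e

  cast∈ : ∀ {x : A} {l m} → l ≡ m → x ∈ l → x ∈ m
  cast∈ refl i = i

  subst∈ : ∀ {x y : A} {l} → x ≡ y → x ∈ l → y ∈ l
  subst∈ refl i = i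

  l⊆ : ∀ {p : List A} (q : List A) → p ⊆ (p ++ q)
  l⊆ q i = ∈-++⁺ˡ i

  r⊆ : ∀ (p : List A) {q} → q ⊆ (p ++ q)
  r⊆ p i = ∈-++⁺ʳ p i

  ++-⊆ : ∀ p {q m : List A} → p ⊆ m → q ⊆ m → (p ++ q) ⊆ m
  ++-⊆ p f g i with ∈-++⁻ p i
  ... | inj₁ j = f j
  ... | inj₂ j = g j

  ++-mono : ∀ p {q p' q' : List A} → p ⊆ p' → q ⊆ q' → (p ++ q) ⊆ (p' ++ q')
  ++-mono p {p' = p'} f g = ++-⊆ p (∈-++⁺ˡ ∘ f) (∈-++⁺ʳ p' ∘ g)

  rev⊆ : ∀ (p : List A) → reverse p ⊆ p
  rev⊆ p i = reverse⁻ i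

  [x]⊆ : ∀ {x : A} {l} → x ∈ l → [ x ] ⊆ l
  [x]⊆ i (here refl) = i

  unique-++ʳ : ∀ p {q : List A} → Unique (p ++ q) → Unique q
  unique-++ʳ [] h = h
  unique-++ʳ (_ ∷ p) (_ ∷ h) = unique-++ʳ p h

  unique-≢ : ∀ p {q : List A} {x y} → Unique (p ++ q) → x ∈ p → y ∈ q → x ≢ y
  unique-≢ (_ ∷ p) (a ∷ _) (here refl) j = All.lookup a (∈-++⁺ʳ p j)
  unique-≢ (_ ∷ p) (_ ∷ u) (there i) j = unique-≢ p u i j

  ConsecIn-∷ : ∀ {l : List A} {u v} x → ConsecIn l u v → ConsecIn (x ∷ l) u v
  ConsecIn-∷ x (p , q , inj₁ e) = x ∷ p , q , inj₁ (cong (x ∷_) e)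
  ConsecIn-∷ x (p , q , inj₂ e) = x ∷ p , q , inj₂ (cong (x ∷_) e)

  ConsecIn-++ˡ : ∀ {l : List A} {u v} m → ConsecIn l u v → ConsecIn (l ++ m) u v
  ConsecIn-++ˡ m (p , q , inj₁ refl) = p , q ++ m , inj₁ (++-assoc p _ m)
  ConsecIn-++ˡ m (p , q , inj₂ refl) = p , q ++ m , inj₂ (++-assoc p _ m)

  ConsecIn-sym : ∀ {l : List A} {u v} → ConsecIn l u v → ConsecIn l v u
  ConsecIn-sym (p , q , inj₁ e) = p , q , inj₂ e
  ConsecIn-sym (p , q , inj₂ e) = p , q , inj₁ e

module Basics (G : Graph) where

  V : Set
  V = Fin (n G)

  infix 4 _~_ _#_ _##_ _~?_

  _~_ : V → V → Set
  x ~ y = E G x y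

  _~?_ : ∀ x y → Dec (x ~ y)
  x ~? y = adj G x y Bool.≟ true

  ~-sym : ∀ {x y} → x ~ y → y ~ x
  ~-sym {x} {y} e = trans (adj-sym G y x) e

  ~-irr : ∀ {x} → ¬ (x ~ x)
  ~-irr {x} e with trans (sym e) (adj-irr G x)
  ... | ()

  ~⇒≢ : ∀ {x y} → x ~ y → x ≢ y
  ~⇒≢ e refl = ~-irr e

  _#_ : V → V → Set
  x # y = (x ≢ y) × ¬ (x ~ y)

  #-sym : ∀ {x y} → x # y → y # x
  #-sym (a , b) = (λ e → a (sym e)) , (λ e → b (~-sym e))

  _∈?_ : ∀ (x : V) l → Dec (x ∈ l)
  x ∈? l = Any.any? (x ≟_) l

  -- A record, not a bare function type, so that both lists can be recovered by unification.
  record _##_ (l m : List V) : Set where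
    constructor mk##
    field at : ∀ {x y} → x ∈ l → y ∈ m → x # y
  open _##_ public

  ##-sym : ∀ {l m} → l ## m → m ## l
  ##-sym h = mk## λ i j → #-sym (at h j i)

  ##-⊆ : ∀ {l m l' m'} → l' ⊆ l → m' ⊆ m → l ## m → l' ## m'
  ##-⊆ f g h = mk## λ i j → at h (f i) (g j)

  ##-⊆ˡ : ∀ {l m l'} → l' ⊆ l → l ## m → l' ## m
  ##-⊆ˡ f = ##-⊆ f id

  ##-⊆ʳ : ∀ {l m m'} → m' ⊆ m → l ## m → l ## m'
  ##-⊆ʳ g = ##-⊆ id g

  []## : ∀ {m} → [] ## m
  []## = mk## λ ()

  ##[] : ∀ {m} → m ## []
  ##[] = mk## λ _ ()

  ##-++ˡ : ∀ {l l' m} → l ## m → l' ## m → (l ++ l') ## m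
  ##-++ˡ {l} h h' = mk## λ i j → case ∈-++⁻ l i of λ { (inj₁ k) → at h k j ; (inj₂ k) → at h' k j }

  ##-++ʳ : ∀ {l m m'} → l ## m → l ## m' → l ## (m ++ m')
  ##-++ʳ {m = m} h h' = mk## λ i j → case ∈-++⁻ m j of λ { (inj₁ k) → at h i k ; (inj₂ k) → at h' i k }

  #→## : ∀ {x y} → x # y → [ x ] ## [ y ]
  #→## h = mk## λ { (here refl) (here refl) → h }

  ##-cons : ∀ {x l m} → [ x ] ## m → l ## m → (x ∷ l) ## m
  ##-cons = ##-++ˡ

  ##-consʳ : ∀ {l x m} → l ## [ x ] → l ## m → l ## (x ∷ m)
  ##-consʳ = ##-++ʳ

  ##-revˡ : ∀ l {m} → l ## m → reverse l ## m
  ##-revˡ l = ##-⊆ˡ (rev⊆ l)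

  ##-revʳ : ∀ {l} m → l ## m → l ## reverse m
  ##-revʳ m = ##-⊆ʳ (rev⊆ m)

  mk[]## : ∀ {x m} → (∀ {y} → y ∈ m → x # y) → [ x ] ## m
  mk[]## h = mk## λ { (here refl) j → h j }

  -- Induced paths: every vertex is adjacent to its successor and anticomplete to all later ones.
  -- Since `#` includes distinctness, no vertex repeats.
  IP : List V → Set
  IP [] = ⊤
  IP (x ∷ []) = ⊤
  IP (x ∷ y ∷ l) = (x ~ y) × ([ x ] ## l) × IP (y ∷ l)

  IP-tail : ∀ {x l} → IP (x ∷ l) → IP l
  IP-tail {l = []} h = tt
  IP-tail {l = y ∷ l} (_ , _ , h) = h

  IP-head : ∀ {x y l} → IP (x ∷ y ∷ l) → x ~ y
  IP-head (h , _) = h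

  IP-anti : ∀ {x y l} → IP (x ∷ y ∷ l) → [ x ] ## l
  IP-anti (_ , h , _) = h

  -- The pieces overlap in `y`, whose relations to both are already known; only the pairs between
  -- `p` and `q` remain.
  IP-glue : ∀ p {y q} → IP (p ++ [ y ]) → IP (y ∷ q) → p ## q → IP (p ++ y ∷ q)
  IP-glue [] h h' a = h'
  IP-glue (x ∷ []) (e , _) h' a = e , a , h'
  IP-glue (x ∷ x' ∷ p) {y} {q} (e , b , h) h' a =
    e , mk## (λ { (here refl) j → case ∈-++⁻ p j of λ
      { (inj₁ k) → at b (here refl) (∈-++⁺ˡ k)
      ; (inj₂ (here refl)) → at b (here refl) (∈-++⁺ʳ p (here refl))
      ; (inj₂ (there k)) → at a (here refl) k } })
    , IP-glue (x' ∷ p) h h' (##-⊆ˡ there a)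

  IP-split : ∀ p {y q} → IP (p ++ y ∷ q) → IP (p ++ [ y ]) × IP (y ∷ q) × p ## q
  IP-split [] h = tt , h , []##
  IP-split (x ∷ []) (e , a , h) = (e , ##[] , tt) , h , a
  IP-split (x ∷ x' ∷ p) {y} {q} (e , a , h) with IP-split (x' ∷ p) h
  ... | h₁ , h₂ , b = (e , ##-⊆ʳ (++-mono p id (λ { (here refl) → here refl })) a , h₁) , h₂ , ##-cons (##-⊆ʳ (r⊆ p ∘ there) a) b

  IP-++ʳ : ∀ p {q} → IP (p ++ q) → IP q
  IP-++ʳ [] h = h
  IP-++ʳ (x ∷ p) h = IP-++ʳ p (IP-tail h)

  IP-++ˡ : ∀ p {q} → IP (p ++ q) → IP p
  IP-++ˡ [] h = tt
  IP-++ˡ (x ∷ []) h = tt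
  IP-++ˡ (x ∷ y ∷ p) (e , a , h) = e , ##-⊆ʳ (l⊆ _) a , IP-++ˡ (y ∷ p) h

  IP-cat : ∀ p {x y q} → IP (p ++ [ x ]) → IP (y ∷ q) → x ~ y → p ## (y ∷ q) → [ x ] ## q → IP (p ++ x ∷ y ∷ q)
  IP-cat p h h' e a b = IP-glue p h (e , b , h') a

  IP-rev : ∀ l → IP l → IP (reverse l)
  IP-rev [] h = tt
  IP-rev (x ∷ []) h = tt
  IP-rev (x ∷ y ∷ l) (e , a , h) =
    subst IP (sym eq) (IP-glue (reverse l) (subst IP (unfold-reverse y l) (IP-rev (y ∷ l) h)) (~-sym e , ##[] , tt) (##-revˡ l (##-sym a)))
    where
    eq : reverse (x ∷ y ∷ l) ≡ reverse l ++ y ∷ x ∷ []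
    eq = trans (unfold-reverse x (y ∷ l)) (trans (cong (_++ [ x ]) (unfold-reverse y l)) (++-assoc (reverse l) _ _))

  IP-uniq : ∀ {l} → IP l → Unique l
  IP-uniq {[]} h = []
  IP-uniq {x ∷ []} h = [] ∷ []
  IP-uniq {x ∷ y ∷ l} (e , a , h) = All.tabulate (λ { (here refl) → ~⇒≢ e ; (there i) → proj₁ (at a (here refl) i) }) ∷ IP-uniq h

  IP⇒Consec : ∀ {l} → IP l → Consec _~_ l
  IP⇒Consec {[]} h = tt
  IP⇒Consec {x ∷ []} h = tt
  IP⇒Consec {x ∷ y ∷ l} (e , a , h) = e , IP⇒Consec h

  IP-ConsecIn : ∀ {l u v} → IP l → u ∈ l → v ∈ l → u ~ v → ConsecIn l u v
  IP-ConsecIn {x ∷ l} h (here refl) (here refl) e = ⊥-elim (~-irr e)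
  IP-ConsecIn {x ∷ y ∷ l} h (here refl) (there (here refl)) e = [] , l , inj₁ refl
  IP-ConsecIn {x ∷ y ∷ l} (_ , a , h) (here refl) (there (there j)) e = ⊥-elim (proj₂ (at a (here refl) j) e)
  IP-ConsecIn {x ∷ y ∷ l} h (there (here refl)) (here refl) e = [] , l , inj₂ refl
  IP-ConsecIn {x ∷ y ∷ l} (_ , a , h) (there (there i)) (here refl) e = ⊥-elim (proj₂ (at a (here refl) i) (~-sym e))
  IP-ConsecIn {x ∷ l} h (there i) (there j) e = ConsecIn-∷ x (IP-ConsecIn (IP-tail h) i j e)

  -- b ∷ M ++ [ c ] is an induced cycle, cut open at the edge bc.
  record Hole (b : V) (M : List V) (c : V) : Set where
    constructor mkHole
    field
      hpˡ : IP (b ∷ M)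
      hpʳ : IP (M ++ [ c ])
      hpᶜ : b ~ c
  open Hole public

  Hole-rot : ∀ {b m M c} → Hole b (m ∷ M) c → Hole m (M ++ [ c ]) b
  Hole-rot {b} {m} {M} {c} (mkHole l r e) = mkHole r
    (subst IP (sym (++-assoc M [ c ] [ b ])) (IP-glue M (IP-++ʳ [ m ] r) (~-sym e , ##[] , tt) (##-sym (IP-anti l))))
    (~-sym (IP-head l))

  Hole-rev : ∀ {b M c} → Hole b M c → Hole c (reverse M) b
  Hole-rev {b} {M} {c} (mkHole l r e) = mkHole
    (subst IP (reverse-++ M [ c ]) (IP-rev (M ++ [ c ]) r))
    (subst IP (unfold-reverse b M) (IP-rev (b ∷ M) l))
    (~-sym e)

  Consec-snoc : ∀ p {x y} → Consec _~_ (p ++ [ x ]) → x ~ y → Consec _~_ ((p ++ [ x ]) ++ [ y ])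
  Consec-snoc [] h e = e , tt
  Consec-snoc (z ∷ []) (h , _) e = h , e , tt
  Consec-snoc (z ∷ z' ∷ p) (h , h') e = h , Consec-snoc (z' ∷ p) h' e

  Hole-cycle : ∀ {b m M c} → Hole b (m ∷ M) c → IsCycle G (b ∷ (m ∷ M) ++ [ c ])
  Hole-cycle {b} {m} {M} {c} (mkHole l r e) = b , (m ∷ M) ++ [ c ] , refl , s≤s (len M) ,
      (All.tabulate (λ i → case ∈-++⁻ (m ∷ M) i of λ { (inj₁ (here refl)) → ~⇒≢ (IP-head l) ; (inj₁ (there j)) → proj₁ (at (IP-anti l) (here refl) j) ; (inj₂ (here refl)) → ~⇒≢ e }) ∷ IP-uniq r) ,
      (IP-head l , Consec-snoc (m ∷ M) (IP⇒Consec r) (~-sym e))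
    where
    len : ∀ (M : List V) → 1 ≤ length (M ++ [ c ])
    len [] = s≤s z≤n
    len (x ∷ M) = s≤s z≤n

  Hole-chordless : ∀ {b m M c} → Hole b (m ∷ M) c → CycleChordless G (b ∷ (m ∷ M) ++ [ c ])
  Hole-chordless {b} {m} {M} {c} (mkHole l r e) u v i j uv = go u v i j uv
    where
    cyc = b ∷ ((m ∷ M) ++ [ c ]) ++ [ b ]
    bm : ∀ {v} → v ∈ ((m ∷ M) ++ [ c ]) → b ~ v → ConsecIn cyc b v
    bm {v} j bv with ∈-++⁻ (m ∷ M) j
    ... | inj₁ k = subst (λ l → ConsecIn l b v) (cong (b ∷_) (sym (++-assoc (m ∷ M) [ c ] [ b ]))) (ConsecIn-++ˡ ([ c ] ++ [ b ]) (IP-ConsecIn l (here refl) (there k) bv))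
    ... | inj₂ (here refl) = b ∷ m ∷ M , [] , inj₂ (cong (b ∷_) (++-assoc (m ∷ M) [ c ] [ b ]))
    go : ∀ u v → u ∈ (b ∷ (m ∷ M) ++ [ c ]) → v ∈ (b ∷ (m ∷ M) ++ [ c ]) → u ~ v → ConsecIn cyc u v
    go u v (here refl) (here refl) uv = ⊥-elim (~-irr uv)
    go u v (here refl) (there j) uv = bm j uv
    go u v (there i) (here refl) uv = ConsecIn-sym (bm i (~-sym uv))
    go u v (there i) (there j) uv = ConsecIn-∷ b (ConsecIn-++ˡ [ b ] (IP-ConsecIn r i j uv))

  Hole-uniq : ∀ {b M c} → Hole b M c → Unique (b ∷ M ++ [ c ])
  Hole-uniq {M = m ∷ M} h = proj₁ (proj₂ (proj₂ (proj₂ (proj₂ (Hole-cycle h)))))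
  Hole-uniq {M = []} h = (~⇒≢ (hpᶜ h) ∷ []) ∷ [] ∷ []

  -- With `M` empty a `Hole` is a mere edge, which three distinct neighbours rule out. Triangles
  -- count as holes, just as they count as cycles.
  Hole-wheel : ∀ {b M c z x₁ x₂ x₃} → Hole b M c → z ∉ (b ∷ M ++ [ c ]) →
    x₁ ∈ (b ∷ M ++ [ c ]) → x₂ ∈ (b ∷ M ++ [ c ]) → x₃ ∈ (b ∷ M ++ [ c ]) →
    x₁ ≢ x₂ → x₁ ≢ x₃ → x₂ ≢ x₃ → z ~ x₁ → z ~ x₂ → z ~ x₃ → HasWheel G
  Hole-wheel {M = []} h z∉ i₁ i₂ i₃ d₁ d₂ d₃ e₁ e₂ e₃ with three⇒3≤length d₁ d₂ d₃ i₁ i₂ i₃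
  ... | s≤s (s≤s ())
  Hole-wheel {b} {m ∷ M} {c} {z} h z∉ i₁ i₂ i₃ d₁ d₂ d₃ e₁ e₂ e₃ =
    b ∷ (m ∷ M) ++ [ c ] , Hole-cycle h , Hole-chordless h , z , z∉ ,
    three⇒3≤length d₁ d₂ d₃ (∈-filterᵇ⁺ (adj G z) i₁ e₁) (∈-filterᵇ⁺ (adj G z) i₂ e₂) (∈-filterᵇ⁺ (adj G z) i₃ e₃)

  -- Paths that need not be induced. Distinctness is left out on purpose: a subdivision states it
  -- once for all of its paths together.
  Link : V → List V → V → Set
  Link x l y = Consec _~_ (x ∷ l ++ [ y ])

  link-split : ∀ {x y} A {u B} → Link x (A ++ u ∷ B) y → Link x A u × Link u B y
  link-split [] (e , h) = (e , tt) , h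
  link-split (z ∷ A) (e , h) = let h₁ , h₂ = link-split A h in (e , h₁) , h₂

  link-join : ∀ {x y} A {u B} → Link x A u → Link u B y → Link x (A ++ u ∷ B) y
  link-join [] (e , _) h = e , h
  link-join (z ∷ A) (e , h) h' = e , link-join A h h'

  link-rev : ∀ {x y} l → Link x l y → Link y (reverse l) x
  link-rev [] (e , _) = ~-sym e , tt
  link-rev {x} {y} (z ∷ l) (e , h) = subst (λ m → Link y m x) (sym (unfold-reverse z l)) (link-join (reverse l) (link-rev l h) (~-sym e , tt))

-- Subdivisions of K4

module Multiset {A : Set} where

  -- Formal concatenations of k lists; inclusions of multisets between them are decided by computation.
  data Ex (k : ℕ) : Set where
    ∅   : Ex k
    var : Fin k → Ex k
    _⊕_ : Ex k → Ex k → Ex k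
    rv  : Ex k → Ex k
  infixr 5 _⊕_

  ⟦_⟧ : ∀ {k} → Ex k → Vec (List A) k → List A
  ⟦ ∅ ⟧ ρ = []
  ⟦ var i ⟧ ρ = lookup ρ i
  ⟦ e ⊕ e' ⟧ ρ = ⟦ e ⟧ ρ ++ ⟦ e' ⟧ ρ
  ⟦ rv e ⟧ ρ = reverse (⟦ e ⟧ ρ)

  flatten : ∀ {k} → Ex k → List (Fin k)
  flatten ∅ = []
  flatten (var i) = [ i ]
  flatten (e ⊕ e') = flatten e ++ flatten e'
  flatten (rv e) = flatten e

  remove : ∀ {k} → Fin k → List (Fin k) → Maybe (List (Fin k))
  remove i [] = nothing
  remove i (j ∷ l) with i ≟ j
  ... | yes _ = just l
  ... | no _ with remove i l
  ... | just l' = just (j ∷ l')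
  ... | nothing = nothing

  sub : ∀ {k} → List (Fin k) → List (Fin k) → Bool
  sub [] m = true
  sub (i ∷ l) m with remove i m
  ... | just m' = sub l m'
  ... | nothing = false

  record Additive (f : List A → ℕ) : Set where
    field
      f-[]  : f [] ≡ 0
      f-++  : ∀ l m → f (l ++ m) ≡ f l + f m
      f-rev : ∀ l → f (reverse l) ≡ f l

  module _ {f : List A → ℕ} (ad : Additive f) {k} (ρ : Vec (List A) k) where
    open Additive ad

    total : List (Fin k) → ℕ
    total [] = 0
    total (i ∷ l) = f (lookup ρ i) + total l

    total-++ : ∀ l m → total (l ++ m) ≡ total l + total m
    total-++ [] m = refl
    total-++ (i ∷ l) m = trans (cong (f (lookup ρ i) +_) (total-++ l m)) (sym (+-assoc (f (lookup ρ i)) _ _))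

    f-flatten : ∀ e → f (⟦ e ⟧ ρ) ≡ total (flatten e)
    f-flatten ∅ = f-[]
    f-flatten (var i) = sym (+-identityʳ _)
    f-flatten (e ⊕ e') = trans (f-++ _ _) (trans (cong₂ _+_ (f-flatten e) (f-flatten e')) (sym (total-++ (flatten e) (flatten e'))))
    f-flatten (rv e) = trans (f-rev _) (f-flatten e)

    remove-total : ∀ i l {l'} → remove i l ≡ just l' → total l ≡ f (lookup ρ i) + total l'
    remove-total i (j ∷ l) eq with i ≟ j
    remove-total i (.i ∷ l) refl | yes refl = refl
    remove-total i (j ∷ l) eq | no _ with remove i l in r
    remove-total i (j ∷ l) refl | no _ | just l' =
      trans (cong (f (lookup ρ j) +_) (remove-total i l r))
        (trans (sym (+-assoc (f (lookup ρ j)) _ _)) (trans (cong (_+ total l') (+-comm (f (lookup ρ j)) _)) (+-assoc (f (lookup ρ i)) _ _)))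
    remove-total i (j ∷ l) () | no _ | nothing

    sub-total : ∀ l m → T (sub l m) → total l ≤ total m
    sub-total [] m t = z≤n
    sub-total (i ∷ l) m t with remove i m in r
    ... | just m' = ≤-trans (+-monoʳ-≤ _ (sub-total l m' t)) (≤-reflexive (sym (remove-total i m r)))
    sub-total (i ∷ l) m () | nothing

    -- The inclusion test looks at variables only, so it computes as soon as the expressions are
    -- concrete. With `f` a count this transfers distinctness from one arrangement of paths to
    -- another; with `f` the length it compares their sizes.
    mono : ∀ e e' → {_ : T (sub (flatten e) (flatten e'))} → f (⟦ e ⟧ ρ) ≤ f (⟦ e' ⟧ ρ)
    mono e e' {t} = ≤-trans (≤-reflexive (f-flatten e)) (≤-trans (sub-total (flatten e) (flatten e') t) (≤-reflexive (sym (f-flatten e'))))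

  length-additive : Additive length
  length-additive = record { f-[] = refl ; f-++ = λ l m → length-++ l ; f-rev = length-reverse }

module Count {k : ℕ} where
  open Multiset

  δ : Fin k → Fin k → ℕ
  δ x y = if does (x ≟ y) then 1 else 0

  cnt : Fin k → List (Fin k) → ℕ
  cnt x [] = 0
  cnt x (y ∷ l) = δ x y + cnt x l

  cnt-++ : ∀ x l m → cnt x (l ++ m) ≡ cnt x l + cnt x m
  cnt-++ x [] m = refl
  cnt-++ x (y ∷ l) m = trans (cong (δ x y +_) (cnt-++ x l m)) (sym (+-assoc (δ x y) _ _))

  cnt-rev : ∀ x l → cnt x (reverse l) ≡ cnt x l
  cnt-rev x [] = refl
  cnt-rev x (y ∷ l) = trans (cong (cnt x) (unfold-reverse y l)) (trans (cnt-++ x (reverse l) [ y ])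
    (trans (cong₂ _+_ (cnt-rev x l) (+-identityʳ (δ x y))) (+-comm (cnt x l) (δ x y))))

  cnt-additive : ∀ x → Additive (cnt x)
  cnt-additive x = record { f-[] = refl ; f-++ = cnt-++ x ; f-rev = cnt-rev x }

  ∈⇒cnt : ∀ {x l} → x ∈ l → 1 ≤ cnt x l
  ∈⇒cnt {x} {y ∷ l} (here refl) with x ≟ x
  ... | yes _ = s≤s z≤n
  ... | no ¬e = ⊥-elim (¬e refl)
  ∈⇒cnt {x} {y ∷ l} (there i) = ≤-trans (∈⇒cnt i) (m≤n+m _ _)

  ∉⇒cnt : ∀ {x l} → x ∉ l → cnt x l ≡ 0
  ∉⇒cnt {x} {[]} h = refl
  ∉⇒cnt {x} {y ∷ l} h with x ≟ y
  ... | yes refl = ⊥-elim (h (here refl))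
  ... | no _ = ∉⇒cnt (h ∘ there)

  cnt≤1⇒Unique : ∀ {l} → (∀ x → cnt x l ≤ 1) → Unique l
  cnt≤1⇒Unique {[]} h = []
  cnt≤1⇒Unique {y ∷ l} h = All.tabulate (λ i → λ { refl → lem i }) ∷ cnt≤1⇒Unique (λ x → ≤-trans (m≤n+m _ _) (h x))
    where
    lem : y ∉ l
    lem i with h y
    ... | q with y ≟ y
    ... | yes _ = case ≤-trans (s≤s (∈⇒cnt i)) q of λ { (s≤s ()) }
    ... | no ¬e = ¬e refl

  Unique⇒cnt≤1 : ∀ {l} → Unique l → ∀ x → cnt x l ≤ 1
  Unique⇒cnt≤1 [] x = z≤n
  Unique⇒cnt≤1 {y ∷ l} (a ∷ u) x with x ≟ y
  ... | yes refl = s≤s (≤-reflexive (∉⇒cnt (λ i → All.lookup a i refl)))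
  ... | no _ = Unique⇒cnt≤1 u x

module K4Subdivisions (G : Graph) where
  open Basics G
  open Multiset {V}
  open Count {n G}

  cells : (b₁ b₂ b₃ b₄ : V) (l₁₂ l₁₃ l₁₄ l₂₃ l₂₄ l₃₄ : List V) → Vec (List V) 10
  cells b₁ b₂ b₃ b₄ l₁₂ l₁₃ l₁₄ l₂₃ l₂₄ l₃₄ = [ b₁ ] ∷ [ b₂ ] ∷ [ b₃ ] ∷ [ b₄ ] ∷ l₁₂ ∷ l₁₃ ∷ l₁₄ ∷ l₂₃ ∷ l₂₄ ∷ l₃₄ ∷ []

  -- The final `[]` makes this list equal by computation to the value of `all10` at `cells`.
  verts : (b₁ b₂ b₃ b₄ : V) (l₁₂ l₁₃ l₁₄ l₂₃ l₂₄ l₃₄ : List V) → List V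
  verts b₁ b₂ b₃ b₄ l₁₂ l₁₃ l₁₄ l₂₃ l₂₄ l₃₄ = b₁ ∷ b₂ ∷ b₃ ∷ b₄ ∷ l₁₂ ++ l₁₃ ++ l₁₄ ++ l₂₃ ++ l₂₄ ++ l₃₄ ++ []

  all10 : Ex 10
  all10 = var 0F ⊕ var 1F ⊕ var 2F ⊕ var 3F ⊕ var 4F ⊕ var 5F ⊕ var 6F ⊕ var 7F ⊕ var 8F ⊕ var 9F ⊕ ∅

  -- A subdivision of K4 given by its branch vertices and the interiors of its six paths. These are
  -- indices, so that a surgery can name the pieces of its result. `FromK4At` and `ToK4At` translate
  -- to and from `K4Subdivision`.
  record K4At (b₁ b₂ b₃ b₄ : V) (l₁₂ l₁₃ l₁₄ l₂₃ l₂₄ l₃₄ : List V) : Set where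
    constructor mkK4
    field
      k₁₂ : Link b₁ l₁₂ b₂
      k₁₃ : Link b₁ l₁₃ b₃
      k₁₄ : Link b₁ l₁₄ b₄
      k₂₃ : Link b₂ l₂₃ b₃
      k₂₄ : Link b₂ l₂₄ b₄
      k₃₄ : Link b₃ l₃₄ b₄
      uq  : ∀ x → cnt x (verts b₁ b₂ b₃ b₄ l₁₂ l₁₃ l₁₄ l₂₃ l₂₄ l₃₄) ≤ 1

  cix : Fin 4 → Fin 4 → Fin 10
  cix 0F 1F = 4F
  cix 0F 2F = 5F
  cix 0F 3F = 6F
  cix 1F 2F = 7F
  cix 1F 3F = 8F
  cix 2F 3F = 9F
  -- Arbitrary; only pairs with i < j are meant.
  cix _ _ = 0F

  bix : Fin 4 → Fin 10
  bix 0F = 0F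
  bix 1F = 1F
  bix 2F = 2F
  bix 3F = 3F

  cix-inj : ∀ i j k l → i F.< j → k F.< l → cix i j ≡ cix k l → (i ≡ k) × (j ≡ l)
  cix-inj = from-yes (all? λ i → all? λ j → all? λ k → all? λ l →
    (i F.<? j) →-dec ((k F.<? l) →-dec ((cix i j ≟ cix k l) →-dec ((i ≟ k) ×-dec (j ≟ l)))))

  cix≢br : ∀ i j m → i F.< j → cix i j ≢ bix m
  cix≢br = from-yes (all? λ i → all? λ j → all? λ m → (i F.<? j) →-dec ¬? (cix i j ≟ bix m))

  pair-sub : ∀ (i j : Fin 10) → i ≢ j → T (sub (i ∷ j ∷ []) (flatten all10))
  pair-sub = from-yes (all? λ i → all? λ j → ¬? (i ≟ j) →-dec T? (sub (i ∷ j ∷ []) (flatten all10)))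

  one-sub : ∀ (i : Fin 10) → T (sub (i ∷ []) (flatten all10))
  one-sub = from-yes (all? λ i → T? (sub (i ∷ []) (flatten all10)))

  pairs-elim : ∀ {Q : Fin 4 → Fin 4 → Set} → Q 0F 1F → Q 0F 2F → Q 0F 3F → Q 1F 2F → Q 1F 3F → Q 2F 3F → ∀ i j → i F.< j → Q i j
  pairs-elim a b c d e f 0F 1F _ = a
  pairs-elim a b c d e f 0F 2F _ = b
  pairs-elim a b c d e f 0F 3F _ = c
  pairs-elim a b c d e f 1F 2F _ = d
  pairs-elim a b c d e f 1F 3F _ = e
  pairs-elim a b c d e f 2F 3F _ = f
  pairs-elim a b c d e f 1F 1F (s≤s ())
  pairs-elim a b c d e f 2F 1F (s≤s ())
  pairs-elim a b c d e f 2F 2F (s≤s (s≤s ()))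
  pairs-elim a b c d e f 3F 1F (s≤s ())
  pairs-elim a b c d e f 3F 2F (s≤s (s≤s ()))
  pairs-elim a b c d e f 3F 3F (s≤s (s≤s (s≤s ())))

  module FromK4At {b₁ b₂ b₃ b₄ l₁₂ l₁₃ l₁₄ l₂₃ l₂₄ l₃₄} (K : K4At b₁ b₂ b₃ b₄ l₁₂ l₁₃ l₁₄ l₂₃ l₂₄ l₃₄) where
    open K4At K

    ρ : Vec (List V) 10
    ρ = cells b₁ b₂ b₃ b₄ l₁₂ l₁₃ l₁₄ l₂₃ l₂₄ l₃₄

    b : Fin 4 → V
    b = lookup (b₁ ∷ b₂ ∷ b₃ ∷ b₄ ∷ [])

    I : Fin 4 → Fin 4 → List V
    I i j = lookup ρ (cix i j)

    b∈ : ∀ m → b m ∈ lookup ρ (bix m)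
    b∈ 0F = here refl
    b∈ 1F = here refl
    b∈ 2F = here refl
    b∈ 3F = here refl

    -- A vertex lying in two different cells would be counted twice in `verts`.
    cell-disj : ∀ i j {x} → x ∈ lookup ρ i → x ∈ lookup ρ j → i ≡ j
    cell-disj i j {x} xi xj with i ≟ j
    ... | yes e = e
    ... | no i≢j = ⊥-elim (case ≤-trans (+-mono-≤ (∈⇒cnt xi) (∈⇒cnt xj)) (≤-trans (≤-reflexive (sym (cnt-++ x (lookup ρ i) (lookup ρ j))))
        (≤-trans (mono (cnt-additive x) ρ (var i ⊕ var j) all10 {pair-sub i j i≢j}) (uq x))) of λ { (s≤s ()) })

    cell-unique : ∀ i → Unique (lookup ρ i)
    cell-unique i = cnt≤1⇒Unique λ x → ≤-trans (mono (cnt-additive x) ρ (var i) all10 {one-sub i}) (uq x)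

    b-inj : ∀ i j → b i ≡ b j → i ≡ j
    b-inj i j e = inj i j (cell-disj (bix i) (bix j) (b∈ i) (subst (_∈ lookup ρ (bix j)) (sym e) (b∈ j)))
      where
      inj : ∀ (i j : Fin 4) → bix i ≡ bix j → i ≡ j
      inj = from-yes (all? λ i → all? λ j → (bix i ≟ bix j) →-dec (i ≟ j))

    b∉I : ∀ i j m → i F.< j → b m ∉ I i j
    b∉I i j m i<j x = cix≢br i j m i<j (cell-disj (cix i j) (bix m) x (b∈ m))

    link : ∀ i j → i F.< j → Link (b i) (I i j) (b j)
    link = pairs-elim k₁₂ k₁₃ k₁₄ k₂₃ k₂₄ k₃₄

    Pth : Fin 4 → Fin 4 → List V
    Pth i j = b i ∷ I i j ++ [ b j ]

    ∈Pth⁻ : ∀ i j {v} → v ∈ Pth i j → (v ≡ b i) ⊎ (v ≡ b j) ⊎ (v ∈ I i j)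
    ∈Pth⁻ i j (here e) = inj₁ e
    ∈Pth⁻ i j (there x) with ∈-++⁻ (I i j) x
    ... | inj₁ y = inj₂ (inj₂ y)
    ... | inj₂ (here e) = inj₂ (inj₁ e)

    <⇒≢ꟳ : ∀ (i j : Fin 4) → i F.< j → i ≢ j
    <⇒≢ꟳ i j i<j refl = <-irrefl refl i<j

    S : K4Subdivision G
    S = record
      { br = b ; br-inj = b-inj ; P = Pth
      ; P-path = λ i j i<j → (I i j , refl) ,
          (All.tabulate (λ x e → case ∈-++⁻ (I i j) x of λ
             { (inj₁ y) → b∉I i j i i<j (subst (_∈ I i j) (sym e) y)
             ; (inj₂ (here e')) → <⇒≢ꟳ i j i<j (b-inj i j (trans e e')) })
           ∷ UP.++⁺ (cell-unique (cix i j)) ([] ∷ []) (λ { (x , here refl) → b∉I i j j i<j x }))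
          , link i j i<j
      ; P-br = λ i j m i<j x → case ∈Pth⁻ i j x of λ
          { (inj₁ e) → inj₁ (b-inj m i e) ; (inj₂ (inj₁ e)) → inj₂ (b-inj m j e) ; (inj₂ (inj₂ y)) → ⊥-elim (b∉I i j m i<j y) }
      ; P-disj = λ i j k l i<j k<l ne v x y → case ∈Pth⁻ i j x of λ
          { (inj₁ e) → i , e ; (inj₂ (inj₁ e)) → j , e
          ; (inj₂ (inj₂ x')) → case ∈Pth⁻ k l y of λ
             { (inj₁ e) → k , e ; (inj₂ (inj₁ e)) → l , e
             ; (inj₂ (inj₂ y')) → ⊥-elim (ne (cix-inj i j k l i<j k<l (cell-disj (cix i j) (cix k l) x' y'))) } } }

  data Cell : Set where
    brC : Fin 4 → Cell
    inC : (i j : Fin 4) → i F.< j → Cell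

  decode : Fin 10 → Cell
  decode 0F = brC 0F
  decode 1F = brC 1F
  decode 2F = brC 2F
  decode 3F = brC 3F
  decode 4F = inC 0F 1F (s≤s z≤n)
  decode 5F = inC 0F 2F (s≤s z≤n)
  decode 6F = inC 0F 3F (s≤s z≤n)
  decode 7F = inC 1F 2F (s≤s (s≤s z≤n))
  decode 8F = inC 1F 3F (s≤s (s≤s z≤n))
  decode 9F = inC 2F 3F (s≤s (s≤s (s≤s z≤n)))

  encode : Cell → Fin 10
  encode (brC m) = bix m
  encode (inC i j _) = cix i j

  encode∘decode : ∀ i → encode (decode i) ≡ i
  encode∘decode = from-yes (all? λ i → encode (decode i) ≟ i)

  module ToK4At (S : K4Subdivision G) where
    open K4Subdivision S

    inner : ∀ i j → i F.< j → List V
    inner i j i<j = proj₁ (proj₁ (P-path i j i<j))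

    P≡ : ∀ i j (i<j : i F.< j) → P i j ≡ br i ∷ inner i j i<j ++ [ br j ]
    P≡ i j i<j = proj₂ (proj₁ (P-path i j i<j))

    P-unique : ∀ i j (i<j : i F.< j) → Unique (br i ∷ inner i j i<j ++ [ br j ])
    P-unique i j i<j = subst Unique (P≡ i j i<j) (proj₁ (proj₂ (P-path i j i<j)))

    P-link : ∀ i j (i<j : i F.< j) → Link (br i) (inner i j i<j) (br j)
    P-link i j i<j = subst (Consec _~_) (P≡ i j i<j) (proj₂ (proj₂ (P-path i j i<j)))

    content : Cell → List V
    content (brC m) = [ br m ]
    content (inC i j i<j) = inner i j i<j

    unique-++⁻ : ∀ (p : List V) {q} → Unique (p ++ q) → Unique p × (∀ {x} → x ∈ p → x ∉ q)
    unique-++⁻ [] u = [] , λ ()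
    unique-++⁻ (x ∷ p) {q} (a ∷ u) with unique-++⁻ p u
    ... | u' , d = (All.tabulate (λ i → All.lookup a (∈-++⁺ˡ i)) ∷ u') , λ { (here refl) j → All.lookup a (∈-++⁺ʳ p j) refl ; (there i) j → d i j }

    inner⊆ : ∀ i j (i<j : i F.< j) {v} → v ∈ inner i j i<j → v ∈ P i j
    inner⊆ i j i<j x = subst (_ ∈_) (sym (P≡ i j i<j)) (there (∈-++⁺ˡ x))

    br∉inner : ∀ i j (i<j : i F.< j) m → br m ∉ inner i j i<j
    br∉inner i j i<j m x with P-unique i j i<j
    ... | a ∷ u with P-br i j m i<j (inner⊆ i j i<j x)
    ... | inj₁ refl = All.lookup a (∈-++⁺ˡ x) refl
    ... | inj₂ refl = proj₂ (unique-++⁻ (inner i j i<j) u) x (here refl)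

    content-unique : ∀ C → Unique (content C)
    content-unique (brC m) = [] ∷ []
    content-unique (inC i j i<j) with P-unique i j i<j
    ... | a ∷ u = proj₁ (unique-++⁻ (inner i j i<j) u)

    content-disj : ∀ C D {v} → v ∈ content C → v ∈ content D → encode C ≡ encode D
    content-disj (brC m) (brC m') (here refl) (here e) = cong bix (br-inj m m' e)
    content-disj (brC m) (inC i j i<j) (here refl) y = ⊥-elim (br∉inner i j i<j m y)
    content-disj (inC i j i<j) (brC m) x (here refl) = ⊥-elim (br∉inner i j i<j m x)
    content-disj (inC i j i<j) (inC k l k<l) {v} x y with (i ≟ k) ×-dec (j ≟ l)
    ... | yes (refl , refl) = refl
    ... | no ne with P-disj i j k l i<j k<l ne v (inner⊆ i j i<j x) (inner⊆ k l k<l y)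
    ... | m , refl = ⊥-elim (br∉inner i j i<j m x)

    cell : Fin 10 → List V
    cell i = content (decode i)

    K : K4At (br 0F) (br 1F) (br 2F) (br 3F) (cell 4F) (cell 5F) (cell 6F) (cell 7F) (cell 8F) (cell 9F)
    K = mkK4 (P-link 0F 1F _) (P-link 0F 2F _) (P-link 0F 3F _) (P-link 1F 2F _) (P-link 1F 3F _) (P-link 2F 3F _)
      (Unique⇒cnt≤1 (UP.concat⁺ {xss = tabulate cell} (tabulate⁺ (λ i → content-unique (decode i)))
        (AP.tabulate⁺ λ {i} {j} i≢j (x , y) → i≢j (trans (sym (encode∘decode i)) (trans (content-disj (decode i) (decode j) x y) (encode∘decode j))))))

  -- Three induced paths from `v` to the corners of a triangle, with no further edges: a subdivision
  -- of K4 in which one triangle stays unsubdivided. Every ISK4 found in the presence of triangles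
  -- has this shape.
  record Fan (v : V) (X : List V) (a : V) (Y : List V) (b : V) (Z : List V) (c : V) : Set where
    field
      ipX : IP (v ∷ X ++ [ a ])
      ipY : IP (v ∷ Y ++ [ b ])
      ipZ : IP (v ∷ Z ++ [ c ])
      a~b : a ~ b
      a~c : a ~ c
      b~c : b ~ c
      X##Y : X ## (Y ++ [ b ])
      X##Z : X ## (Z ++ [ c ])
      Y##Z : Y ## (Z ++ [ c ])
      a##Y : [ a ] ## Y
      a##Z : [ a ] ## Z
      b##Z : [ b ] ## Z

  fan-ISK4 : ∀ {v X a Y b Z c} → Fan v X a Y b Z c → HasISK4 G
  fan-ISK4 {v} {X} {a} {Y} {b} {Z} {c} F = FromK4At.S K , ind
    where
    open Fan F
    A B C : List V
    A = X ++ [ a ]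
    B = Y ++ [ b ]
    C = Z ++ [ c ]
    dAB : ∀ {x} → x ∈ A → x ∈ B → ⊥
    dAB i j with ∈-++⁻ X i
    ... | inj₁ k = proj₁ (at X##Y k j) refl
    ... | inj₂ (here refl) with ∈-++⁻ Y j
    ... | inj₁ k = proj₁ (at a##Y (here refl) k) refl
    ... | inj₂ (here refl) = ~-irr a~b
    dAC : ∀ {x} → x ∈ A → x ∈ C → ⊥
    dAC i j with ∈-++⁻ X i
    ... | inj₁ k = proj₁ (at X##Z k j) refl
    ... | inj₂ (here refl) with ∈-++⁻ Z j
    ... | inj₁ k = proj₁ (at a##Z (here refl) k) refl
    ... | inj₂ (here refl) = ~-irr a~c
    dBC : ∀ {x} → x ∈ B → x ∈ C → ⊥
    dBC i j with ∈-++⁻ Y i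
    ... | inj₁ k = proj₁ (at Y##Z k j) refl
    ... | inj₂ (here refl) with ∈-++⁻ Z j
    ... | inj₁ k = proj₁ (at b##Z (here refl) k) refl
    ... | inj₂ (here refl) = ~-irr b~c
    v∉ : ∀ {D} → IP (v ∷ D) → v ∉ D
    v∉ h i with IP-uniq h
    ... | p ∷ _ = All.lookup p i refl
    whole : Unique ((v ∷ A) ++ (B ++ C))
    whole = UP.++⁺ (IP-uniq ipX) (UP.++⁺ (IP-uniq (IP-tail ipY)) (IP-uniq (IP-tail ipZ)) (λ (i , j) → dBC i j))
      λ { (here refl , j) → case ∈-++⁻ B j of λ { (inj₁ k) → v∉ ipY k ; (inj₂ k) → v∉ ipZ k }
        ; (there i , j) → case ∈-++⁻ B j of λ { (inj₁ k) → dAB i k ; (inj₂ k) → dAC i k } }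
    K : K4At v a b c X Y Z [] [] []
    K = mkK4 (IP⇒Consec ipX) (IP⇒Consec ipY) (IP⇒Consec ipZ) (a~b , tt) (a~c , tt) (b~c , tt)
      λ x → ≤-trans (mono (cnt-additive x) ([ v ] ∷ [ a ] ∷ [ b ] ∷ [ c ] ∷ X ∷ Y ∷ Z ∷ [])
        (var 0F ⊕ var 1F ⊕ var 2F ⊕ var 3F ⊕ var 4F ⊕ var 5F ⊕ var 6F ⊕ ∅)
        ((var 0F ⊕ (var 4F ⊕ var 1F)) ⊕ ((var 5F ⊕ var 2F) ⊕ (var 6F ⊕ var 3F)))) (Unique⇒cnt≤1 whole x)
    open FromK4At K using (Pth)
    loc : ∀ i j → i F.< j → ∀ {u} → u ∈ Pth i j → (u ∈ (v ∷ A)) ⊎ (u ∈ (v ∷ B)) ⊎ (u ∈ (v ∷ C))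
    loc = pairs-elim inj₁ (inj₂ ∘ inj₁) (inj₂ ∘ inj₂)
      (λ { (here refl) → inj₁ (there (∈-++⁺ʳ X (here refl))) ; (there (here refl)) → inj₂ (inj₁ (there (∈-++⁺ʳ Y (here refl)))) })
      (λ { (here refl) → inj₁ (there (∈-++⁺ʳ X (here refl))) ; (there (here refl)) → inj₂ (inj₂ (there (∈-++⁺ʳ Z (here refl)))) })
      (λ { (here refl) → inj₂ (inj₁ (there (∈-++⁺ʳ Y (here refl)))) ; (there (here refl)) → inj₂ (inj₂ (there (∈-++⁺ʳ Z (here refl)))) })
    Res : V → V → Set
    Res u w = Σ (Fin 4) λ i → Σ (Fin 4) λ j → (i F.< j) × ConsecIn (Pth i j) u w
    rsym : ∀ {u w} → Res u w → Res w u
    rsym (i , j , l , r) = i , j , l , ConsecIn-sym r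
    inA : ∀ {u w} → u ∈ (v ∷ A) → w ∈ (v ∷ A) → u ~ w → Res u w
    inA i j e = 0F , 1F , s≤s z≤n , IP-ConsecIn ipX i j e
    inB : ∀ {u w} → u ∈ (v ∷ B) → w ∈ (v ∷ B) → u ~ w → Res u w
    inB i j e = 0F , 2F , s≤s z≤n , IP-ConsecIn ipY i j e
    inC' : ∀ {u w} → u ∈ (v ∷ C) → w ∈ (v ∷ C) → u ~ w → Res u w
    inC' i j e = 0F , 3F , s≤s z≤n , IP-ConsecIn ipZ i j e
    AB : ∀ {u w} → u ∈ (v ∷ A) → w ∈ (v ∷ B) → u ~ w → Res u w
    AB (here refl) j e = inB (here refl) j e
    AB i (here refl) e = inA i (here refl) e
    AB (there i) (there j) e with ∈-++⁻ X i
    ... | inj₁ k = ⊥-elim (proj₂ (at X##Y k j) e)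
    ... | inj₂ (here refl) with ∈-++⁻ Y j
    ... | inj₁ k = ⊥-elim (proj₂ (at a##Y (here refl) k) e)
    ... | inj₂ (here refl) = 1F , 2F , s≤s (s≤s z≤n) , [] , [] , inj₁ refl
    AC : ∀ {u w} → u ∈ (v ∷ A) → w ∈ (v ∷ C) → u ~ w → Res u w
    AC (here refl) j e = inC' (here refl) j e
    AC i (here refl) e = inA i (here refl) e
    AC (there i) (there j) e with ∈-++⁻ X i
    ... | inj₁ k = ⊥-elim (proj₂ (at X##Z k j) e)
    ... | inj₂ (here refl) with ∈-++⁻ Z j
    ... | inj₁ k = ⊥-elim (proj₂ (at a##Z (here refl) k) e)
    ... | inj₂ (here refl) = 1F , 3F , s≤s (s≤s z≤n) , [] , [] , inj₁ refl
    BC : ∀ {u w} → u ∈ (v ∷ B) → w ∈ (v ∷ C) → u ~ w → Res u w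
    BC (here refl) j e = inC' (here refl) j e
    BC i (here refl) e = inB i (here refl) e
    BC (there i) (there j) e with ∈-++⁻ Y i
    ... | inj₁ k = ⊥-elim (proj₂ (at Y##Z k j) e)
    ... | inj₂ (here refl) with ∈-++⁻ Z j
    ... | inj₁ k = ⊥-elim (proj₂ (at b##Z (here refl) k) e)
    ... | inj₂ (here refl) = 2F , 3F , s≤s (s≤s (s≤s z≤n)) , [] , [] , inj₁ refl
    ind : InducedSub (FromK4At.S K)
    ind u w (i , j , i<j , x) (k , l , k<l , y) e with loc i j i<j x | loc k l k<l y
    ... | inj₁ p | inj₁ q = inA p q e
    ... | inj₁ p | inj₂ (inj₁ q) = AB p q e
    ... | inj₁ p | inj₂ (inj₂ q) = AC p q e
    ... | inj₂ (inj₁ p) | inj₁ q = rsym (AB q p (~-sym e))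
    ... | inj₂ (inj₁ p) | inj₂ (inj₁ q) = inB p q e
    ... | inj₂ (inj₁ p) | inj₂ (inj₂ q) = BC p q e
    ... | inj₂ (inj₂ p) | inj₁ q = rsym (AC q p (~-sym e))
    ... | inj₂ (inj₂ p) | inj₂ (inj₁ q) = rsym (BC q p (~-sym e))
    ... | inj₂ (inj₂ p) | inj₂ (inj₂ q) = inC' p q e

-- Wheels and paths towards a hole

module _ {A : Set} where

  snoc-split : ∀ (M : List A) {c} p {u q} → M ++ [ c ] ≡ p ++ u ∷ q →
    ((q ≡ []) × (M ≡ p) × (u ≡ c)) ⊎ (Σ (List A) λ q' → (q ≡ q' ++ [ c ]) × (M ≡ p ++ u ∷ q'))
  snoc-split [] [] refl = inj₁ (refl , refl , refl)
  snoc-split [] (x ∷ []) ()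
  snoc-split [] (x ∷ y ∷ p) ()
  snoc-split (m ∷ M) {c} [] refl = inj₂ (M , refl , refl)
  snoc-split (m ∷ M) (x ∷ p) e with ∷-injective e
  ... | refl , e' with snoc-split M p e'
  ... | inj₁ (a , b , c) = inj₁ (a , cong (m ∷_) b , c)
  ... | inj₂ (q' , a , b) = inj₂ (q' , a , cong (m ∷_) b)

  snoc-view : ∀ x (l : List A) → Σ (List A) λ l' → Σ A λ y → x ∷ l ≡ l' ++ [ y ]
  snoc-view x [] = [] , x , refl
  snoc-view x (y ∷ l) with snoc-view y l
  ... | l' , z , e = x ∷ l' , z , cong (x ∷_) e

  snoc-inj : ∀ (p : List A) {q x y} → p ++ [ x ] ≡ q ++ [ y ] → (p ≡ q) × (x ≡ y)
  snoc-inj p {q} e with snoc-split p q e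
  ... | inj₁ (_ , e₁ , e₂) = e₁ , sym e₂
  ... | inj₂ ([] , () , _)
  ... | inj₂ (_ ∷ _ , () , _)

  reverse-∷ʳ : ∀ (l : List A) x → reverse (l ++ [ x ]) ≡ x ∷ reverse l
  reverse-∷ʳ l x = reverse-++ l [ x ]

-- Adjacency of `x` and `y` is left open, so K4 is excluded together with the diamond.
DiamondFree : Graph → Set
DiamondFree G = ∀ {b c x y} → E G b c → E G x b → E G x c → E G y b → E G y c → x ≡ y

module Wheels (G : Graph) (noW : ¬ HasWheel G) where
  open Basics G

  -- `z` sees both ends of the edge `x y` of the hole, so one more neighbour on it makes `z` the hub
  -- of a wheel.
  no-third-neighbour : ∀ {x Q y z} → Hole x Q y → z ~ x → z ~ y → z ∉ Q → Any (z ~_) Q → ⊥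
  no-third-neighbour {x} {M} {y} {z} h zx zy z∉ a with Any⇒∈ a
  ... | q , i , zq = noW (Hole-wheel h
      (λ { (here refl) → ~-irr zx ; (there j) → case ∈-++⁻ M j of λ { (inj₁ k) → z∉ k ; (inj₂ (here refl)) → ~-irr zy } })
      (here refl) (there (∈-++⁺ˡ i)) (there (∈-++⁺ʳ M (here refl)))
      (unique-≢ [ x ] (Hole-uniq h) (here refl) (∈-++⁺ˡ i)) (~⇒≢ (hpᶜ h)) (unique-≢ (x ∷ M) (Hole-uniq h) (there i) (here refl))
      zx zq zy)

  -- Cut the path at the first neighbour of `c`. Closed up by `c` it is a hole through the edge
  -- `a c`, and `b` sees `a`, `c` and the earlier vertex `y` on it.
  b-before-c : ∀ {a b c Q} q₁ {y q₂} → IP (a ∷ Q) → Q ≡ q₁ ++ y ∷ q₂ → (∀ {t} → t ∈ q₁ → ¬ (c ~ t)) → c ∉ Q → b ∉ Q →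
    a ~ b → a ~ c → b ~ c → b ~ y → Any (c ~_) (y ∷ q₂) → ⊥
  b-before-c {a} {b} {c} q₁ {y} {q₂} ip refl cq c∉ b∉ ab ac bc by an with firstSat (c ~?_) an
  ... | s , x , t , eq , cx , cs = no-third-neighbour {a} {(q₁ ++ s) ++ [ x ]} {c} {b}
        (mkHole (IP-++ˡ (a ∷ (q₁ ++ s) ++ [ x ]) (subst (λ l → IP (a ∷ l)) eqQ ip))
          (subst IP (sym (++-assoc (q₁ ++ s) [ x ] [ c ])) (IP-glue (q₁ ++ s) (IP-++ˡ ((q₁ ++ s) ++ [ x ]) (subst IP eqQ (IP-tail ip)))
            (~-sym cx , ##[] , tt)
            (##-sym (mk[]## λ i → (λ e → c∉ (subst (_∈ (q₁ ++ y ∷ q₂)) (sym e) (in-Q (∈-++⁺ˡ i)))) , (case ∈-++⁻ q₁ i of λ { (inj₁ k) → cq k ; (inj₂ k) → cs k }))))) ac)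
        (~-sym ab) bc (λ i → b∉ (in-Q i)) (∈⇒Any y∈ by)
    where
    eqQ : q₁ ++ y ∷ q₂ ≡ ((q₁ ++ s) ++ [ x ]) ++ t
    eqQ = trans (cong (q₁ ++_) eq) (trans (sym (++-assoc q₁ s (x ∷ t))) (sym (++-assoc (q₁ ++ s) [ x ] t)))
    in-Q : ∀ {v} → v ∈ ((q₁ ++ s) ++ [ x ]) → v ∈ (q₁ ++ y ∷ q₂)
    in-Q i = cast∈ (sym eqQ) (∈-++⁺ˡ i)
    y∈ : y ∈ ((q₁ ++ s) ++ [ x ])
    y∈ = helper s eq
      where
      helper : ∀ s → y ∷ q₂ ≡ s ++ x ∷ t → y ∈ ((q₁ ++ s) ++ [ x ])
      helper [] refl = ∈-++⁺ʳ (q₁ ++ []) (here refl)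
      helper (_ ∷ s) refl = ∈-++⁺ˡ (∈-++⁺ʳ q₁ (here refl))

module HoleAttachments (G : Graph) (noI : ¬ HasISK4 G) (noW : ¬ HasWheel G) (DF : DiamondFree G) where
  open Basics G
  open K4Subdivisions G
  open Wheels G noW public

  data HoleAttachment (z b : V) (M : List V) (c : V) : Set where
    at-b : z ~ b → [ z ] ## (M ++ [ c ]) → HoleAttachment z b M c
    at-c : z ~ c → [ z ] ## (b ∷ M) → HoleAttachment z b M c
    pair : ∀ p u v q → b ∷ M ++ [ c ] ≡ p ++ u ∷ v ∷ q → z ~ u → z ~ v → [ z ] ## (p ++ q) → HoleAttachment z b M c

  -- Consider the first and the last neighbour of `z` on the hole. A neighbour between them gives a
  -- wheel. A single neighbour inside `M`, or two neighbours that are not consecutive, give a `Fan`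
  -- over the triangle `a b c`.
  hole-attachment : ∀ {a Z z b M c} → IP (a ∷ Z ++ [ z ]) → Hole b M c → a ~ b → a ~ c → [ a ] ## M → Z ## (b ∷ M ++ [ c ]) →
    z ∉ (b ∷ M ++ [ c ]) → Any (z ~_) (b ∷ M ++ [ c ]) → HoleAttachment z b M c
  hole-attachment {a} {Z} {z} {b} {M} {c} ipA hp ab ac aM ZL z∉ an with firstSat (z ~?_) an
  ... | p , u , q₀ , eqL , zu , zp with Any.any? (z ~?_) q₀
  hole-attachment {a} {Z} {z} {b} {M} {c} ipA hp ab ac aM ZL z∉ an | [] , .b , q₀ , refl , zu , zp | no ¬an =
    at-b zu (mk[]## λ i → (λ { refl → z∉ (there i) }) , λ e → ¬an (∈⇒Any i e))
  hole-attachment {a} {Z} {z} {b} {M} {c} ipA hp ab ac aM ZL z∉ an | x ∷ p' , u , q₀ , eqL , zu , zp | no ¬an with ∷-injective eqL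
  ... | refl , eqM with snoc-split M p' eqM
  ... | inj₁ (refl , refl , refl) = at-c zu (mk[]## λ i → (λ e → z∉ (subst (_∈ (b ∷ M ++ [ c ])) (sym e) (∈-++⁺ˡ i))) , zp i)
  -- One neighbour `u` inside `M`: the three paths start at `u` and run over `z` to `a`, back to `b`
  -- and on to `c`.
  ... | inj₂ (q' , refl , refl) = ⊥-elim (noI (fan-ISK4 {u} {z ∷ reverse Z} {a} {reverse p'} {b} {q'} {c} record
        { ipX = ~-sym zu , mk[]## (λ i → case ∈-++⁻ (reverse Z) i of λ { (inj₁ j) → #-sym (at ZL (rev⊆ Z j) (there (∈-++⁺ˡ u∈M))) ; (inj₂ (here refl)) → #-sym (at aM (here refl) u∈M) })
            , subst IP (trans (unfold-reverse a (Z ++ [ z ])) (cong (_++ [ a ]) (reverse-∷ʳ Z z))) (IP-rev _ ipA)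
        ; ipY = subst IP (trans (unfold-reverse b (p' ++ [ u ])) (cong (_++ [ b ]) (reverse-∷ʳ p' u))) (IP-rev _ (proj₁ (IP-split (b ∷ p') (hpˡ hp))))
        ; ipZ = IP-++ʳ p' (subst IP (++-assoc p' (u ∷ q') [ c ]) (hpʳ hp))
        ; a~b = ab ; a~c = ac ; b~c = hpᶜ hp
        ; X##Y = ##-cons (mk[]## λ i → case ∈-++⁻ (reverse p') i of λ { (inj₁ j) → z# (there (rev⊆ p' j)) ; (inj₂ (here refl)) → z# (here refl) })
                   (##-revˡ Z (##-⊆ʳ (++-⊆ (reverse p') (λ j → there (∈-++⁺ˡ (∈-++⁺ˡ (rev⊆ p' j)))) (λ { (here refl) → here refl })) ZL))
        ; X##Z = ##-cons (mk[]## λ i → (λ e → z∉ (subst (_∈ (b ∷ (p' ++ u ∷ q') ++ [ c ])) (sym e) (inQ i))) , λ e → ¬an (∈⇒Any i e))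
                   (##-revˡ Z (##-⊆ʳ inQ ZL))
        ; Y##Z = ##-revˡ p' (proj₂ (proj₂ (IP-split p' (subst IP (++-assoc p' (u ∷ q') [ c ]) (hpʳ hp)))))
        ; a##Y = ##-revʳ p' (##-⊆ʳ (l⊆ _) aM)
        ; a##Z = ##-⊆ʳ (r⊆ p' ∘ there) aM
        ; b##Z = ##-⊆ˡ (λ { (here refl) → here refl }) (proj₂ (proj₂ (IP-split (b ∷ p') (hpˡ hp)))) }))
    where
    u∈M : u ∈ (p' ++ u ∷ q')
    u∈M = ∈-++⁺ʳ p' (here refl)
    z# : ∀ {y} → y ∈ (b ∷ p') → z # y
    z# {y} i = (λ { refl → z∉ (case i of λ { (here refl) → here refl ; (there j) → there (∈-++⁺ˡ (∈-++⁺ˡ j)) }) }) , zp i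
    inQ : ∀ {y} → y ∈ (q' ++ [ c ]) → y ∈ (b ∷ (p' ++ u ∷ q') ++ [ c ])
    inQ i = there (cast∈ (sym (++-assoc p' (u ∷ q') [ c ])) (∈-++⁺ʳ p' (there i)))
  hole-attachment {a} {Z} {z} {b} {M} {c} ipA hp ab ac aM ZL z∉ an | p , u , q₀ , eqL , zu , zp | yes an' with lastSat (z ~?_) an'
  ... | [] , v , q , refl , zv , zq = pair p u v q eqL zu zv (mk[]## λ i → (λ e → z∉ (subst (z ∈_) (sym eqL) (case ∈-++⁻ p i of λ { (inj₁ k) → subst (_∈ _) (sym e) (∈-++⁺ˡ k) ; (inj₂ k) → subst (_∈ _) (sym e) (∈-++⁺ʳ p (there (there k))) }))) , (case ∈-++⁻ p i of λ { (inj₁ k) → zp k ; (inj₂ k) → zq k }))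
  ... | m₀ ∷ m , v , q , refl , zv , zq with Any.any? (z ~?_) (m₀ ∷ m)
  ... | yes am with Any⇒∈ am
  ... | w , wi , zw = ⊥-elim (noW (Hole-wheel hp z∉ (inL (here refl)) (inL (there (∈-++⁺ˡ wi))) (inL (there (∈-++⁺ʳ (m₀ ∷ m) (here refl))))
         (unique-≢ [ u ] uS (here refl) (∈-++⁺ˡ wi))
         (unique-≢ [ u ] uS (here refl) (∈-++⁺ʳ (m₀ ∷ m) (here refl)))
         (unique-≢ (u ∷ m₀ ∷ m) uS (there wi) (here refl)) zu zw zv))
    where
    uS : Unique (u ∷ m₀ ∷ m ++ v ∷ q)
    uS = unique-++ʳ p (subst Unique eqL (Hole-uniq hp))
    inL : ∀ {y} → y ∈ (u ∷ m₀ ∷ m ++ v ∷ q) → y ∈ (b ∷ M ++ [ c ])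
    inL i = cast∈ (sym eqL) (∈-++⁺ʳ p i)
  hole-attachment {a} {Z} {z} {b} {M} {c} ipA hp ab ac aM ZL z∉ an | p , u , q₀ , eqL , zu , zp | yes an' | m₀ ∷ m , v , q , refl , zv , zq | no ¬am with snoc-view v q
  ... | W , c' , eqW with headb p eqL | snoc-inj (b ∷ M) (trans eqL (trans (cong (λ l → p ++ u ∷ m₀ ∷ m ++ l) eqW) (re p)))
    where
    headb : ∀ p {t} → b ∷ M ++ [ c ] ≡ p ++ u ∷ t → Σ (List V) λ p'' → p ++ [ u ] ≡ b ∷ p''
    headb [] e = [] , cong (_∷ []) (sym (proj₁ (∷-injective e)))
    headb (x ∷ p) e = p ++ [ u ] , cong (_∷ (p ++ [ u ])) (sym (proj₁ (∷-injective e)))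
    re : ∀ p → p ++ u ∷ m₀ ∷ m ++ W ++ [ c' ] ≡ (p ++ u ∷ m₀ ∷ m ++ W) ++ [ c' ]
    re [] = cong (λ l → u ∷ m₀ ∷ l) (sym (++-assoc m W [ c' ]))
    re (x ∷ p) = cong (x ∷_) (re p)
  -- Two neighbours with a gap between them: the paths start at `z` and run to `a`, over `u` back to
  -- `b`, and over `v` on to `c`.
  ... | p'' , eqp | eqbM , refl = ⊥-elim (noI (fan-ISK4 {z} {reverse Z} {a} {reverse p''} {b} {W} {c} record
        { ipX = subst IP (trans (unfold-reverse a (Z ++ [ z ])) (cong (_++ [ a ]) (reverse-∷ʳ Z z))) (IP-rev _ ipA)
        ; ipY = subst (λ l → IP (z ∷ l)) eqY (zu , ##-revʳ p (mk[]## λ i → z# (∈-++⁺ˡ i) , zp i) , subst IP (reverse-∷ʳ p u) (IP-rev (p ++ [ u ]) (subst IP (sym eqp) (IP-++ˡ (b ∷ p'') (subst (λ l → IP (b ∷ l)) eqM (hpˡ hp))))))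
        ; ipZ = subst (λ l → IP (z ∷ l)) eqW (zv , mk[]## (λ i → z# (∈-++⁺ʳ p (there (there (∈-++⁺ʳ m (there i))))) , zq i) , subst IP (sym eqW) (IP-++ʳ (p'' ++ m₀ ∷ m) (subst IP (trans (cong (_++ [ c ]) (trans eqM (sym (++-assoc p'' (m₀ ∷ m) W)))) (++-assoc (p'' ++ m₀ ∷ m) W [ c ])) (hpʳ hp))))
        ; a~b = ab ; a~c = ac ; b~c = hpᶜ hp
        ; X##Y = ##-revˡ Z (##-⊆ʳ (++-⊆ (reverse p'') (λ j → there (∈-++⁺ˡ (p''⊆ (rev⊆ p'' j)))) (λ { (here refl) → here refl })) ZL)
        ; X##Z = ##-revˡ Z (##-⊆ʳ (++-⊆ W (λ j → there (∈-++⁺ˡ (W⊆ j))) (λ { (here refl) → there (∈-++⁺ʳ M (here refl)) })) ZL)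
        ; Y##Z = ##-revˡ p'' (##-⊆ʳ (r⊆ m) (proj₂ (proj₂ (IP-split p'' (subst IP (trans (cong (_++ [ c ]) eqM) (trans (++-assoc p'' (m₀ ∷ m ++ W) [ c ]) (cong (λ l → p'' ++ m₀ ∷ l) (++-assoc m W [ c ])))) (hpʳ hp))))))
        ; a##Y = ##-revʳ p'' (##-⊆ʳ p''⊆ aM)
        ; a##Z = ##-⊆ʳ W⊆ aM
        ; b##Z = ##-⊆ (λ { (here refl) → here refl }) (r⊆ m) (proj₂ (proj₂ (IP-split (b ∷ p'') (subst (λ l → IP (b ∷ l)) eqM (hpˡ hp))))) }))
    where
    eqY : u ∷ reverse p ≡ reverse p'' ++ [ b ]
    eqY = trans (sym (reverse-∷ʳ p u)) (trans (cong reverse eqp) (unfold-reverse b p''))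
    eqM : M ≡ p'' ++ m₀ ∷ m ++ W
    eqM = ∷-injectiveʳ (trans eqbM (trans (sym (++-assoc p [ u ] (m₀ ∷ m ++ W))) (cong (_++ (m₀ ∷ m ++ W)) eqp)))
    p''⊆ : p'' ⊆ M
    p''⊆ i = cast∈ (sym eqM) (∈-++⁺ˡ i)
    W⊆ : W ⊆ M
    W⊆ i = cast∈ (sym eqM) (∈-++⁺ʳ p'' (there (∈-++⁺ʳ m i)))
    z# : ∀ {y} → y ∈ (p ++ u ∷ m₀ ∷ m ++ v ∷ q) → z ≢ y
    z# i e = z∉ (subst (_∈ (b ∷ M ++ [ c ])) (sym e) (cast∈ (sym eqL) i))

-- Prisms

module _ {A : Set} where

  locate : ∀ (l₁ : List A) {l₂} p {x y q} → l₁ ++ l₂ ≡ p ++ x ∷ y ∷ q →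
    (Σ (List A) λ q₁ → (l₁ ≡ p ++ x ∷ y ∷ q₁) × (q ≡ q₁ ++ l₂))
    ⊎ ((l₁ ≡ p ++ [ x ]) × (l₂ ≡ y ∷ q))
    ⊎ (Σ (List A) λ p₂ → (l₂ ≡ p₂ ++ x ∷ y ∷ q) × (p ≡ l₁ ++ p₂))
  locate [] p e = inj₂ (inj₂ (p , e , refl))
  locate (z ∷ []) [] refl = inj₂ (inj₁ (refl , refl))
  locate (z ∷ z' ∷ l₁) [] refl = inj₁ (l₁ , refl , refl)
  locate (z ∷ l₁) (z' ∷ p) e with ∷-injective e
  ... | refl , e' with locate l₁ p e'
  ... | inj₁ (q₁ , e₁ , e₂) = inj₁ (q₁ , cong (z ∷_) e₁ , e₂)
  ... | inj₂ (inj₁ (e₁ , e₂)) = inj₂ (inj₁ (cong (z ∷_) e₁ , e₂))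
  ... | inj₂ (inj₂ (p₂ , e₁ , e₂)) = inj₂ (inj₂ (p₂ , e₁ , cong (z ∷_) e₂))

  reverse-pair : ∀ (p : List A) {x y q} → reverse (p ++ x ∷ y ∷ q) ≡ reverse q ++ y ∷ x ∷ reverse p
  reverse-pair p {x} {y} {q} = trans (reverse-++ p (x ∷ y ∷ q)) (trans (cong (_++ reverse p) (trans (unfold-reverse x (y ∷ q)) (cong (_++ [ x ]) (unfold-reverse y q))))
    (trans (++-assoc (reverse q ++ [ y ]) [ x ] (reverse p)) (++-assoc (reverse q) [ y ] (x ∷ reverse p))))

  reverse-path : ∀ (a : A) R s → reverse (a ∷ R ++ [ s ]) ≡ s ∷ reverse R ++ [ a ]
  reverse-path a R s = trans (unfold-reverse a (R ++ [ s ])) (cong (_++ [ a ]) (reverse-∷ʳ R s))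

  rev⊇ : ∀ (p : List A) → p ⊆ reverse p
  rev⊇ p i = reverse⁺ i

  ∈-path⁻ : ∀ {a : A} R {s x} → x ∈ (a ∷ R ++ [ s ]) → (x ≡ a) ⊎ (x ∈ R) ⊎ (x ≡ s)
  ∈-path⁻ R (here e) = inj₁ e
  ∈-path⁻ R (there i) with ∈-++⁻ R i
  ... | inj₁ j = inj₂ (inj₁ j)
  ... | inj₂ (here e) = inj₂ (inj₂ e)

  last∈ : ∀ {a : A} R {s} → s ∈ (a ∷ R ++ [ s ])
  last∈ R = there (∈-++⁺ʳ R (here refl))

  mid∈ : ∀ {a : A} {R} {s x} → x ∈ R → x ∈ (a ∷ R ++ [ s ])
  mid∈ i = there (∈-++⁺ˡ i)

module Prisms (G : Graph) where
  open Basics G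

  -- A hole as a bare list, which can be rotated and hence cut open at any of its edges.
  HoleList : List V → Set
  HoleList [] = ⊥
  HoleList (b ∷ l) = Σ (List V) λ M → Σ V λ c → (l ≡ M ++ [ c ]) × Hole b M c

  HoleList-rot : ∀ x l → HoleList (x ∷ l) → HoleList (l ++ [ x ])
  HoleList-rot x l ([] , c , refl , h) = [] , x , refl , mkHole tt tt (~-sym (hpᶜ h))
  HoleList-rot x l (m ∷ M , c , refl , h) = M ++ [ c ] , x , refl , Hole-rot h

  HoleList-rotate : ∀ l₁ l₂ → HoleList (l₁ ++ l₂) → HoleList (l₂ ++ l₁)
  HoleList-rotate [] l₂ h = subst HoleList (sym (++-identityʳ l₂)) h
  HoleList-rotate (x ∷ l₁) l₂ h = subst HoleList (++-assoc l₂ [ x ] l₁) (HoleList-rotate l₁ (l₂ ++ [ x ]) (subst HoleList (++-assoc l₁ l₂ [ x ]) (HoleList-rot x (l₁ ++ l₂) h)))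

  HoleList⇒Hole : ∀ {b M c} → HoleList (b ∷ M ++ [ c ]) → Hole b M c
  HoleList⇒Hole {b} {M} {c} (M' , c' , e , h) with snoc-inj M {M'} e
  ... | refl , refl = h

  path-≢ : ∀ {a R s} → IP (a ∷ R ++ [ s ]) → a ≢ s
  path-≢ {a} {R} h with IP-uniq h
  ... | u ∷ _ = All.lookup u (∈-++⁺ʳ R (here refl))

  path-a∉ : ∀ {a R s} → IP (a ∷ R ++ [ s ]) → a ∉ R
  path-a∉ {a} {R} h i with IP-uniq h
  ... | u ∷ _ = All.lookup u (∈-++⁺ˡ i) refl

  path-s∉ : ∀ {a R s} → IP (a ∷ R ++ [ s ]) → s ∉ R
  path-s∉ {a} {R} h i = unique-≢ (a ∷ R) (IP-uniq h) (there i) (here refl) refl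

  -- The possible relations between vertices of two rungs: the edges `a b` and `s t` are the only
  -- ones.
  Cross : (a s b t x y : V) → Set
  Cross a s b t x y = ((x ≡ a) × (y ≡ b)) ⊎ ((x ≡ s) × (y ≡ t)) ⊎ (x # y)

  record Ladder (a : V) (R : List V) (s b : V) (B : List V) (t : V) : Set where
    constructor mkLadder
    field
      ab : a ~ b
      st : s ~ t
      cr : ∀ {x y} → x ∈ (a ∷ R ++ [ s ]) → y ∈ (b ∷ B ++ [ t ]) → Cross a s b t x y

  ladder-sym : ∀ {a R s b B t} → Ladder a R s b B t → Ladder b B t a R s
  ladder-sym (mkLadder ab st cr) = mkLadder (~-sym ab) (~-sym st) λ i j → case cr j i of λ
    { (inj₁ (e , e')) → inj₁ (e' , e) ; (inj₂ (inj₁ (e , e'))) → inj₂ (inj₁ (e' , e)) ; (inj₂ (inj₂ h)) → inj₂ (inj₂ (#-sym h)) }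

  unrev : ∀ {a : V} R {s} {x} → x ∈ (s ∷ reverse R ++ [ a ]) → x ∈ (a ∷ R ++ [ s ])
  unrev {a} R {s} i = reverse⁻ (cast∈ (sym (reverse-path a R s)) i)

  ladder-mirror : ∀ {a R s b B t} → Ladder a R s b B t → Ladder s (reverse R) a t (reverse B) b
  ladder-mirror {R = R} {B = B} (mkLadder ab st cr) = mkLadder st ab λ i j → case cr (unrev R i) (unrev B j) of λ
    { (inj₁ e) → inj₂ (inj₁ e) ; (inj₂ (inj₁ e)) → inj₁ e ; (inj₂ (inj₂ h)) → inj₂ (inj₂ h) }

  ladder-hole : ∀ {b B t c C u} → IP (b ∷ B ++ [ t ]) → IP (c ∷ C ++ [ u ]) → Ladder b B t c C u → Hole b (B ++ t ∷ u ∷ reverse C) c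
  ladder-hole {b} {B} {t} {c} {C} {u} ipB ipC (mkLadder bc tu cr) = mkHole
      (IP-cat (b ∷ B) ipB (IP-++ˡ (u ∷ reverse C) ipC') tu (##-cons bb' (##-⊆ʳ (l⊆ [ c ]) B##)) (##-⊆ʳ (l⊆ [ c ]) t##))
      (subst IP (sym (++-assoc B (t ∷ u ∷ reverse C) [ c ])) (IP-cat B (IP-tail ipB) ipC' tu B## t##))
      bc
    where
    ipC' : IP (u ∷ reverse C ++ [ c ])
    ipC' = subst IP (reverse-path c C u) (IP-rev _ ipC)
    t#c : t # c
    t#c = case cr (last∈ B) (here refl) of λ { (inj₁ (e , _)) → ⊥-elim (path-≢ ipB (sym e)) ; (inj₂ (inj₁ (_ , e))) → ⊥-elim (path-≢ ipC e) ; (inj₂ (inj₂ h)) → h }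
    t## : [ t ] ## (reverse C ++ [ c ])
    t## = mk[]## λ j → case ∈-++⁻ (reverse C) j of λ
      { (inj₁ k) → case cr (last∈ B) (mid∈ (rev⊆ C k)) of λ { (inj₁ (e , _)) → ⊥-elim (path-≢ ipB (sym e)) ; (inj₂ (inj₁ (_ , e))) → ⊥-elim (path-s∉ ipC (subst (_∈ C) e (rev⊆ C k))) ; (inj₂ (inj₂ h)) → h }
      ; (inj₂ (here refl)) → t#c }
    B## : B ## (u ∷ reverse C ++ [ c ])
    B## = mk## λ i j → case cr (mid∈ i) (unrev C j) of λ
      { (inj₁ (e , _)) → ⊥-elim (path-a∉ ipB (subst (_∈ B) e i)) ; (inj₂ (inj₁ (e , _))) → ⊥-elim (path-s∉ ipB (subst (_∈ B) e i)) ; (inj₂ (inj₂ h)) → h }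
    bb' : [ b ] ## (u ∷ reverse C)
    bb' = mk[]## λ j → case cr (here refl) (unrev C (∈-++⁺ˡ j)) of λ
      { (inj₁ (_ , e)) → ⊥-elim (case subst (_∈ (u ∷ reverse C)) e j of λ { (here e') → path-≢ ipC e' ; (there k) → path-a∉ ipC (rev⊆ C k) }) ; (inj₂ (inj₁ (e , _))) → ⊥-elim (path-≢ ipB e) ; (inj₂ (inj₂ h)) → h }

  -- Triangles `a b c` and `s t u` joined by three rungs, any two of which form a ladder. Each rung
  -- has at least one edge. The first one plays a special role: its length is minimised.
  record Prism (a : V) (R : List V) (s b : V) (B : List V) (t c : V) (C : List V) (u : V) : Set where
    constructor mkPrism
    field
      ipR : IP (a ∷ R ++ [ s ])
      ipB : IP (b ∷ B ++ [ t ])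
      ipC : IP (c ∷ C ++ [ u ])
      RB : Ladder a R s b B t
      RC : Ladder a R s c C u
      BC : Ladder b B t c C u
  open Prism public

  swap : ∀ {a R s b B t c C u} → Prism a R s b B t c C u → Prism a R s c C u b B t
  swap (mkPrism x y z p q r) = mkPrism x z y q p (ladder-sym r)

  IP-mirror : ∀ {a} R {s} → IP (a ∷ R ++ [ s ]) → IP (s ∷ reverse R ++ [ a ])
  IP-mirror {a} R {s} h = subst IP (reverse-path a R s) (IP-rev _ h)

  mirror : ∀ {a R s b B t c C u} → Prism a R s b B t c C u → Prism s (reverse R) a t (reverse B) b u (reverse C) c
  mirror {R = R} {B = B} {C = C} (mkPrism x y z p q r) = mkPrism (IP-mirror R x) (IP-mirror B y) (IP-mirror C z) (ladder-mirror p) (ladder-mirror q) (ladder-mirror r)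

module ConnectorEnds (G : Graph) (noI : ¬ HasISK4 G) (noW : ¬ HasWheel G) (DF : DiamondFree G) where
  open Basics G
  open Prisms G
  open HoleAttachments G noI noW DF

  data Attach (l b : V) (B : List V) (t c : V) (C : List V) (u : V) : Set where
    only-b : l ~ b → [ l ] ## (B ++ [ t ]) → [ l ] ## (c ∷ C ++ [ u ]) → Attach l b B t c C u
    only-c : l ~ c → [ l ] ## (C ++ [ u ]) → [ l ] ## (b ∷ B ++ [ t ]) → Attach l b B t c C u
    pair-B : ∀ p x y q → b ∷ B ++ [ t ] ≡ p ++ x ∷ y ∷ q → l ~ x → l ~ y → [ l ] ## (p ++ q) → [ l ] ## (c ∷ C ++ [ u ]) → Attach l b B t c C u
    pair-C : ∀ p x y q → c ∷ C ++ [ u ] ≡ p ++ x ∷ y ∷ q → l ~ x → l ~ y → [ l ] ## (p ++ q) → [ l ] ## (b ∷ B ++ [ t ]) → Attach l b B t c C u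

  Y≡ : ∀ {b : V} {B t c} C {u} → b ∷ (B ++ t ∷ u ∷ reverse C) ++ [ c ] ≡ (b ∷ B ++ [ t ]) ++ (u ∷ reverse C ++ [ c ])
  Y≡ {b} {B} {t} {c} C {u} = cong (b ∷_) (trans (++-assoc B (t ∷ u ∷ reverse C) [ c ]) (sym (++-assoc B [ t ] (u ∷ reverse C ++ [ c ]))))

  R##Y : ∀ {a R s b B t c C u} → Prism a R s b B t c C u → R ## (b ∷ (B ++ t ∷ u ∷ reverse C) ++ [ c ])
  R##Y {a} {R} {s} {b} {B} {t} {c} {C} {u} P = mk## λ {x} {y} i j → case ∈-++⁻ (b ∷ B ++ [ t ]) (subst (y ∈_) (Y≡ C) j) of λ
      { (inj₁ k) → case Ladder.cr (RB P) (mid∈ i) k of λ { (inj₁ (e , _)) → ⊥-elim (na i e) ; (inj₂ (inj₁ (e , _))) → ⊥-elim (ns i e) ; (inj₂ (inj₂ h)) → h }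
      ; (inj₂ k) → case Ladder.cr (RC P) (mid∈ i) (unrev C k) of λ { (inj₁ (e , _)) → ⊥-elim (na i e) ; (inj₂ (inj₁ (e , _))) → ⊥-elim (ns i e) ; (inj₂ (inj₂ h)) → h } }
    where
    na : ∀ {x} → x ∈ R → x ≢ a
    na i refl = path-a∉ (ipR P) i
    ns : ∀ {x} → x ∈ R → x ≢ s
    ns i refl = path-s∉ (ipR P) i

  ∈Y⁻ : ∀ {b : V} {B t c} C {u x} → x ∈ (b ∷ (B ++ t ∷ u ∷ reverse C) ++ [ c ]) → (x ∈ (b ∷ B ++ [ t ])) ⊎ (x ∈ (c ∷ C ++ [ u ]))
  ∈Y⁻ {b} {B} {t} {c} C {u} i with ∈-++⁻ (b ∷ B ++ [ t ]) (cast∈ (Y≡ C) i)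
  ... | inj₁ k = inj₁ k
  ... | inj₂ k = inj₂ (unrev C k)

  rerev : ∀ {a : V} R {s x} → x ∈ (a ∷ R ++ [ s ]) → x ∈ (s ∷ reverse R ++ [ a ])
  rerev {a} R {s} i = cast∈ (reverse-path a R s) (reverse⁺ i)

  ∈YB : ∀ {b : V} {B t c} C {u x} → x ∈ (b ∷ B ++ [ t ]) → x ∈ (b ∷ (B ++ t ∷ u ∷ reverse C) ++ [ c ])
  ∈YB C i = cast∈ (sym (Y≡ C)) (∈-++⁺ˡ i)

  ∈YC : ∀ {b : V} {B t c} C {u x} → x ∈ (c ∷ C ++ [ u ]) → x ∈ (b ∷ (B ++ t ∷ u ∷ reverse C) ++ [ c ])
  ∈YC {b} {B} {t} {c} C {u} i = cast∈ (sym (Y≡ C)) (∈-++⁺ʳ (b ∷ B ++ [ t ]) (rerev C i))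

  a##M : ∀ {a R s b B t c C u} → Prism a R s b B t c C u → [ a ] ## (B ++ t ∷ u ∷ reverse C)
  a##M {a} {R} {s} {b} {B} {t} {c} {C} {u} P = mk[]## λ {y} i → case ∈-++⁻ (B ++ [ t ]) (subst (y ∈_) (sym (++-assoc B [ t ] (u ∷ reverse C))) i) of λ
      { (inj₁ k) → case Ladder.cr (RB P) (here refl) (there k) of λ
          { (inj₁ (_ , e)) → ⊥-elim (unique-≢ [ b ] (IP-uniq (ipB P)) (here refl) k (sym e)) ; (inj₂ (inj₁ (e , _))) → ⊥-elim (path-≢ (ipR P) e) ; (inj₂ (inj₂ h)) → h }
      ; (inj₂ k) → case Ladder.cr (RC P) (here refl) (unrev C (∈-++⁺ˡ k)) of λ
          { (inj₁ (_ , e)) → ⊥-elim (case subst (_∈ (u ∷ reverse C)) e k of λ { (here e') → path-≢ (ipC P) e' ; (there k') → path-a∉ (ipC P) (rev⊆ C k') }) ; (inj₂ (inj₁ (e , _))) → ⊥-elim (path-≢ (ipR P) e) ; (inj₂ (inj₂ h)) → h } }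

  -- W = Wi ++ [ l ] = f ∷ Wt is a path whose first vertex sees the a..s path and whose last vertex sees the rest of the prism.
  last-attachment : ∀ {a R s b B t c C u} (P : Prism a R s b B t c C u) {Wi l f Wt} → IP (Wi ++ [ l ]) → Wi ++ [ l ] ≡ f ∷ Wt →
    Wt ## (a ∷ R ++ [ s ]) → Wi ## (b ∷ (B ++ t ∷ u ∷ reverse C) ++ [ c ]) →
    f ∉ (a ∷ R ++ [ s ]) → l ∉ (a ∷ R ++ [ s ]) → l ∉ (b ∷ (B ++ t ∷ u ∷ reverse C) ++ [ c ]) →
    Any (f ~_) (a ∷ R) → Any (l ~_) (b ∷ (B ++ t ∷ u ∷ reverse C) ++ [ c ]) → Attach l b B t c C u
  last-attachment {a} {R} {s} {b} {B} {t} {c} {C} {u} P {Wi} {l} {f} {Wt} ipW eqW WtR WiY f∉ l∉R l∉ fr ly with firstSat (f ~?_) fr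
  ... | p , r , q , eqR , fr' , fp with headZ p eqR
    where
    headZ : ∀ p → a ∷ R ≡ p ++ r ∷ q → Σ (List V) λ Z → (p ++ r ∷ Wi ≡ a ∷ Z) × (Z ⊆ (R ++ Wi))
    headZ [] e = Wi , cong (_∷ Wi) (sym (∷-injectiveˡ e)) , r⊆ R
    headZ (x ∷ p) e = p ++ r ∷ Wi , cong (_∷ (p ++ r ∷ Wi)) (sym (∷-injectiveˡ e)) ,
      λ i → subst (λ R → _ ∈ (R ++ Wi)) (sym (∷-injectiveʳ e)) (cast∈ (sym (++-assoc p (r ∷ q) Wi)) (++-mono p id (λ { (here e) → here e ; (there k) → there (∈-++⁺ʳ q k) }) i))
  ... | Z , eqZ , Z⊆ = conv (hole-attachment ipA hpBC (Ladder.ab (RB P)) (Ladder.ab (RC P)) (a##M P)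
          (##-⊆ˡ Z⊆ (##-++ˡ (R##Y P) WiY)) l∉ ly)
    where
    hpBC = ladder-hole (ipB P) (ipC P) (BC P)
    pr : IP (p ++ r ∷ (q ++ [ s ]))
    pr = subst IP (trans (cong (_++ [ s ]) eqR) (++-assoc p (r ∷ q) [ s ])) (ipR P)
    p⊆ : ∀ {x} → x ∈ (p ++ [ r ]) → x ∈ (a ∷ R ++ [ s ])
    p⊆ i = ∈-++⁺ˡ (cast∈ (sym eqR) (++-mono p id (λ { (here e) → here e }) i))
    ipA : IP (a ∷ Z ++ [ l ])
    ipA = subst IP (trans (cong (λ w → p ++ r ∷ w) (sym eqW)) (trans (sym (++-assoc p (r ∷ Wi) [ l ])) (cong (_++ [ l ]) eqZ)))
      (IP-cat p (proj₁ (IP-split p pr)) (subst IP eqW ipW) (~-sym fr')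
        (##-consʳ (##-sym (mk[]## λ i → (λ e → f∉ (subst (_∈ _) (sym e) (p⊆ (∈-++⁺ˡ i)))) , fp i)) (##-sym (##-⊆ʳ (λ i → p⊆ (∈-++⁺ˡ i)) WtR)))
        (##-sym (##-⊆ʳ ([x]⊆ (p⊆ (∈-++⁺ʳ p (here refl)))) WtR)))
    conv : HoleAttachment l b (B ++ t ∷ u ∷ reverse C) c → Attach l b B t c C u
    conv (at-b e h) = only-b e (##-⊆ʳ (λ i → ∈-++⁺ˡ (cast∈ (++-assoc B [ t ] (u ∷ reverse C)) (∈-++⁺ˡ i))) h)
      (mk[]## λ i → case ∈YC {b} {B} {t} {c} C {u} i of λ { (here refl) → ⊥-elim (bc# i) ; (there k) → at h (here refl) k })
      where
      bc# : b ∉ (c ∷ C ++ [ u ])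
      bc# i = case Ladder.cr (BC P) (here refl) i of λ { (inj₁ (_ , e)) → ~⇒≢ (Ladder.ab (BC P)) e ; (inj₂ (inj₁ (e , _))) → path-≢ (ipB P) e ; (inj₂ (inj₂ (h , _))) → h refl }
    conv (at-c e h) = only-c e (mk[]## λ i → at h (here refl) (inM i))
      (##-⊆ʳ (λ i → case ∈-path⁻ B i of λ { (inj₁ refl) → here refl ; (inj₂ (inj₁ k)) → there (∈-++⁺ˡ k) ; (inj₂ (inj₂ refl)) → there (∈-++⁺ʳ B (here refl)) }) h)
      where
      inM : ∀ {y} → y ∈ (C ++ [ u ]) → y ∈ (b ∷ B ++ t ∷ u ∷ reverse C)
      inM i with ∈-++⁻ C i
      ... | inj₁ k = there (∈-++⁺ʳ B (there (there (rev⊇ C k))))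
      ... | inj₂ (here refl) = there (∈-++⁺ʳ B (there (here refl)))
    conv (pair p x y q e lx ly h) with locate (b ∷ B ++ [ t ]) p (trans (sym (Y≡ C)) e)
    ... | inj₁ (q₁ , e₁ , refl) = pair-B p x y q₁ e₁ lx ly (##-⊆ʳ (++-mono p id (l⊆ _)) h) (##-⊆ʳ (λ i → ∈-++⁺ʳ p (∈-++⁺ʳ q₁ (rerev C i))) h)
    ... | inj₂ (inj₁ (e₁ , e₂)) with snoc-inj (b ∷ B) {p} e₁ | ∷-injectiveˡ e₂
    -- The pair straddles the edge `t u`. Diamond-freeness then identifies `l` with `s`, but `l`
    -- lies off the first rung.
    ... | _ , refl | refl = ⊥-elim (l∉R (subst (_∈ _) (DF (Ladder.st (BC P)) (Ladder.st (RB P)) (Ladder.st (RC P)) lx ly) (last∈ R)))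
    conv (pair p x y q e lx ly h) | inj₂ (inj₂ (p₂ , e₁ , refl)) =
      pair-C (reverse q) y x (reverse p₂) (trans (sym (reverse-involutive _)) (trans (cong reverse (trans (reverse-path c C u) e₁)) (reverse-pair p₂))) ly lx
        (##-⊆ʳ (++-⊆ (reverse q) (λ i → ∈-++⁺ʳ ((b ∷ B ++ [ t ]) ++ p₂) (rev⊆ q i)) (λ i → ∈-++⁺ˡ (∈-++⁺ʳ (b ∷ B ++ [ t ]) (rev⊆ p₂ i)))) h)
        (##-⊆ʳ (λ i → ∈-++⁺ˡ (∈-++⁺ˡ i)) h)

-- Rerouting a prism along an outside path

module Rerouting (G : Graph) (noI : ¬ HasISK4 G) (noW : ¬ HasWheel G) (DF : DiamondFree G) where
  open Basics G
  open Prisms G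
  open HoleAttachments G noI noW DF
  open ConnectorEnds G noI noW DF

  -- Minimality of the first rung among all prisms with corner `a`; the rest of the triangle at `a`
  -- and the other rungs may change.
  Shorter : V → List V → Set
  Shorter a R = ∀ {R' s b B t c C u} → Prism a R' s b B t c C u → length R' < length R → ⊥

  ladder-≢ : ∀ {a R s b B t x y} → Ladder a R s b B t → x ∈ (a ∷ R ++ [ s ]) → y ∈ (b ∷ B ++ [ t ]) → x ≢ y
  ladder-≢ L i j with Ladder.cr L i j
  ... | inj₁ (refl , refl) = ~⇒≢ (Ladder.ab L)
  ... | inj₂ (inj₁ (refl , refl)) = ~⇒≢ (Ladder.st L)
  ... | inj₂ (inj₂ h) = proj₁ h

  -- The new rungs: b..x..W..f against c..u..s..v, where f sees exactly the consecutive pair u', v of the a..s path.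
  module Reroute {a R s b B t c C u} (P : Prism a R s b B t c C u) (IH : Shorter a R) {f mid l} (ipW : IP (f ∷ mid ++ [ l ]))
    (WtR : (mid ++ [ l ]) ## (a ∷ R ++ [ s ])) (WiY : (f ∷ mid) ## (b ∷ (B ++ t ∷ u ∷ reverse C) ++ [ c ])) (f∉ : f ∉ (a ∷ R ++ [ s ]))
    {p x y q} (eqB : b ∷ B ++ [ t ] ≡ p ++ x ∷ y ∷ q) (lx : l ~ x) (l##pq : [ l ] ## (p ++ q)) (l##C : [ l ] ## (c ∷ C ++ [ u ]))
    {p₂ u' v q₁} (eqA : a ∷ R ++ [ s ] ≡ p₂ ++ u' ∷ v ∷ q₁) (fu : f ~ u') (fv : f ~ v) (f## : [ f ] ## (p₂ ++ q₁)) where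

    headb : Σ (List V) λ Bx → p ++ [ x ] ≡ b ∷ Bx
    headb = go p eqB
      where
      go : ∀ p → b ∷ B ++ [ t ] ≡ p ++ x ∷ y ∷ q → Σ (List V) λ Bx → p ++ [ x ] ≡ b ∷ Bx
      go [] e = [] , cong (_∷ []) (sym (∷-injectiveˡ e))
      go (z ∷ p) e = p ++ [ x ] , cong (_∷ (p ++ [ x ])) (sym (∷-injectiveˡ e))
    Bx : List V
    Bx = proj₁ headb
    B' : List V
    B' = Bx ++ l ∷ reverse mid
    C' : List V
    C' = C ++ u ∷ reverse q₁
    W' : List V
    W' = l ∷ reverse mid ++ [ f ]
    eqB' : b ∷ B' ++ [ f ] ≡ p ++ x ∷ W'
    eqB' = trans (cong (b ∷_) (++-assoc Bx (l ∷ reverse mid) [ f ])) (trans (cong (_++ W') (sym (proj₂ headb))) (++-assoc p [ x ] W'))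
    E' : List V
    E' = proj₁ (snoc-view v q₁)
    eqE : v ∷ q₁ ≡ E' ++ [ s ]
    eqE with snoc-view v q₁
    ... | E , s' , e with snoc-inj (a ∷ R) {p₂ ++ u' ∷ E} (trans eqA (trans (cong (λ l → p₂ ++ u' ∷ l) e) (sym (++-assoc p₂ (u' ∷ E) [ s' ]))))
    ... | _ , refl = e
    revE : reverse q₁ ++ [ v ] ≡ s ∷ reverse E'
    revE = trans (sym (unfold-reverse v q₁)) (trans (cong reverse eqE) (reverse-∷ʳ E' s))
    eqC' : c ∷ C' ++ [ v ] ≡ (c ∷ C) ++ u ∷ s ∷ reverse E'
    eqC' = cong (c ∷_) (trans (++-assoc C (u ∷ reverse q₁) [ v ]) (cong (λ l → C ++ u ∷ l) revE))
    uA : Unique (p₂ ++ u' ∷ v ∷ q₁)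
    uA = subst Unique eqA (IP-uniq (ipR P))
    ipA : IP (p₂ ++ u' ∷ v ∷ q₁)
    ipA = subst IP eqA (ipR P)
    p⊆B : ∀ {z} → z ∈ (p ++ [ x ]) → z ∈ (b ∷ B ++ [ t ])
    p⊆B i = cast∈ (sym eqB) (++-mono p id (λ { (here e) → here e }) i)
    p≢t : ∀ {z} → z ∈ (p ++ [ x ]) → z ≢ t
    p≢t i refl = unique-≢ (p ++ [ x ]) (subst Unique (trans eqB (sym (++-assoc p [ x ] (y ∷ q)))) (IP-uniq (ipB P))) i t∈ refl
      where
      t∈ : t ∈ (y ∷ q)
      t∈ with snoc-view y q
      ... | E , t' , e with snoc-inj (b ∷ B) {p ++ x ∷ E} (trans eqB (trans (cong (λ l → p ++ x ∷ l) e) (sym (++-assoc p (x ∷ E) [ t' ]))))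
      ... | _ , refl = cast∈ (sym e) (∈-++⁺ʳ E (here refl))
    vq⊆A : ∀ {z} → z ∈ (v ∷ q₁) → z ∈ (a ∷ R ++ [ s ])
    vq⊆A i = cast∈ (sym eqA) (∈-++⁺ʳ p₂ (there i))
    up⊆A : ∀ {z} → z ∈ (p₂ ++ [ u' ]) → z ∈ (a ∷ R ++ [ s ])
    up⊆A i = cast∈ (sym eqA) (++-mono p₂ id (λ { (here e) → here e }) i)
    up≢vq : ∀ {z w} → z ∈ (p₂ ++ [ u' ]) → w ∈ (v ∷ q₁) → z ≢ w
    up≢vq i j = unique-≢ (p₂ ++ [ u' ]) (subst Unique (sym (++-assoc p₂ [ u' ] (v ∷ q₁))) uA) i j
    a∈up : a ∈ (p₂ ++ [ u' ])
    a∈up = go p₂ eqA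
      where
      go : ∀ p₂ → a ∷ R ++ [ s ] ≡ p₂ ++ u' ∷ v ∷ q₁ → a ∈ (p₂ ++ [ u' ])
      go [] e = here (∷-injectiveˡ e)
      go (z ∷ p₂) e = here (∷-injectiveˡ e)
    s∈vq : s ∈ (v ∷ q₁)
    s∈vq = cast∈ (sym eqE) (∈-++⁺ʳ E' (here refl))
    inC' : ∀ {z} → z ∈ (c ∷ C' ++ [ v ]) → (z ∈ (c ∷ C ++ [ u ])) ⊎ (z ∈ (v ∷ q₁))
    inC' i with ∈-++⁻ (c ∷ C) (cast∈ eqC' i)
    ... | inj₁ j = inj₁ (∈-++⁺ˡ j)
    ... | inj₂ (here refl) = inj₁ (last∈ C)
    ... | inj₂ (there (here refl)) = inj₂ s∈vq
    ... | inj₂ (there (there j)) = inj₂ (cast∈ (sym eqE) (∈-++⁺ˡ (rev⊆ E' j)))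
    data InB' (z : V) : Set where
      inp : z ∈ (p ++ [ x ]) → InB' z
      inW : z ∈ (mid ++ [ l ]) → InB' z
      isf : z ≡ f → InB' z
    inB' : ∀ {z} → z ∈ (b ∷ B' ++ [ f ]) → InB' z
    inB' i with ∈-++⁻ (p ++ [ x ]) (cast∈ (trans eqB' (sym (++-assoc p [ x ] W'))) i)
    ... | inj₁ j = inp j
    ... | inj₂ (here refl) = inW (∈-++⁺ʳ mid (here refl))
    ... | inj₂ (there j) with ∈-++⁻ (reverse mid) j
    ... | inj₁ k = inW (∈-++⁺ˡ (rev⊆ mid k))
    ... | inj₂ (here e) = isf e
    W##rb : ∀ {z w} → z ∈ (mid ++ [ l ]) → w ∈ p → z # w
    W##rb i j with ∈-++⁻ mid i
    ... | inj₁ k = at WiY (there k) (∈YB C (p⊆B (∈-++⁺ˡ j)))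
    ... | inj₂ (here refl) = at l##pq (here refl) (∈-++⁺ˡ j)
    W##rc : ∀ {z w} → z ∈ (mid ++ [ l ]) → w ∈ (c ∷ C ++ [ u ]) → z # w
    W##rc i j with ∈-++⁻ mid i
    ... | inj₁ k = at WiY (there k) (∈YC C j)
    ... | inj₂ (here refl) = at l##C (here refl) j
    ipW' : IP W'
    ipW' = IP-mirror mid ipW
    ipB' : IP (b ∷ B' ++ [ f ])
    ipB' = subst IP (sym eqB') (IP-cat p (proj₁ (IP-split p (subst IP eqB (ipB P)))) ipW' (~-sym lx)
        (##-sym (mk## λ { (here refl) j → W##rb (∈-++⁺ʳ mid (here refl)) j
                        ; (there i) j → case ∈-++⁻ (reverse mid) i of λ { (inj₁ k) → W##rb (∈-++⁺ˡ (rev⊆ mid k)) j ; (inj₂ (here refl)) → at WiY (here refl) (∈YB C (p⊆B (∈-++⁺ˡ j))) } }))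
        (##-sym (mk## λ { i (here refl) → case ∈-++⁻ (reverse mid) i of λ
          { (inj₁ k) → at WiY (there (rev⊆ mid k)) (∈YB C (p⊆B (∈-++⁺ʳ p (here refl)))) ; (inj₂ (here refl)) → at WiY (here refl) (∈YB C (p⊆B (∈-++⁺ʳ p (here refl)))) } })))
    ac-cross : ∀ {z w} → z ∈ (v ∷ q₁) → w ∈ (c ∷ C ++ [ u ]) → ((z ≡ s) × (w ≡ u)) ⊎ (z # w)
    ac-cross i j with Ladder.cr (RC P) (vq⊆A i) j
    ... | inj₁ (e , _) = ⊥-elim (up≢vq a∈up i (sym e))
    ... | inj₂ h = h
    ipC' : IP (c ∷ C' ++ [ v ])
    ipC' = subst IP (sym eqC') (IP-cat (c ∷ C) (ipC P) (subst IP (trans (cong reverse eqE) (reverse-∷ʳ E' s)) (IP-rev (v ∷ q₁) (IP-++ʳ [ u' ] (IP-++ʳ p₂ ipA)))) (~-sym (Ladder.st (RC P)))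
        (##-sym (mk## λ i j → case ac-cross (vq i) (∈-++⁺ˡ j) of λ { (inj₁ (_ , e)) → ⊥-elim (unique-≢ (c ∷ C) (IP-uniq (ipC P)) j (here refl) e) ; (inj₂ h) → h }))
        (##-sym (mk## λ { i (here refl) → case ac-cross (vq (there i)) (last∈ C) of λ { (inj₁ (e , _)) → ⊥-elim (unique-≢ E' (subst Unique eqE (IP-uniq (IP-++ʳ [ u' ] (IP-++ʳ p₂ ipA)))) (rev⊆ E' i) (here refl) e) ; (inj₂ h) → h } })))
      where
      vq : ∀ {z} → z ∈ (s ∷ reverse E') → z ∈ (v ∷ q₁)
      vq (here refl) = s∈vq
      vq (there i) = cast∈ (sym eqE) (∈-++⁺ˡ (rev⊆ E' i))
    BC' : Ladder b B' f c C' v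
    BC' = mkLadder (Ladder.ab (BC P)) fv λ i j → go (inB' i) (inC' j)
      where
      go : ∀ {z w} → InB' z → (w ∈ (c ∷ C ++ [ u ])) ⊎ (w ∈ (v ∷ q₁)) → Cross b f c v z w
      go (inp i) (inj₁ j) with Ladder.cr (BC P) (p⊆B i) j
      ... | inj₁ e = inj₁ e
      ... | inj₂ (inj₁ (e , _)) = ⊥-elim (p≢t i e)
      ... | inj₂ (inj₂ h) = inj₂ (inj₂ h)
      go (inp i) (inj₂ j) with Ladder.cr (RB P) (vq⊆A j) (p⊆B i)
      ... | inj₁ (e , _) = ⊥-elim (up≢vq a∈up j (sym e))
      ... | inj₂ (inj₁ (_ , e)) = ⊥-elim (p≢t i e)
      ... | inj₂ (inj₂ h) = inj₂ (inj₂ (#-sym h))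
      go (inW i) (inj₁ j) = inj₂ (inj₂ (W##rc i j))
      go (inW i) (inj₂ j) = inj₂ (inj₂ (at WtR i (vq⊆A j)))
      go (isf refl) (inj₁ j) = inj₂ (inj₂ (at WiY (here refl) (∈YC C j)))
      go (isf refl) (inj₂ (here e)) = inj₂ (inj₁ (refl , e))
      go (isf refl) (inj₂ (there j)) = inj₂ (inj₂ (at f## (here refl) (∈-++⁺ʳ p₂ j)))
    up≢s : ∀ {z} → z ∈ (p₂ ++ [ u' ]) → z ≢ s
    up≢s i = up≢vq i s∈vq
    u~v : u' ~ v
    u~v = IP-head (IP-++ʳ p₂ ipA)
    -- The triangle `u' f v` replaces `s t u`, and the part of the first rung from `a` to `u'` is a
    -- shorter first rung. If `u'` is `a` itself that rung would have no edge; in that case `a` sees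
    -- `b`, `c` and `f` on the hole formed by the two new rungs.
    conclude : ∀ p₂' → p₂ ≡ p₂' → ⊥
    conclude [] e = no-third-neighbour (ladder-hole ipB' ipC' BC') (Ladder.ab (RB P)) (Ladder.ab (RC P)) a∉ (∈⇒Any (∈-++⁺ʳ B' (here refl)) (subst (_~ f) (sym a≡u) (~-sym fu)))
      where
      a≡u : a ≡ u'
      a≡u = ∷-injectiveˡ (trans eqA (cong (λ l → l ++ u' ∷ v ∷ q₁) e))
      a∉ : a ∉ (B' ++ f ∷ v ∷ reverse C')
      a∉ i with ∈Y⁻ {b} {B'} {f} {c} C' {v} (there (∈-++⁺ˡ i))
      ... | inj₁ j with inB' j
      ... | inp k = ladder-≢ (RB P) (here refl) (p⊆B k) refl
      ... | inW k = proj₁ (at WtR k (here refl)) refl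
      ... | isf refl = f∉ (here refl)
      a∉ i | inj₂ j with inC' j
      ... | inj₁ k = ladder-≢ (RC P) (here refl) k refl
      ... | inj₂ k = up≢vq a∈up k refl
    conclude (z ∷ p₃) e with trans eqA (cong (λ l → l ++ u' ∷ v ∷ q₁) e)
    ... | e' with ∷-injective e'
    ... | refl , e'' = IH {p₃} {u'} {b} {B'} {f} {c} {C'} {v}
          (mkPrism (subst (λ l → IP (l ++ [ u' ])) e (proj₁ (IP-split p₂ ipA))) ipB' ipC'
            (mkLadder (Ladder.ab (RB P)) (~-sym fu) λ i j → goB (cast∈ (cong (_++ [ u' ]) (sym e)) i) (inB' j))
            (mkLadder (Ladder.ab (RC P)) u~v λ i j → goC (cast∈ (cong (_++ [ u' ]) (sym e)) i) (inC' j))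
            BC')
          (len E' (trans e'' (trans (cong (λ l → p₃ ++ u' ∷ l) eqE) (sym (++-assoc p₃ (u' ∷ E') [ s ])))))
      where
      len : ∀ E → R ++ [ s ] ≡ (p₃ ++ u' ∷ E) ++ [ s ] → length p₃ < length R
      len E e with snoc-inj R {p₃ ++ u' ∷ E} e
      ... | refl , _ = subst (length p₃ <_) (sym (length-++ p₃)) (m<m+n (length p₃) (s≤s z≤n))
      goB : ∀ {z w} → z ∈ (p₂ ++ [ u' ]) → InB' w → Cross a u' b f z w
      goB i (inp j) with Ladder.cr (RB P) (up⊆A i) (p⊆B j)
      ... | inj₁ h = inj₁ h
      ... | inj₂ (inj₁ (h , _)) = ⊥-elim (up≢s i h)
      ... | inj₂ (inj₂ h) = inj₂ (inj₂ h)
      goB i (inW j) = inj₂ (inj₂ (#-sym (at WtR j (up⊆A i))))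
      goB i (isf refl) with ∈-++⁻ p₂ i
      ... | inj₁ k = inj₂ (inj₂ (#-sym (at f## (here refl) (∈-++⁺ˡ k))))
      ... | inj₂ (here refl) = inj₂ (inj₁ (refl , refl))
      goC : ∀ {z w} → z ∈ (p₂ ++ [ u' ]) → (w ∈ (c ∷ C ++ [ u ])) ⊎ (w ∈ (v ∷ q₁)) → Cross a u' c v z w
      goC i (inj₁ j) with Ladder.cr (RC P) (up⊆A i) j
      ... | inj₁ h = inj₁ h
      ... | inj₂ (inj₁ (h , _)) = ⊥-elim (up≢s i h)
      ... | inj₂ (inj₂ h) = inj₂ (inj₂ h)
      goC i (inj₂ j) with ∈-++⁻ p₂ i
      ... | inj₁ k = inj₂ (inj₂ (at (proj₂ (proj₂ (IP-split p₂ ipA))) k j))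
      goC i (inj₂ (here refl)) | inj₂ (here refl) = inj₂ (inj₁ (refl , refl))
      goC i (inj₂ (there j)) | inj₂ (here refl) = inj₂ (inj₂ (at (IP-anti (IP-++ʳ p₂ ipA)) (here refl) j))

  -- `l x y` is a triangle on an edge of the hole through the first two rungs, and W leads from `l`
  -- back to that hole. So `hole-attachment` applies to the other end `f` and leaves only a
  -- consecutive pair on the first rung, which is the situation of `Reroute`. If W is a single
  -- vertex, it is the hub of a wheel.
  attached-pair⇒⊥ : ∀ {a R s b B t c C u} (P : Prism a R s b B t c C u) → Shorter a R → ∀ {Wi l f Wt} → IP (Wi ++ [ l ]) → Wi ++ [ l ] ≡ f ∷ Wt →
    Wt ## (a ∷ R ++ [ s ]) → Wi ## (b ∷ (B ++ t ∷ u ∷ reverse C) ++ [ c ]) →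
    f ∉ (a ∷ R ++ [ s ]) → l ∉ (b ∷ (B ++ t ∷ u ∷ reverse C) ++ [ c ]) →
    Any (f ~_) (a ∷ R ++ [ s ]) →
    ∀ {p x y q} → b ∷ B ++ [ t ] ≡ p ++ x ∷ y ∷ q → l ~ x → l ~ y → [ l ] ## (p ++ q) → [ l ] ## (c ∷ C ++ [ u ]) → ⊥
  attached-pair⇒⊥ {a} {R} {s} {b} {B} {t} {c} {C} {u} P IH {[]} {l} {.l} {.[]} ipW refl WtR WiY f∉ l∉ fr {p} {x} {y} {q} eqB lx ly l## lC with Any⇒∈ fr
  ... | r , ri , lr = noW (Hole-wheel (ladder-hole (ipR P) (ipB P) (RB P)) (λ i → case ∈Y⁻ B i of λ { (inj₁ j) → f∉ j ; (inj₂ j) → l∉ (∈YB C j) })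
          (∈YB B ri) (∈YC B x∈) (∈YC B y∈) (ladder-≢ (RB P) ri x∈) (ladder-≢ (RB P) ri y∈) x≢y lr lx ly)
    where
    x∈ : x ∈ (b ∷ B ++ [ t ])
    x∈ = cast∈ (sym eqB) (∈-++⁺ʳ p (here refl))
    y∈ : y ∈ (b ∷ B ++ [ t ])
    y∈ = cast∈ (sym eqB) (∈-++⁺ʳ p (there (here refl)))
    x≢y : x ≢ y
    x≢y = unique-≢ [ x ] (unique-++ʳ p (subst Unique eqB (IP-uniq (ipB P)))) (here refl) (here refl)
  attached-pair⇒⊥ {a} {R} {s} {b} {B} {t} {c} {C} {u} P IH {f ∷ mid} {l} {.f} {.(mid ++ [ l ])} ipW refl WtR WiY f∉ l∉ fr {p} {x} {y} {q} eqB lx ly l## lC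
    = conv (hole-attachment (IP-mirror mid ipW) hole lx ly
        (##-++ʳ (##-revʳ p (##-⊆ʳ (l⊆ q) l##)) (##-++ʳ (##-⊆ˡ ([x]⊆ (∈-++⁺ʳ mid (here refl))) WtR) (##-revʳ q (##-⊆ʳ (r⊆ p) l##))))
        (##-revˡ mid (mk## λ i j → case inLL j of λ { (inj₁ k) → at WtR (∈-++⁺ˡ i) k ; (inj₂ k) → at WiY (there i) (∈YB C k) }))
        (λ i → case inLL i of λ { (inj₁ k) → f∉ k ; (inj₂ k) → proj₁ (at WiY (here refl) (∈YB C k)) refl })
        (Any-in (Any⇒∈ fr)))
    where
    ra = a ∷ R ++ [ s ]
    f#B : ∀ {z} → z ∈ (b ∷ B ++ [ t ]) → f # z
    f#B i = at WiY (here refl) (∈YB C i)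
    LLeq : x ∷ (reverse p ++ ra ++ reverse q) ++ [ y ] ≡ (x ∷ reverse p) ++ (ra ++ (reverse q ++ [ y ]))
    LLeq = cong (x ∷_) (trans (++-assoc (reverse p) (ra ++ reverse q) [ y ]) (cong (reverse p ++_) (++-assoc ra (reverse q) [ y ])))
    -- The hole of the first two rungs, cut open at `x y` instead of `a b`.
    hole : Hole x (reverse p ++ ra ++ reverse q) y
    hole = HoleList⇒Hole (subst HoleList (trans (cong (λ l → (x ∷ reverse p) ++ l) (++-assoc ra (reverse q) [ y ])) (cong (x ∷_) (trans (cong (reverse p ++_) (sym (++-assoc ra (reverse q) [ y ]))) (sym (++-assoc (reverse p) (ra ++ reverse q) [ y ])))))
      (HoleList-rotate ((ra ++ reverse q) ++ [ y ]) (x ∷ reverse p)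
        (subst HoleList (trans (Y≡ B) (trans (cong (ra ++_) (trans (sym (reverse-path b B t)) (trans (cong reverse eqB) (reverse-pair p)))) (trans (sym (++-assoc ra (reverse q) (y ∷ x ∷ reverse p))) (sym (++-assoc (ra ++ reverse q) [ y ] (x ∷ reverse p))))))
          (_ , _ , refl , ladder-hole (ipR P) (ipB P) (RB P)))))
    rp⊆ : ∀ {z} → z ∈ (x ∷ reverse p) → z ∈ (b ∷ B ++ [ t ])
    rp⊆ (here refl) = cast∈ (sym eqB) (∈-++⁺ʳ p (here refl))
    rp⊆ (there i) = cast∈ (sym eqB) (∈-++⁺ˡ (rev⊆ p i))
    rq⊆ : ∀ {z} → z ∈ (reverse q ++ [ y ]) → z ∈ (b ∷ B ++ [ t ])
    rq⊆ i with ∈-++⁻ (reverse q) i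
    ... | inj₁ j = cast∈ (sym eqB) (∈-++⁺ʳ p (there (there (rev⊆ q j))))
    ... | inj₂ (here refl) = cast∈ (sym eqB) (∈-++⁺ʳ p (there (here refl)))
    inLL : ∀ {z} → z ∈ (x ∷ (reverse p ++ ra ++ reverse q) ++ [ y ]) → (z ∈ ra) ⊎ (z ∈ (b ∷ B ++ [ t ]))
    inLL i with ∈-++⁻ (x ∷ reverse p) (cast∈ LLeq i)
    ... | inj₁ j = inj₂ (rp⊆ j)
    ... | inj₂ j with ∈-++⁻ ra j
    ... | inj₁ k = inj₁ k
    ... | inj₂ k = inj₂ (rq⊆ k)
    Any-in : (Σ V λ r → (r ∈ ra) × (f ~ r)) → Any (f ~_) (x ∷ (reverse p ++ ra ++ reverse q) ++ [ y ])
    Any-in (r , i , e) = ∈⇒Any (cast∈ (sym LLeq) (∈-++⁺ʳ (x ∷ reverse p) (∈-++⁺ˡ i))) e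
    conv : HoleAttachment f x (reverse p ++ ra ++ reverse q) y → ⊥
    conv (at-b e _) = proj₂ (f#B (rp⊆ (here refl))) e
    conv (at-c e _) = proj₂ (f#B (rq⊆ (∈-++⁺ʳ (reverse q) (here refl)))) e
    conv (pair p' u' v q' e fu fv h) with locate (x ∷ reverse p) p' (trans (sym LLeq) e)
    ... | inj₁ (q₁ , e₁ , _) = proj₂ (f#B (rp⊆ (cast∈ (sym e₁) (∈-++⁺ʳ p' (here refl))))) fu
    ... | inj₂ (inj₁ (e₁ , _)) = proj₂ (f#B (rp⊆ (cast∈ (sym e₁) (∈-++⁺ʳ p' (here refl))))) fu
    ... | inj₂ (inj₂ (p₂ , e₁ , refl)) with locate ra p₂ e₁
    ... | inj₁ (q₁ , e₂ , refl) = Reroute.conclude P IH ipW WtR WiY f∉ {p} {x} {y} {q} eqB lx l## lC {p₂} {u'} {v} {q₁} e₂ fu fv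
            (##-⊆ʳ (++-mono p₂ (r⊆ (x ∷ reverse p)) (l⊆ _)) h) p₂ refl
    ... | inj₂ (inj₁ (_ , e₂)) = proj₂ (f#B (rq⊆ (cast∈ (sym e₂) (here refl)))) fv
    ... | inj₂ (inj₂ (p₃ , e₂ , _)) = proj₂ (f#B (rq⊆ (cast∈ (sym e₂) (∈-++⁺ʳ p₃ (here refl))))) fu

-- Attachments to a prism

module Attachments (G : Graph) (noI : ¬ HasISK4 G) (noW : ¬ HasWheel G) (DF : DiamondFree G) where
  open Basics G
  open Prisms G
  open HoleAttachments G noI noW DF
  open ConnectorEnds G noI noW DF
  open Rerouting G noI noW DF

  module _ {a R s b B t c C u} (P : Prism a R s b B t c C u) where

    InR InY : V → Set
    InR x = x ∈ (a ∷ R ++ [ s ])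
    InY x = (x ∈ (b ∷ B ++ [ t ])) ⊎ (x ∈ (c ∷ C ++ [ u ]))

    -- `r` on the first rung and `y` on another one are corners of the same triangle.
    Loc : V → V → Set
    Loc r y = ((r ≡ a) × ((y ≡ b) ⊎ (y ≡ c))) ⊎ ((r ≡ s) × ((y ≡ t) ⊎ (y ≡ u)))

    Loc? : ∀ r y → Dec (Loc r y)
    Loc? r y = ((r ≟ a) ×-dec ((y ≟ b) ⊎-dec (y ≟ c))) ⊎-dec ((r ≟ s) ×-dec ((y ≟ t) ⊎-dec (y ≟ u)))

    Local : List V → Set
    Local W = ∀ {w w' r y} → w ∈ W → w' ∈ W → InR r → InY y → w ~ r → w' ~ y → Loc r y

    Outside : List V → Set
    Outside W = ∀ {w} → w ∈ W → ¬ InR w × ¬ InY w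

    -- An outside path in two presentations, `Wi ++ [ l ]` and `f ∷ Wt`, because the induction
    -- removes either end. For a single vertex `f` and `l` coincide.
    record Conn (Wi : List V) (l f : V) (Wt : List V) : Set where
      field
        ipW : IP (Wi ++ [ l ])
        eqW : Wi ++ [ l ] ≡ f ∷ Wt
        out : Outside (Wi ++ [ l ])
      f∈ : f ∈ (Wi ++ [ l ])
      f∈ = cast∈ (sym eqW) (here refl)
      l∈ : l ∈ (Wi ++ [ l ])
      l∈ = ∈-++⁺ʳ Wi (here refl)
      Wt⊆ : Wt ⊆ (Wi ++ [ l ])
      Wt⊆ i = cast∈ (sym eqW) (there i)

  swap⊎ : ∀ {X Y : Set} → X ⊎ Y → Y ⊎ X
  swap⊎ (inj₁ x) = inj₂ x
  swap⊎ (inj₂ y) = inj₁ y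

  module _ {a R s b B t c C u} (P : Prism a R s b B t c C u) where

    Y-swap : ∀ {x} → InY (swap P) x → InY P x
    Y-swap (inj₁ i) = inj₂ i
    Y-swap (inj₂ i) = inj₁ i

    Y-mirror : ∀ {x} → InY (mirror P) x → InY P x
    Y-mirror (inj₁ i) = inj₁ (unrev B i)
    Y-mirror (inj₂ i) = inj₂ (unrev C i)

    Y-swap⁻ : ∀ {x} → InY P x → InY (swap P) x
    Y-swap⁻ (inj₁ i) = inj₂ i
    Y-swap⁻ (inj₂ i) = inj₁ i

    Y-mirror⁻ : ∀ {x} → InY P x → InY (mirror P) x
    Y-mirror⁻ (inj₁ i) = inj₁ (rerev B i)
    Y-mirror⁻ (inj₂ i) = inj₂ (rerev C i)

    Loc-swap : ∀ {r y} → Loc P r y → Loc (swap P) r y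
    Loc-swap (inj₁ (e , h)) = inj₁ (e , swap⊎ h)
    Loc-swap (inj₂ (e , h)) = inj₂ (e , swap⊎ h)

    Loc-mirror : ∀ {r y} → Loc P r y → Loc (mirror P) r y
    Loc-mirror = swap⊎

    Local-swap : ∀ {W} → Local P W → Local (swap P) W
    Local-swap h i j r y e e' = Loc-swap (h i j r (Y-swap y) e e')

    Local-mirror : ∀ {W} → Local P W → Local (mirror P) W
    Local-mirror h i j r y e e' = Loc-mirror (h i j (unrev R r) (Y-mirror y) e e')

    conn-swap : ∀ {Wi l f Wt} → Conn P Wi l f Wt → Conn (swap P) Wi l f Wt
    conn-swap K = record { ipW = Conn.ipW K ; eqW = Conn.eqW K ; out = λ i → let o , o' = Conn.out K i in o , (λ y → o' (Y-swap y)) }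

    conn-mirror : ∀ {Wi l f Wt} → Conn P Wi l f Wt → Conn (mirror P) Wi l f Wt
    conn-mirror K = record { ipW = Conn.ipW K ; eqW = Conn.eqW K ; out = λ i → let o , o' = Conn.out K i in (λ r → o (unrev R r)) , (λ y → o' (Y-mirror y)) }

  Loc-unswap : ∀ {a R s b B t c C u} (P : Prism a R s b B t c C u) {r y} → Loc (swap P) r y → Loc P r y
  Loc-unswap P (inj₁ (e , inj₁ h)) = inj₁ (e , inj₂ h)
  Loc-unswap P (inj₁ (e , inj₂ h)) = inj₁ (e , inj₁ h)
  Loc-unswap P (inj₂ (e , inj₁ h)) = inj₂ (e , inj₂ h)
  Loc-unswap P (inj₂ (e , inj₂ h)) = inj₂ (e , inj₁ h)

  Loc-unmirror : ∀ {a R s b B t c C u} (P : Prism a R s b B t c C u) {r y} → Loc (mirror P) r y → Loc P r y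
  Loc-unmirror P (inj₁ h) = inj₂ h
  Loc-unmirror P (inj₂ h) = inj₁ h

  -- The path from a through W to c in the hole b..t u..c sees b before c.
  inner-Y-b : ∀ {a R s b B t c C u} (P : Prism a R s b B t c C u) {Wi l f Wt} → Conn P Wi l f Wt → f ~ a → (∀ {w} → w ∈ Wt → ¬ (w ~ a)) →
    (∀ {w y} → w ∈ Wi → InY P y → w ~ y → (y ≡ b) ⊎ (y ≡ c)) → ∀ {y} → InY P y → l ~ y → y ≢ b → y ≢ c →
    ∀ q₁ {w q₂} → Wi ≡ q₁ ++ w ∷ q₂ → (∀ {x} → x ∈ q₁ → ¬ (x ~ c)) → w ~ b → ⊥
  inner-Y-b {a} {R} {s} {b} {B} {t} {c} {C} {u} P {Wi} {l} {f} {Wt} K fa Wta WiY {y} yY ly y≢b y≢c q₁ {w} {q₂} eqWi q₁c wb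
    with lastSat (l ~?_) {B ++ t ∷ u ∷ reverse C} (∈⇒Any y∈N ly)
    where
    y∈N : y ∈ (B ++ t ∷ u ∷ reverse C)
    y∈N = case yY of λ
      { (inj₁ i) → case ∈-path⁻ B i of λ { (inj₁ e) → ⊥-elim (y≢b e) ; (inj₂ (inj₁ k)) → ∈-++⁺ˡ k ; (inj₂ (inj₂ refl)) → ∈-++⁺ʳ B (here refl) }
      ; (inj₂ i) → case ∈-path⁻ C i of λ { (inj₁ e) → ⊥-elim (y≢c e) ; (inj₂ (inj₁ k)) → ∈-++⁺ʳ B (there (there (rev⊇ C k))) ; (inj₂ (inj₂ refl)) → ∈-++⁺ʳ B (there (here refl)) } }
  ... | n₁ , y* , n₂ , eqN , ly* , ln₂ = b-before-c q₁ {w} {q₂ ++ l ∷ y* ∷ n₂} ipQ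
        (trans (cong (_++ (l ∷ y* ∷ n₂)) eqWi) (++-assoc q₁ (w ∷ q₂) (l ∷ y* ∷ n₂))) (λ i e → q₁c i (~-sym e)) c∉ b∉
        (Ladder.ab (RB P)) (Ladder.ab (RC P)) (Ladder.ab (BC P)) (~-sym wb) (lastc (snoc-view y* n₂))
    where
    open Conn K
    hp = ladder-hole (ipB P) (ipC P) (BC P)
    N = B ++ t ∷ u ∷ reverse C
    N⊆ : ∀ {z} → z ∈ N → InY P z
    N⊆ i = ∈Y⁻ C (there (∈-++⁺ˡ i))
    yn⊆ : ∀ {z} → z ∈ (y* ∷ n₂) → z ∈ N
    yn⊆ i = cast∈ (sym eqN) (∈-++⁺ʳ n₁ i)
    N≢b : ∀ {z} → z ∈ N → z ≢ b
    N≢b i e = unique-≢ [ b ] (IP-uniq (hpˡ hp)) (here refl) i (sym e)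
    N≢c : ∀ {z} → z ∈ N → z ≢ c
    N≢c i e = unique-≢ N (IP-uniq (hpʳ hp)) i (here refl) e
    ipN : IP (y* ∷ n₂ ++ [ c ])
    ipN = IP-++ʳ n₁ (subst IP (trans (cong (_++ [ c ]) eqN) (++-assoc n₁ (y* ∷ n₂) [ c ])) (hpʳ hp))
    ipaW : IP (a ∷ Wi ++ [ l ])
    ipaW = subst (λ l → IP (a ∷ l)) (sym eqW) (~-sym fa , mk[]## (λ i → (λ e → proj₁ (out (Wt⊆ i)) (here (sym e))) , λ e → Wta i (~-sym e)) , subst IP eqW ipW)
    ipQ : IP (a ∷ Wi ++ l ∷ y* ∷ n₂)
    ipQ = IP-cat (a ∷ Wi) ipaW (IP-++ˡ (y* ∷ n₂) ipN) ly*
      (##-cons (##-⊆ʳ yn⊆ (a##M P)) (mk## λ i j → (λ e → proj₂ (out (∈-++⁺ˡ i)) (subst (InY P) (sym e) (N⊆ (yn⊆ j)))) ,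
         λ e → case WiY i (N⊆ (yn⊆ j)) e of λ { (inj₁ h) → N≢b (yn⊆ j) h ; (inj₂ h) → N≢c (yn⊆ j) h }))
      (mk[]## λ j → (λ e → proj₂ (out l∈) (subst (InY P) (sym e) (N⊆ (yn⊆ (there j))))) , ln₂ j)
    c∉ : c ∉ (Wi ++ l ∷ y* ∷ n₂)
    c∉ i with ∈-++⁻ Wi i
    ... | inj₁ j = proj₂ (out (∈-++⁺ˡ j)) (inj₂ (here refl))
    ... | inj₂ (here refl) = proj₂ (out l∈) (inj₂ (here refl))
    ... | inj₂ (there j) = N≢c (yn⊆ j) refl
    b∉ : b ∉ (Wi ++ l ∷ y* ∷ n₂)
    b∉ i with ∈-++⁻ Wi i
    ... | inj₁ j = proj₂ (out (∈-++⁺ˡ j)) (inj₁ (here refl))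
    ... | inj₂ (here refl) = proj₂ (out l∈) (inj₁ (here refl))
    ... | inj₂ (there j) = N≢b (yn⊆ j) refl
    lastc : (Σ (List V) λ E → Σ V λ e → y* ∷ n₂ ≡ E ++ [ e ]) → Any (c ~_) (w ∷ q₂ ++ l ∷ y* ∷ n₂)
    lastc (E , e , eqE) = ∈⇒Any (there (∈-++⁺ʳ q₂ (there (cast∈ (sym eqE) (∈-++⁺ʳ E (here refl))))))
      (~-sym (IP-head (IP-++ʳ E {e ∷ c ∷ []} (subst IP (trans (cong (_++ [ c ]) eqE) (++-assoc E [ e ] [ c ])) ipN))))

  -- Of `b` and `c`, the one seen first along the path plays the role of `b` in `inner-Y-b`;
  -- exchanging the last two rungs covers the other case.
  inner-Y : ∀ {a R s b B t c C u} (P : Prism a R s b B t c C u) {Wi l f Wt} → Conn P Wi l f Wt → f ~ a → (∀ {w} → w ∈ Wt → ¬ (w ~ a)) →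
    (∀ {w y} → w ∈ Wi → InY P y → w ~ y → (y ≡ b) ⊎ (y ≡ c)) → ∀ {y} → InY P y → l ~ y → y ≢ b → y ≢ c →
    ∀ {w y'} → w ∈ Wi → InY P y' → w ~ y' → ⊥
  inner-Y {b = b} {c = c} P {Wi} K fa Wta WiY yY ly y≢b y≢c {w} wi y'Y wy' with firstSat (λ x → (x ~? b) ⊎-dec (x ~? c)) {Wi} (∈⇒Any wi (sat (WiY wi y'Y wy') wy'))
    where
    sat : ∀ {y'} → (y' ≡ b) ⊎ (y' ≡ c) → w ~ y' → (w ~ b) ⊎ (w ~ c)
    sat (inj₁ refl) e = inj₁ e
    sat (inj₂ refl) e = inj₂ e
  ... | q₁ , x , q₂ , eq , inj₁ xb , h = inner-Y-b P K fa Wta WiY yY ly y≢b y≢c q₁ eq (λ i e → h i (inj₂ e)) xb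
  ... | q₁ , x , q₂ , eq , inj₂ xc , h = inner-Y-b (swap P) (conn-swap P K) fa Wta (λ i j e → swap⊎ (WiY i (Y-swap P j) e)) (Y-swap⁻ P yY) ly y≢c y≢b q₁ eq (λ i e → h i (inj₁ e)) xc

  -- The hole t..W..r..a c..u through the edge tu, with s as third vertex of the triangle.
  inner-R : ∀ {a R s b B t c C u} (P : Prism a R s b B t c C u) {Wi l f Wt} → Conn P Wi l f Wt →
    (∀ {w y} → w ∈ Wi → InY P y → ¬ (w ~ y)) → (∀ {y} → InY P y → l ~ y → y ≡ t) → l ~ t →
    (∀ {w r} → w ∈ Wt → InR P r → w ~ r → r ≡ s) → ∀ {w} → w ∈ Wt → w ~ s → Any (f ~_) (a ∷ R) → ⊥
  inner-R {a} {R} {s} {b} {B} {t} {c} {C} {u} P {Wi} {l} {f} {Wt} K WiY lY lt WtR {w₀} w₀i w₀s an with firstSat (f ~?_) an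
  ... | p , r , q , eqR , fr , fp = no-third-neighbour (ladder-hole ip₁ ip₂ L) (Ladder.st (RB P)) (Ladder.st (RC P)) s∉ (∈⇒Any (∈-++⁺ˡ (rev⊇ Wt w₀i)) (~-sym w₀s))
    where
    open Conn K
    eqRev : reverse Wt ++ [ f ] ≡ l ∷ reverse Wi
    eqRev = trans (sym (unfold-reverse f Wt)) (trans (cong reverse (sym eqW)) (reverse-∷ʳ Wi l))
    ip₁ : IP (t ∷ reverse Wt ++ [ f ])
    ip₁ = subst (λ l → IP (t ∷ l)) (sym eqRev) (~-sym lt , ##-revʳ Wi (mk[]## λ i → (λ e → proj₂ (out (∈-++⁺ˡ i)) (inj₁ (subst (_∈ _) e (last∈ B)))) , λ e → WiY i (inj₁ (last∈ B)) (~-sym e))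
      , subst IP (reverse-∷ʳ Wi l) (IP-rev _ ipW))
    headp : Σ (List V) λ p' → p ++ [ r ] ≡ a ∷ p'
    headp = go p eqR
      where
      go : ∀ p → a ∷ R ≡ p ++ r ∷ q → Σ (List V) λ p' → p ++ [ r ] ≡ a ∷ p'
      go [] e = [] , cong (_∷ []) (sym (∷-injectiveˡ e))
      go (z ∷ p) e = p ++ [ r ] , cong (_∷ (p ++ [ r ])) (sym (∷-injectiveˡ e))
    p' = proj₁ headp
    pr⊆ : ∀ {z} → z ∈ (p ++ [ r ]) → z ∈ (a ∷ R)
    pr⊆ i = cast∈ (sym eqR) (++-mono p id (λ { (here e) → here e }) i)
    aR≢s : ∀ {z} → z ∈ (a ∷ R) → z ≢ s
    aR≢s i = unique-≢ (a ∷ R) (IP-uniq (ipR P)) i (here refl)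
    ippr : IP (p ++ [ r ])
    ippr = IP-++ˡ (p ++ [ r ]) {q} (subst IP (trans eqR (sym (++-assoc p [ r ] q))) (IP-++ˡ (a ∷ R) (ipR P)))
    ac : ∀ {z w} → z ∈ (p ++ [ r ]) → w ∈ (c ∷ C ++ [ u ]) → ((z ≡ a) × (w ≡ c)) ⊎ (z # w)
    ac i j with Ladder.cr (RC P) (∈-++⁺ˡ (pr⊆ i)) j
    ... | inj₁ h = inj₁ h
    ... | inj₂ (inj₁ (e , _)) = ⊥-elim (aR≢s (pr⊆ i) e)
    ... | inj₂ (inj₂ h) = inj₂ h
    eq₂ : u ∷ (reverse C ++ c ∷ p) ++ [ r ] ≡ (u ∷ reverse C) ++ c ∷ a ∷ p'
    eq₂ = cong (u ∷_) (trans (++-assoc (reverse C) (c ∷ p) [ r ]) (cong (λ l → reverse C ++ c ∷ l) (proj₂ headp)))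
    ap' : ∀ {z} → z ∈ (a ∷ p') → z ∈ (p ++ [ r ])
    ap' i = cast∈ (sym (proj₂ headp)) i
    ip₂ : IP (u ∷ (reverse C ++ c ∷ p) ++ [ r ])
    ip₂ = subst IP (sym eq₂) (IP-cat (u ∷ reverse C) (IP-mirror C (ipC P)) (subst IP (proj₂ headp) ippr) (~-sym (Ladder.ab (RC P)))
        (##-sym (mk## λ i j → case ac (ap' i) (unrev C (∈-++⁺ˡ j)) of λ
           { (inj₁ (_ , e)) → ⊥-elim (unique-≢ (u ∷ reverse C) (IP-uniq (IP-mirror C (ipC P))) j (here refl) e) ; (inj₂ h) → h }))
        (##-sym (mk## λ { i (here refl) → case ac (ap' (there i)) (here refl) of λ
           { (inj₁ (e , _)) → ⊥-elim (unique-≢ [ a ] (subst Unique (proj₂ headp) (IP-uniq ippr)) (here refl) i (sym e)) ; (inj₂ h) → h } })))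
    in₁ : ∀ {z} → z ∈ (reverse Wt ++ [ f ]) → z ∈ (f ∷ Wt)
    in₁ i with ∈-++⁻ (reverse Wt) i
    ... | inj₁ j = there (rev⊆ Wt j)
    ... | inj₂ (here e) = here e
    in₂ : ∀ {z} → z ∈ (u ∷ (reverse C ++ c ∷ p) ++ [ r ]) → (z ∈ (c ∷ C ++ [ u ])) ⊎ (z ∈ (p ++ [ r ]))
    in₂ i with ∈-++⁻ (u ∷ reverse C ++ [ c ]) (cast∈ (cong (u ∷_) (trans (++-assoc (reverse C) (c ∷ p) [ r ]) (sym (++-assoc (reverse C) [ c ] (p ++ [ r ]))))) i)
    ... | inj₁ j = inj₁ (unrev C j)
    ... | inj₂ j = inj₂ j
    W∈ : ∀ {z} → z ∈ (f ∷ Wt) → z ∈ (Wi ++ [ l ])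
    W∈ i = cast∈ (sym eqW) i
    W≁c : ∀ {z w} → z ∈ (f ∷ Wt) → w ∈ (c ∷ C ++ [ u ]) → z # w
    W≁c i j = (λ e → proj₂ (out (W∈ i)) (inj₂ (subst (_∈ _) (sym e) j))) , λ e → case ∈-++⁻ Wi (W∈ i) of λ
      { (inj₁ k) → WiY k (inj₂ j) e ; (inj₂ (here refl)) → ladder-≢ (BC P) (last∈ B) j (sym (lY (inj₂ j) e)) }
    cross : ∀ {z w} → z ∈ (t ∷ reverse Wt ++ [ f ]) → (w ∈ (c ∷ C ++ [ u ])) ⊎ (w ∈ (p ++ [ r ])) → Cross t f u r z w
    cross (here refl) (inj₁ j) with Ladder.cr (BC P) (last∈ B) j
    ... | inj₁ (e , _) = ⊥-elim (path-≢ (ipB P) (sym e))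
    ... | inj₂ (inj₁ h) = inj₁ h
    ... | inj₂ (inj₂ h) = inj₂ (inj₂ h)
    cross (here refl) (inj₂ j) with Ladder.cr (RB P) (∈-++⁺ˡ (pr⊆ j)) (last∈ B)
    ... | inj₁ (_ , e) = ⊥-elim (path-≢ (ipB P) (sym e))
    ... | inj₂ (inj₁ (e , _)) = ⊥-elim (aR≢s (pr⊆ j) e)
    ... | inj₂ (inj₂ h) = inj₂ (inj₂ (#-sym h))
    cross (there i) (inj₁ j) = inj₂ (inj₂ (W≁c (in₁ i) j))
    cross (there i) (inj₂ j) with in₁ i
    ... | there k = inj₂ (inj₂ ((λ e → proj₁ (out (Wt⊆ k)) (subst (InR P) (sym e) (∈-++⁺ˡ (pr⊆ j)))) , λ e → aR≢s (pr⊆ j) (WtR k (∈-++⁺ˡ (pr⊆ j)) e)))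
    ... | here refl with ∈-++⁻ p j
    ... | inj₁ k = inj₂ (inj₂ ((λ e → proj₁ (out f∈) (subst (InR P) (sym e) (∈-++⁺ˡ (pr⊆ j)))) , fp k))
    ... | inj₂ (here refl) = inj₂ (inj₁ (refl , refl))
    L : Ladder t (reverse Wt) f u (reverse C ++ c ∷ p) r
    L = mkLadder (Ladder.st (BC P)) fr λ i j → cross i (in₂ j)
    s∉ : s ∉ (reverse Wt ++ f ∷ r ∷ reverse (reverse C ++ c ∷ p))
    s∉ i with ∈Y⁻ {t} {reverse Wt} {f} {u} (reverse C ++ c ∷ p) {r} (there (∈-++⁺ˡ i))
    ... | inj₁ (here e) = ladder-≢ (RB P) (last∈ R) (last∈ B) e
    ... | inj₁ (there j) = proj₁ (out (W∈ (in₁ j))) (last∈ R)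
    ... | inj₂ j with in₂ j
    ... | inj₁ k = ladder-≢ (RC P) (last∈ R) k refl
    ... | inj₂ k = aR≢s (pr⊆ k) refl

  module _ {a R s b B t c C u} (P : Prism a R s b B t c C u) {Wi l f Wt} (K : Conn P Wi l f Wt)
    (WtR : ∀ {w r} → w ∈ Wt → InR P r → ¬ (w ~ r)) (WiY : ∀ {w y} → w ∈ Wi → InY P y → ¬ (w ~ y)) where
    open Conn K

    private
      WtR## : Wt ## (a ∷ R ++ [ s ])
      WtR## = mk## λ i j → (λ e → proj₁ (out (Wt⊆ i)) (subst (InR P) (sym e) j)) , WtR i j
      WiY## : ∀ {M} → (∀ {z} → z ∈ M → InY P z) → Wi ## M
      WiY## h = mk## λ i j → (λ e → proj₂ (out (∈-++⁺ˡ i)) (subst (InY P) (sym e) (h j))) , WiY i (h j)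

    finish-B : Shorter a R → ∀ {r} → InR P r → f ~ r → ∀ {p x y q} → b ∷ B ++ [ t ] ≡ p ++ x ∷ y ∷ q → l ~ x → l ~ y → [ l ] ## (p ++ q) → [ l ] ## (c ∷ C ++ [ u ]) → ⊥
    finish-B IH ri fr e lx ly h hC = attached-pair⇒⊥ P IH ipW eqW WtR## (WiY## (∈Y⁻ C)) (proj₁ (out f∈)) (λ i → proj₂ (out l∈) (∈Y⁻ C i)) (∈⇒Any ri fr) e lx ly h hC

    finish-C : Shorter a R → ∀ {r} → InR P r → f ~ r → ∀ {p x y q} → c ∷ C ++ [ u ] ≡ p ++ x ∷ y ∷ q → l ~ x → l ~ y → [ l ] ## (p ++ q) → [ l ] ## (b ∷ B ++ [ t ]) → ⊥
    finish-C IH ri fr e lx ly h hB = attached-pair⇒⊥ (swap P) IH ipW eqW WtR## (WiY## (λ i → Y-swap P (∈Y⁻ B i))) (proj₁ (out f∈)) (λ i → proj₂ (out l∈) (Y-swap P (∈Y⁻ B i))) (∈⇒Any ri fr) e lx ly h hB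

    attach : ∀ {y} → InY P y → l ~ y → Any (f ~_) (a ∷ R) → Attach l b B t c C u
    attach yi ly fr = last-attachment P ipW eqW WtR## (WiY## (∈Y⁻ C)) (proj₁ (out f∈)) (proj₁ (out l∈)) (λ i → proj₂ (out l∈) (∈Y⁻ C i)) fr
      (case yi of λ { (inj₁ i) → ∈⇒Any (∈YB C i) ly ; (inj₂ i) → ∈⇒Any (∈YC C i) ly })

  -- Now `last-attachment` can be read from either triangle. If `f` sees the first rung before `s`,
  -- the only neighbour of `l` is `b` or `c`; if `f` sees it beyond `a`, the only neighbour of `l`
  -- is `t` or `u`; pairs are excluded by minimality. Both readings at once contradict each other,
  -- and a single one is local.
  clean : ∀ {a R s b B t c C u} (P : Prism a R s b B t c C u) → Shorter a R → ∀ {Wi l f Wt} (K : Conn P Wi l f Wt) →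
    (∀ {w r} → w ∈ Wt → InR P r → ¬ (w ~ r)) → (∀ {w y} → w ∈ Wi → InY P y → ¬ (w ~ y)) →
    ∀ {r y} → InR P r → InY P y → f ~ r → l ~ y → ¬ Loc P r y → ⊥
  clean {a} {R} {s} {b} {B} {t} {c} {C} {u} P IH {Wi} {l} {f} {Wt} K WtR WiY {r} {y} ri yi fr ly ¬loc = go (Any.any? (f ~?_) (a ∷ R))
    where
    Only : V → Set
    Only z = ∀ {y} → InY P y → l ~ y → y ≡ z
    back : Attach l t (reverse B) b u (reverse C) c → ((l ~ t) × Only t) ⊎ ((l ~ u) × Only u)
    back (only-b lt h₁ h₂) = inj₁ (lt , λ { (inj₁ i) e → case rerev B i of λ { (here h) → h ; (there j) → ⊥-elim (proj₂ (at h₁ (here refl) j) e) } ; (inj₂ i) e → ⊥-elim (proj₂ (at h₂ (here refl) (rerev C i)) e) })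
    back (only-c lu h₁ h₂) = inj₂ (lu , λ { (inj₂ i) e → case rerev C i of λ { (here h) → h ; (there j) → ⊥-elim (proj₂ (at h₁ (here refl) j) e) } ; (inj₁ i) e → ⊥-elim (proj₂ (at h₂ (here refl) (rerev B i)) e) })
    back (pair-B p x y q e lx ly h h') = ⊥-elim (finish-B P K WtR WiY IH ri fr {reverse q} (trans (sym (reverse-involutive _)) (trans (cong reverse (trans (reverse-path b B t) e)) (reverse-pair p))) ly lx
       (##-⊆ʳ (++-⊆ (reverse q) (r⊆ p ∘ rev⊆ q) (l⊆ q ∘ rev⊆ p)) h) (##-⊆ʳ (rerev C) h'))
    back (pair-C p x y q e lx ly h h') = ⊥-elim (finish-C P K WtR WiY IH ri fr {reverse q} (trans (sym (reverse-involutive _)) (trans (cong reverse (trans (reverse-path c C u) e)) (reverse-pair p))) ly lx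
       (##-⊆ʳ (++-⊆ (reverse q) (r⊆ p ∘ rev⊆ q) (l⊆ q ∘ rev⊆ p)) h) (##-⊆ʳ (rerev B) h'))
    farView : r ∈ (s ∷ reverse R) → ((l ~ t) × Only t) ⊎ ((l ~ u) × Only u)
    farView ri' = back (attach (mirror P) (conn-mirror P K) (λ i j → WtR i (unrev R j)) (λ i j → WiY i (Y-mirror P j)) (Y-mirror⁻ P yi) ly (∈⇒Any ri' fr))
    far : r ≢ a → r ∈ (s ∷ reverse R)
    far r≢a with ∈-path⁻ R ri
    ... | inj₁ e = ⊥-elim (r≢a e)
    ... | inj₂ (inj₁ k) = there (rev⊇ R k)
    ... | inj₂ (inj₂ e) = here e
    go : Dec (Any (f ~_) (a ∷ R)) → ⊥
    go (yes an) with attach P K WtR WiY yi ly an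
    ... | pair-B p x y q e lx ly h h' = finish-B P K WtR WiY IH ri fr {p} e lx ly h h'
    ... | pair-C p x y q e lx ly h h' = finish-C P K WtR WiY IH ri fr {p} e lx ly h h'
    ... | only-b lb h₁ h₂ = case farView (far λ e → ¬loc (inj₁ (e , inj₁ y≡b))) of λ
          { (inj₁ (lt , _)) → proj₂ (at h₁ (here refl) (∈-++⁺ʳ B (here refl))) lt ; (inj₂ (lu , _)) → proj₂ (at h₂ (here refl) (last∈ C)) lu }
      where
      y≡b : y ≡ b
      y≡b = case yi of λ { (inj₁ (here e)) → e ; (inj₁ (there i)) → ⊥-elim (proj₂ (at h₁ (here refl) i) ly) ; (inj₂ i) → ⊥-elim (proj₂ (at h₂ (here refl) i) ly) }
    ... | only-c lc h₁ h₂ = case farView (far λ e → ¬loc (inj₁ (e , inj₂ y≡c))) of λ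
          { (inj₁ (lt , _)) → proj₂ (at h₂ (here refl) (last∈ B)) lt ; (inj₂ (lu , _)) → proj₂ (at h₁ (here refl) (∈-++⁺ʳ C (here refl))) lu }
      where
      y≡c : y ≡ c
      y≡c = case yi of λ { (inj₂ (here e)) → e ; (inj₂ (there i)) → ⊥-elim (proj₂ (at h₁ (here refl) i) ly) ; (inj₁ i) → ⊥-elim (proj₂ (at h₂ (here refl) i) ly) }
    go (no ¬an) = case farView (here r≡s) of λ
        { (inj₁ (_ , h)) → ¬loc (inj₂ (r≡s , inj₁ (h yi ly))) ; (inj₂ (_ , h)) → ¬loc (inj₂ (r≡s , inj₂ (h yi ly))) }
      where
      r≡s : r ≡ s
      r≡s = case ∈-++⁻ (a ∷ R) ri of λ { (inj₁ i) → ⊥-elim (¬an (∈⇒Any i fr)) ; (inj₂ (here e)) → e }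

  module _ {a R s b B t c C u} (P : Prism a R s b B t c C u) (IH : Shorter a R) {Wi l f Wt} (K : Conn P Wi l f Wt)
    (Lt : Local P Wt) (Li : Local P Wi) {r y} (ri : InR P r) (yi : InY P y) (fr : f ~ r) (ly : l ~ y) (¬loc : ¬ Loc P r y) where
    open Conn K

    private
      f∈Wi : ∀ {w} → w ∈ Wi → f ∈ Wi
      f∈Wi i = go Wi eqW i
        where
        go : ∀ Wi {w} → Wi ++ [ l ] ≡ f ∷ Wt → w ∈ Wi → f ∈ Wi
        go (x ∷ Wi) refl i = here refl
      l∈Wt : ∀ {w} → w ∈ Wt → l ∈ Wt
      l∈Wt i = go Wi eqW i
        where
        go : ∀ Wi {w} → Wi ++ [ l ] ≡ f ∷ Wt → w ∈ Wt → l ∈ Wt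
        go [] refl ()
        go (x ∷ Wi) refl i = ∈-++⁺ʳ Wi (here refl)

    -- Locality of `Wi` and the edge from `f` to `r` force `r` to be `a` or `s`, and confine what
    -- `Wi` sees on the other rungs to the two corners next to `r`. By `¬loc` the neighbour `y` of
    -- `l` is none of these, so `inner-Y` applies.
    no-inner-Y : ∀ {w y'} → w ∈ Wi → InY P y' → w ~ y' → ⊥
    no-inner-Y wi y'i wy' with Li (f∈Wi wi) wi ri y'i fr wy'
    ... | inj₁ (refl , _) = inner-Y P K fr (λ i e → ¬loc (Lt i (l∈Wt i) ri yi e ly)) (λ i j e → onlybc (Li (f∈Wi i) i ri j fr e)) yi ly
          (λ e → ¬loc (inj₁ (refl , inj₁ e))) (λ e → ¬loc (inj₁ (refl , inj₂ e))) wi y'i wy'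
      where
      onlybc : ∀ {y} → Loc P a y → (y ≡ b) ⊎ (y ≡ c)
      onlybc (inj₁ (_ , h)) = h
      onlybc (inj₂ (e , _)) = ⊥-elim (path-≢ (ipR P) e)
    ... | inj₂ (refl , _) = inner-Y (mirror P) (conn-mirror P K) fr (λ i e → ¬loc (Lt i (l∈Wt i) ri yi e ly)) (λ i j e → onlytu (Li (f∈Wi i) i ri (Y-mirror P j) fr e)) (Y-mirror⁻ P yi) ly
          (λ e → ¬loc (inj₂ (refl , inj₁ e))) (λ e → ¬loc (inj₂ (refl , inj₂ e))) wi (Y-mirror⁻ P y'i) wy'
      where
      onlytu : ∀ {y} → Loc P s y → (y ≡ t) ⊎ (y ≡ u)
      onlytu (inj₂ (_ , h)) = h
      onlytu (inj₁ (e , _)) = ⊥-elim (path-≢ (ipR P) (sym e))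

  -- Supplies what `inner-R` asks for: locality of `Wt` leaves `s` as the only vertex of the first
  -- rung that `Wt` sees, and `l` cannot see `u` besides `t`, since diamond-freeness would make it
  -- `s`.
  inner-R-t : ∀ {a R s b B t c C u} (P : Prism a R s b B t c C u) {Wi l f Wt} (K : Conn P Wi l f Wt)
    → Local P Wt → (∀ {w y} → w ∈ Wi → InY P y → ¬ (w ~ y)) → ∀ {r} → InR P r → f ~ r → l ~ t → ¬ Loc P r t →
    l ∈ Wt → ∀ {w} → w ∈ Wt → w ~ s → ⊥
  inner-R-t {a} {R} {s} {b} {B} {t} {c} {C} {u} P {Wi} {l} {f} {Wt} K Lt WiY {r} ri fr lt ¬loc lWt {w} wi ws =
      inner-R P K WiY onlyt lt (λ i j e → onlys (Lt i lWt j (inj₁ (last∈ B)) e lt)) wi ws (∈⇒Any r∈ fr)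
    where
    open Conn K
    t≢b : t ≢ b
    t≢b e = path-≢ (ipB P) (sym e)
    t≢c : t ≢ c
    t≢c = ladder-≢ (BC P) (last∈ B) (here refl)
    onlyt : ∀ {y} → InY P y → l ~ y → y ≡ t
    onlyt yi ly with Lt wi lWt (last∈ R) yi ws ly
    ... | inj₁ (e , _) = ⊥-elim (path-≢ (ipR P) (sym e))
    ... | inj₂ (_ , inj₁ e) = e
    ... | inj₂ (_ , inj₂ refl) = ⊥-elim (proj₁ (out l∈) (subst (InR P) (DF (Ladder.st (BC P)) (Ladder.st (RB P)) (Ladder.st (RC P)) lt ly) (last∈ R)))
    onlys : ∀ {r} → Loc P r t → r ≡ s
    onlys (inj₁ (_ , inj₁ e)) = ⊥-elim (t≢b e)
    onlys (inj₁ (_ , inj₂ e)) = ⊥-elim (t≢c e)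
    onlys (inj₂ (e , _)) = e
    r∈ : r ∈ (a ∷ R)
    r∈ with ∈-++⁻ (a ∷ R) ri
    ... | inj₁ i = i
    ... | inj₂ (here e) = ⊥-elim (¬loc (inj₂ (e , inj₁ refl)))

  -- Locality puts `r'` and the neighbour `y` of `l` into one triangle. Exchanging rungs and
  -- exchanging triangles moves `y` to `t` in all four cases.
  no-inner-R : ∀ {a R s b B t c C u} (P : Prism a R s b B t c C u) {Wi l f Wt} (K : Conn P Wi l f Wt)
    → Local P Wt → (∀ {w y} → w ∈ Wi → InY P y → ¬ (w ~ y)) → ∀ {r y} → InR P r → InY P y → f ~ r → l ~ y → ¬ Loc P r y →
    l ∈ Wt → ∀ {w r'} → w ∈ Wt → InR P r' → w ~ r' → ⊥
  no-inner-R {R = R} P K Lt WiY ri yi fr ly ¬loc lWt wi r'i wr' with Lt wi lWt r'i yi wr' ly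
  ... | inj₂ (refl , inj₁ refl) = inner-R-t P K Lt WiY ri fr ly ¬loc lWt wi wr'
  ... | inj₂ (refl , inj₂ refl) = inner-R-t (swap P) (conn-swap P K) (Local-swap P Lt) (λ i j → WiY i (Y-swap P j)) ri fr ly (¬loc ∘ Loc-unswap P) lWt wi wr'
  ... | inj₁ (refl , inj₁ refl) = inner-R-t (mirror P) (conn-mirror P K) (Local-mirror P Lt) (λ i j → WiY i (Y-mirror P j)) (rerev R ri) fr ly (¬loc ∘ Loc-unmirror P) lWt wi wr'
  ... | inj₁ (refl , inj₂ refl) = inner-R-t (swap (mirror P)) (conn-swap (mirror P) (conn-mirror P K)) (Local-swap (mirror P) (Local-mirror P Lt))
         (λ i j → WiY i (Y-mirror P (Y-swap (mirror P) j))) (rerev R ri) fr ly (¬loc ∘ Loc-unmirror P ∘ Loc-unswap (mirror P)) lWt wi wr'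

  core : ∀ {a R s b B t c C u} (P : Prism a R s b B t c C u) → Shorter a R → ∀ {Wi l f Wt} → Conn P Wi l f Wt → Local P Wt → Local P Wi →
    ∀ {r y} → InR P r → InY P y → f ~ r → l ~ y → Loc P r y
  core P IH {Wi} {l} {f} {Wt} K Lt Li {r} {y} ri yi fr ly with Loc? P r y
  ... | yes h = h
  ... | no ¬loc = ⊥-elim (clean P IH K (λ i j e → no-inner-R P K Lt nY ri yi fr ly ¬loc (lWt Wi (Conn.eqW K) i) i j e) nY ri yi fr ly ¬loc)
    where
    nY : ∀ {w y} → w ∈ Wi → InY P y → ¬ (w ~ y)
    nY i j e = no-inner-Y P IH K Lt Li ri yi fr ly ¬loc i j e
    lWt : ∀ Wi {w} → Wi ++ [ l ] ≡ f ∷ Wt → w ∈ Wt → l ∈ Wt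
    lWt [] refl ()
    lWt (x ∷ Wi) refl i = ∈-++⁺ʳ Wi (here refl)

  -- Induction on the length. Two attachments that avoid one end of the path belong to a shorter
  -- path, so only attachments at opposite ends are new; `core` treats them, on the path or on its
  -- reverse.
  local : ∀ {a R s b B t c C u} (P : Prism a R s b B t c C u) → Shorter a R → ∀ k W → length W ≤ k → IP W → Outside P W → Local P W
  local P IH k [] _ ip o ()
  local P IH (suc k) (w ∷ []) _ ip o (here refl) (here refl) ri yi e e' =
    core P IH {[]} {w} {w} {[]} (record { ipW = tt ; eqW = refl ; out = o }) (λ ()) (λ ()) ri yi e e'
  local {R = R} P IH (suc k) (f ∷ w ∷ W) (s≤s len) ip o {x} {x'} i j ri yi e e' with snoc-view w W
  ... | mid , l , eq = go i (cast∈ (cong (f ∷_) eq) i) j (cast∈ (cong (f ∷_) eq) j) e e'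
    where
    ip' : IP (f ∷ mid ++ [ l ])
    ip' = subst (λ W → IP (f ∷ W)) eq ip
    Lt : Local P (w ∷ W)
    Lt = local P IH k (w ∷ W) len (IP-tail ip) (o ∘ there)
    Li : Local P (f ∷ mid)
    Li = local P IH k (f ∷ mid) (≤-trans (≤-reflexive (trans (sym (trans (length-++ mid) (+-comm _ 1))) (cong length (sym eq)))) len) (IP-++ˡ (f ∷ mid) ip')
      (λ i → o (cast∈ (cong (f ∷_) (sym eq)) (∈-++⁺ˡ i)))
    K : Conn P (f ∷ mid) l f (w ∷ W)
    K = record { ipW = ip' ; eqW = cong (f ∷_) (sym eq) ; out = λ i → o (cast∈ (cong (f ∷_) (sym eq)) i) }
    revmid : reverse (w ∷ W) ≡ l ∷ reverse mid
    revmid = trans (cong reverse eq) (reverse-∷ʳ mid l)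
    K' : Conn P (reverse (w ∷ W)) f l (reverse mid ++ [ f ])
    K' = record { ipW = subst IP (unfold-reverse f (w ∷ W)) (IP-rev _ ip)
                ; eqW = cong (_++ [ f ]) revmid
                ; out = λ i → o (reverse⁻ (cast∈ (sym (unfold-reverse f (w ∷ W))) i)) }
    Lt' : Local P (reverse mid ++ [ f ])
    Lt' i j = Li (re i) (re j)
      where
      re : ∀ {z} → z ∈ (reverse mid ++ [ f ]) → z ∈ (f ∷ mid)
      re i = reverse⁻ (cast∈ (sym (unfold-reverse f mid)) i)
    Li' : Local P (reverse (w ∷ W))
    Li' i j = Lt (reverse⁻ i) (reverse⁻ j)
    go : ∀ {x x'} → x ∈ (f ∷ w ∷ W) → x ∈ (f ∷ mid ++ [ l ]) → x' ∈ (f ∷ w ∷ W) → x' ∈ (f ∷ mid ++ [ l ]) → x ~ _ → x' ~ _ → Loc P _ _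
    go (there i) _ (there j) _ e e' = Lt i j ri yi e e'
    go (here refl) _ j j' e e' with ∈-++⁻ (f ∷ mid) j'
    ... | inj₁ q = Li (here refl) q ri yi e e'
    ... | inj₂ (here refl) = core P IH K Lt Li ri yi e e'
    go (there i) i' (here refl) _ e e' with ∈-++⁻ (f ∷ mid) i'
    ... | inj₁ p = Li p (here refl) ri yi e e'
    ... | inj₂ (here refl) = core P IH K' Lt' Li' ri yi e e'

-- Clique cutsets

module Paths (G : Graph) where
  open Basics G

  suffix-last : ∀ (l : List V) {v} p {x q} → l ++ [ v ] ≡ p ++ x ∷ q → Σ (List V) λ l' → x ∷ q ≡ l' ++ [ v ]
  suffix-last l p {x} e with snoc-split l p e
  ... | inj₁ (refl , _ , refl) = [] , refl
  ... | inj₂ (q' , refl , _) = x ∷ q' , refl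

  -- As in `Reach`, the starting vertex is exempt from `ok`.
  record PathIn (ok : V → Set) (u v : V) : Set where
    field
      tl   : List V
      ip   : IP (u ∷ tl)
      oks  : ∀ {x} → x ∈ tl → ok x
      ini  : List V
      ends : u ∷ tl ≡ ini ++ [ v ]

  -- The induced path grows at its front: it is cut at `u` if `u` already lies on it, and otherwise
  -- `u` jumps to its last neighbour.
  reach⇒path : ∀ {ok u v} → Reach G ok u v → PathIn ok u v
  reach⇒path here = record { tl = [] ; ip = tt ; oks = λ () ; ini = [] ; ends = refl }
  reach⇒path {ok} {u} {v} (step {v = w} uw okw r) with reach⇒path r
  ... | record { tl = l ; ip = ip ; oks = oks ; ini = ini ; ends = ends } with u ∈? (w ∷ l)
  ... | yes i with ∈-∃++ i
  ... | p , q , e with suffix-last ini p (trans (sym ends) e)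
  ... | l' , e' = record { tl = q ; ip = IP-++ʳ p (subst IP e ip)
        ; oks = λ {x} j → all (cast∈ (sym e) (∈-++⁺ʳ p (there j))) ; ini = l' ; ends = e' }
    where
    all : ∀ {x} → x ∈ (w ∷ l) → ok x
    all (here refl) = okw
    all (there j) = oks j
  reach⇒path {ok} {u} {v} (step {v = w} uw okw r) | record { tl = l ; ip = ip ; oks = oks ; ini = ini ; ends = ends } | no u∉ with lastSat (u ~?_) {w ∷ l} (here uw)
  ... | p , x , q , e , ux , h with suffix-last ini p (trans (sym ends) e)
  ... | l' , e' = record { tl = x ∷ q
        ; ip = ux , mk[]## (λ j → (λ eq → u∉ (subst (_∈ (w ∷ l)) (sym eq) (cast∈ (sym e) (∈-++⁺ʳ p (there j))))) , h j) , IP-++ʳ p (subst IP e ip)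
        ; oks = λ {x} j → all (cast∈ (sym e) (∈-++⁺ʳ p j)) ; ini = u ∷ l' ; ends = cong (u ∷_) e' }
    where
    all : ∀ {x} → x ∈ (w ∷ l) → ok x
    all (here refl) = okw
    all (there j) = oks j

  CliqueList : List V → Set
  CliqueList L = ∀ {x y} → x ∈ L → y ∈ L → x ≢ y → x ~ y

  does-true : ∀ {P : Set} (d : Dec P) → does d ≡ true → P
  does-true (yes p) _ = p
  does-true (no _) ()

  does-false : ∀ {P : Set} (d : Dec P) → does d ≡ false → ¬ P
  does-false (no ¬p) _ = ¬p
  does-false (yes _) ()

  -- The double negation costs nothing, as every use refutes something. With `L` empty it expresses
  -- connectedness.
  connected-avoiding : ¬ HasCliqueCutset G → ∀ L → CliqueList L → ∀ {u v} → u ∉ L → v ∉ L → ¬ ¬ PathIn (_∉ L) u v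
  connected-avoiding noC L cl {u} {v} u∉ v∉ k = noC ((λ x → does (x ∈? L)) , (λ x y ex ey → cl (does-true (x ∈? L) ex) (does-true (y ∈? L) ey)) ,
      u , v , dec-false (u ∈? L) u∉ , dec-false (v ∈? L) v∉ , λ r → k (weaken (reach⇒path r)))
    where
    weaken : ∀ {u v} → PathIn (λ w → does (w ∈? L) ≡ false) u v → PathIn (_∉ L) u v
    weaken p = record { PathIn p ; oks = λ {x} i → does-false (x ∈? L) (PathIn.oks p i) }

module Diamonds (G : Graph) (noW : ¬ HasWheel G) (noC : ¬ HasCliqueCutset G) where
  open Basics G
  open Paths G
  open Wheels G noW

  edge-clique : ∀ {b c} → b ~ c → CliqueList (b ∷ c ∷ [])
  edge-clique e (here refl) (here refl) ne = ⊥-elim (ne refl)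
  edge-clique e (here refl) (there (here refl)) ne = e
  edge-clique e (there (here refl)) (here refl) ne = ~-sym e
  edge-clique e (there (here refl)) (there (here refl)) ne = ⊥-elim (ne refl)

  diamondFree : DiamondFree G
  diamondFree {b} {c} {x} {y} bc xb xc yb yc = decidable-stable (x ≟ y) λ x≢y →
      connected-avoiding noC (b ∷ c ∷ []) (edge-clique bc) (notin xb xc) (notin yb yc) λ p → go x≢y p
    where
    notin : ∀ {z} → z ~ b → z ~ c → z ∉ (b ∷ c ∷ [])
    notin zb zc (here refl) = ~-irr zb
    notin zb zc (there (here refl)) = ~-irr zc
    go : x ≢ y → PathIn (_∉ (b ∷ c ∷ [])) x y → ⊥
    go x≢y record { tl = l ; ip = ip ; oks = oks ; ini = ini ; ends = ends } with y∈l ini ends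
      where
      y∈l : ∀ ini → x ∷ l ≡ ini ++ [ y ] → y ∈ l
      y∈l [] refl = ⊥-elim (x≢y refl)
      y∈l (_ ∷ ini) refl = ∈-++⁺ʳ ini (here refl)
    -- The search ends at `y` at the latest, and whichever of `b` and `c` is not met first is still
    -- seen by `y`.
    ... | y∈ with firstSat (λ z → (b ~? z) ⊎-dec (c ~? z)) (∈⇒Any y∈ (inj₁ (~-sym yb)))
    ... | q₁ , w , q₂ , eq , inj₁ bw , h = b-before-c q₁ ip eq (λ i e → h i (inj₂ e)) (λ i → oks i (there (here refl))) (λ i → oks i (here refl)) xb xc bc bw (after yc (λ i e → h i (inj₂ (~-sym e))))
      where
      after : ∀ {d} → y ~ d → (∀ {z} → z ∈ q₁ → ¬ (z ~ d)) → Any (d ~_) (w ∷ q₂)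
      after yd h' with ∈-++⁻ q₁ (cast∈ eq y∈)
      ... | inj₁ i = ⊥-elim (h' i yd)
      ... | inj₂ i = ∈⇒Any i (~-sym yd)
    ... | q₁ , w , q₂ , eq , inj₂ cw , h = b-before-c q₁ ip eq (λ i e → h i (inj₁ e)) (λ i → oks i (here refl)) (λ i → oks i (there (here refl))) xc xb (~-sym bc) cw (after yb (λ i e → h i (inj₁ (~-sym e))))
      where
      after : ∀ {d} → y ~ d → (∀ {z} → z ∈ q₁ → ¬ (z ~ d)) → Any (d ~_) (w ∷ q₂)
      after yd h' with ∈-++⁻ q₁ (cast∈ eq y∈)
      ... | inj₁ i = ⊥-elim (h' i yd)
      ... | inj₂ i = ∈⇒Any i (~-sym yd)

-- Existence of prisms

module PrismExists (G : Graph) (noI : ¬ HasISK4 G) (noW : ¬ HasWheel G) (noC : ¬ HasCliqueCutset G) where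
  open Basics G
  open Paths G
  open Diamonds G noW noC
  open Prisms G
  open HoleAttachments G noI noW diamondFree

  snoc-last : ∀ {W : List V} {n₁ y n₂} → W ≡ n₁ ++ y ∷ n₂ → ∀ {c} → IP (W ++ [ c ]) → Any (c ~_) (y ∷ n₂)
  snoc-last {W} {n₁} {y} {n₂} eq {c} ip with snoc-view y n₂
  ... | E , e , eqE = subst (Any (c ~_)) (sym eqE) (∈⇒Any (∈-++⁺ʳ E (here refl)) (~-sym (IP-head (IP-++ʳ E (IP-++ʳ n₁ (subst IP
      (trans (cong (_++ [ c ]) (trans eq (cong (n₁ ++_) eqE))) (trans (++-assoc n₁ (E ++ [ e ]) [ c ]) (cong (n₁ ++_) (++-assoc E [ e ] [ c ])))) ip))))))

  module _ {a b c : V} (ab : a ~ b) (ac : a ~ c) (bc : b ~ c) where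

    Δ : List V
    Δ = a ∷ b ∷ c ∷ []

    T-clique : CliqueList Δ
    T-clique (here refl) (here refl) ne = ⊥-elim (ne refl)
    T-clique (here refl) (there (here refl)) ne = ab
    T-clique (here refl) (there (there (here refl))) ne = ac
    T-clique (there (here refl)) (here refl) ne = ~-sym ab
    T-clique (there (there (here refl))) (here refl) ne = ~-sym ac
    T-clique (there i) (there j) ne = edge-clique bc i j ne

    -- The edge `b c` is not a cutset, so some path leads from `a` to `w` without it; its first step
    -- is the required neighbour.
    nbr-outside : ∀ {w} → w ∉ Δ → ¬ ¬ (Σ V λ v → (a ~ v) × (v ∉ Δ))
    nbr-outside {w} w∉ k = connected-avoiding noC (b ∷ c ∷ []) (edge-clique bc) (λ { (here e) → ~⇒≢ ab e ; (there (here e)) → ~⇒≢ ac e }) (w∉ ∘ there) go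
      where
      go : PathIn (_∉ (b ∷ c ∷ [])) a w → ⊥
      go record { tl = [] ; ini = [] ; ends = refl } = w∉ (here refl)
      go record { tl = [] ; ini = _ ∷ [] ; ends = () }
      go record { tl = [] ; ini = _ ∷ _ ∷ _ ; ends = () }
      go record { tl = v ∷ l ; ip = ip ; oks = oks } = k (v , IP-head ip , λ { (here refl) → ~-irr (IP-head ip) ; (there i) → oks (here refl) i })

    -- Keep the stretch of the path from the last neighbour of `b` to the first neighbour of `c`
    -- after it.
    hole-through : ∀ {b' c'} → b' ∉ Δ → b' ~ b → c' ~ c → PathIn (_∉ Δ) b' c' → Σ (List V) λ W → Hole b W c × (∀ {x} → x ∈ W → x ∉ Δ) × (Σ V λ x → x ∈ W)
    hole-through {b'} {c'} b'∉ b'b c'c record { tl = l ; ip = ip ; oks = oks ; ini = ini ; ends = ends } with lastSat (b ~?_) {b' ∷ l} (here (~-sym b'b))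
    ... | p , x , q , eq , bx , bq with suffix-last ini p (trans (sym ends) eq)
    ... | l' , eq' with firstSat (c ~?_) {x ∷ q} (∈⇒Any (cast∈ (sym eq') (∈-++⁺ʳ l' (here refl))) (~-sym c'c))
    -- If the stretch is a single vertex, it sees both `b` and `c` and would be `a`.
    ... | [] , .x , .q , refl , cx , _ = ⊥-elim (outW (∈-++⁺ʳ p (here refl)) (here (sym (diamondFree bc ab ac (~-sym bx) (~-sym cx)))))
      where
      outW : ∀ {z} → z ∈ (p ++ x ∷ q) → z ∉ Δ
      outW i with cast∈ (sym eq) i
      ... | here refl = b'∉
      ... | there j = oks j
    ... | .x ∷ s , z , t , refl , cz , cs = x ∷ s ++ [ z ] , mkHole (bx , mk[]## (λ i → (λ e → outW (there (st i)) (there (here (sym e)))) , bq (st i)) , ipW)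
          (subst IP (sym (++-assoc (x ∷ s) [ z ] [ c ])) (IP-glue (x ∷ s) ipW (~-sym cz , ##[] , tt)
            (##-sym (mk[]## λ i → (λ e → outW (∈-++⁺ˡ i) (there (there (here (sym e))))) , cs i)))) bc
          , (λ i → outW (case i of λ { (here e) → here e ; (there j) → there (st j) })) , x , here refl
      where
      st : ∀ {y} → y ∈ (s ++ [ z ]) → y ∈ (s ++ z ∷ t)
      st = ++-mono s id λ { (here e) → here e }
      outW : ∀ {y} → y ∈ (x ∷ s ++ z ∷ t) → y ∉ Δ
      outW i with cast∈ (sym eq) (∈-++⁺ʳ p i)
      ... | here refl = b'∉
      ... | there j = oks j
      ipW : IP (x ∷ s ++ [ z ])
      ipW = proj₁ (IP-split (x ∷ s) (IP-++ʳ p (subst IP eq ip)))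

  module _ {a b c : V} (ab : a ~ b) (ac : a ~ c) (bc : b ~ c) {W : List V} (hp : Hole b W c) (Wout : ∀ {x} → x ∈ W → x ∉ (a ∷ b ∷ c ∷ [])) where

    a##W : [ a ] ## W
    a##W = mk[]## λ i → (λ e → Wout i (here (sym e))) , λ e → no-third-neighbour hp ab ac (λ j → Wout j (here refl)) (∈⇒Any i e)

    -- a path from a towards W meets no neighbour of b: it would be seen before c
    no-b : ∀ {Z z} → IP (a ∷ Z ++ [ z ]) → (∀ {x} → x ∈ (Z ++ [ z ]) → x ∉ (a ∷ b ∷ c ∷ [])) → Z ## W → z ∉ W → Any (z ~_) W →
      ∀ q₁ {w q₂} → Z ++ [ z ] ≡ q₁ ++ w ∷ q₂ → (∀ {t} → t ∈ q₁ → ¬ (c ~ t)) → b ~ w → ⊥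
    no-b {Z} {z} ip Zo ZW z∉ an q₁ {w} {q₂} eq cq bw with lastSat (z ~?_) an
    ... | n₁ , y , n₂ , eqW , zy , zn = b-before-c q₁ {w} {q₂ ++ y ∷ n₂}
         (IP-cat (a ∷ Z) ip (IP-++ʳ n₁ (subst IP eqW (IP-++ˡ W (hpʳ hp)))) zy (##-cons (##-⊆ʳ yn a##W) (##-⊆ʳ yn ZW)) (mk[]## λ j → (λ e → z∉ (subst (_∈ W) (sym e) (yn (there j)))) , zn j))
         (trans (sym (++-assoc Z [ z ] (y ∷ n₂))) (trans (cong (_++ (y ∷ n₂)) eq) (++-assoc q₁ (w ∷ q₂) (y ∷ n₂))))
         cq (λ i → outQ i (there (there (here refl)))) (λ i → outQ i (there (here refl))) ab ac bc bw
         (anyr (w ∷ q₂) (snoc-last {W} {n₁} eqW (hpʳ hp)))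
      where
      yn : ∀ {x} → x ∈ (y ∷ n₂) → x ∈ W
      yn i = cast∈ (sym eqW) (∈-++⁺ʳ n₁ i)
      outQ : ∀ {x} → x ∈ (Z ++ z ∷ y ∷ n₂) → x ∉ (a ∷ b ∷ c ∷ [])
      outQ i with ∈-++⁻ (Z ++ [ z ]) (cast∈ (sym (++-assoc Z [ z ] (y ∷ n₂))) i)
      ... | inj₁ j = Zo j
      ... | inj₂ j = Wout (yn j)
      anyr : ∀ p {l : List V} → Any (c ~_) l → Any (c ~_) (p ++ l)
      anyr [] h = h
      anyr (_ ∷ p) h = there (anyr p h)

    -- Start at the last neighbour of `a` and stop at the first vertex in or next to `W`. That
    -- vertex is not in `W`: its predecessor would have stopped the walk, and `a` sees nothing of
    -- `W`.
    approach : ∀ {a' x} → a' ∉ (a ∷ b ∷ c ∷ []) → a ~ a' → x ∈ W → PathIn (_∉ (a ∷ b ∷ c ∷ [])) a' x →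
      Σ (List V) λ Z → Σ V λ z → IP (a ∷ Z ++ [ z ]) × (∀ {x} → x ∈ (Z ++ [ z ]) → x ∉ (a ∷ b ∷ c ∷ [])) × Z ## W × z ∉ W × Any (z ~_) W
    approach {a'} {x} a'∉ aa' xW record { tl = l ; ip = ip ; oks = oks ; ini = ini ; ends = ends } with lastSat (a ~?_) {a' ∷ l} (here aa')
    ... | p , z₁ , q , eq , az , aq with suffix-last ini p (trans (sym ends) eq)
    ... | l' , eq' with firstSat (λ v → (v ∈? W) ⊎-dec Any.any? (v ~?_) W) {z₁ ∷ q} (∈⇒Any (cast∈ (sym eq') (∈-++⁺ʳ l' (here refl))) (inj₁ xW))
    ... | s , z , t , eqs , satz , nos = s , z , ipaZ s eqs , (λ i → outq (cast∈ (sym eqs) (++-mono s id (λ { (here e) → here e }) i))) ,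
          (mk## λ i j → (λ e → nos i (inj₁ (subst (_∈ W) (sym e) j))) , λ e → nos i (inj₂ (∈⇒Any j e))) , z∉W s eqs (λ i → nos i) , (case satz of λ { (inj₁ i) → ⊥-elim (z∉W s eqs (λ i → nos i) i) ; (inj₂ h) → h })
      where
      outq : ∀ {y} → y ∈ (z₁ ∷ q) → y ∉ (a ∷ b ∷ c ∷ [])
      outq i with cast∈ (sym eq) (∈-++⁺ʳ p i)
      ... | here refl = a'∉
      ... | there j = oks j
      ipq : IP (z₁ ∷ q)
      ipq = IP-++ʳ p (subst IP eq ip)
      ipaz : IP (a ∷ z₁ ∷ q)
      ipaz = az , mk[]## (λ i → (λ e → outq (there i) (here (sym e))) , aq i) , ipq
      ipaZ : ∀ s → z₁ ∷ q ≡ s ++ z ∷ t → IP (a ∷ s ++ [ z ])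
      ipaZ s e = proj₁ (IP-split (a ∷ s) (subst (λ l → IP (a ∷ l)) e ipaz))
      z∉W : ∀ s → z₁ ∷ q ≡ s ++ z ∷ t → (∀ {y} → y ∈ s → ¬ ((y ∈ W) ⊎ Any (y ~_) W)) → z ∉ W
      z∉W [] refl _ i = proj₂ (at a##W (here refl) i) az
      z∉W (s₀ ∷ s) e h i with snoc-view s₀ s
      ... | E , e₁ , eqE = h (cast∈ (sym eqE) (∈-++⁺ʳ E (here refl))) (inj₂ (∈⇒Any i (IP-head (IP-++ʳ E {e₁ ∷ z ∷ t} (subst IP (trans e (trans (cong (_++ (z ∷ t)) eqE) (++-assoc E [ e₁ ] (z ∷ t)))) ipq)))))

    -- As `z` sees neither `b` nor `c`, `hole-attachment` leaves a consecutive pair `u`, `v` inside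
    -- `W`. It splits the hole into the rungs from `b` to `u` and from `c` to `v`, with `z u v` as
    -- the second triangle.
    net : ∀ {Z z} → IP (a ∷ Z ++ [ z ]) → (∀ {x} → x ∈ (Z ++ [ z ]) → x ∉ (a ∷ b ∷ c ∷ [])) → Z ## W → z ∉ W → Any (z ~_) W →
      (∀ {x} → x ∈ (Z ++ [ z ]) → ¬ (b ~ x)) → (∀ {x} → x ∈ (Z ++ [ z ]) → ¬ (c ~ x)) →
      Σ (List V) λ B → Σ V λ t → Σ (List V) λ C → Σ V λ u → Prism a Z z b B t c C u
    net {Z} {z} ip Zo ZW z∉ an nb nc = go (hole-attachment ip hp ab ac a##W
          (##-consʳ (mk## λ { i (here refl) → Z#b (∈-++⁺ˡ i) }) (##-++ʳ ZW (mk## λ { i (here refl) → Z#c (∈-++⁺ˡ i) })))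
          (λ { (here refl) → Zo z∈ (there (here refl)) ; (there i) → case ∈-++⁻ W i of λ { (inj₁ j) → z∉ j ; (inj₂ (here refl)) → Zo z∈ (there (there (here refl))) } })
          (there (anyl an)))
      where
      z∈ : z ∈ (Z ++ [ z ])
      z∈ = ∈-++⁺ʳ Z (here refl)
      Z#b : ∀ {x} → x ∈ (Z ++ [ z ]) → x # b
      Z#b i = (λ e → Zo i (there (here e))) , λ e → nb i (~-sym e)
      Z#c : ∀ {x} → x ∈ (Z ++ [ z ]) → x # c
      Z#c i = (λ e → Zo i (there (there (here e)))) , λ e → nc i (~-sym e)
      anyl : ∀ {l : List V} → Any (z ~_) l → Any (z ~_) (l ++ [ c ])
      anyl (here e) = here e
      anyl (there h) = there (anyl h)
      go : HoleAttachment z b W c → Σ (List V) λ B → Σ V λ t → Σ (List V) λ C → Σ V λ u → Prism a Z z b B t c C u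
      go (at-b e _) = ⊥-elim (nb z∈ (~-sym e))
      go (at-c e _) = ⊥-elim (nc z∈ (~-sym e))
      go (pair [] u v q e zu zv h) = ⊥-elim (nb z∈ (subst (_~ z) (sym (∷-injectiveˡ e)) (~-sym zu)))
      go (pair (_ ∷ p) u v q e zu zv h) with ∷-injective e
      ... | refl , e' with snoc-split W (p ++ [ u ]) (trans e' (sym (++-assoc p [ u ] (v ∷ q))))
      ... | inj₁ (_ , _ , refl) = ⊥-elim (nc z∈ (~-sym zv))
      ... | inj₂ (q' , refl , eqW) = p , u , reverse q' , v , mkPrism ip
            (proj₁ (IP-split (b ∷ p) ipbW)) (subst IP (reverse-path v q' c) (IP-rev _ (IP-++ʳ [ u ] (IP-++ʳ p ipWc))))
            (mkLadder ab zu crB) (mkLadder ac zv λ i j → crC i (unrev' j)) (mkLadder bc (IP-head (IP-++ʳ p ipWc)) λ i j → crBC i (unrev' j))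
        where
        eqW' : W ≡ p ++ u ∷ v ∷ q'
        eqW' = trans eqW (++-assoc p [ u ] (v ∷ q'))
        ipbW : IP (b ∷ p ++ u ∷ v ∷ q')
        ipbW = subst (λ l → IP (b ∷ l)) eqW' (hpˡ hp)
        ipWc : IP (p ++ u ∷ v ∷ q' ++ [ c ])
        ipWc = subst IP (trans (cong (_++ [ c ]) eqW') (++-assoc p (u ∷ v ∷ q') [ c ])) (hpʳ hp)
        unrev' : ∀ {y} → y ∈ (c ∷ reverse q' ++ [ v ]) → (y ≡ v) ⊎ (y ∈ q') ⊎ (y ≡ c)
        unrev' i = ∈-path⁻ q' (reverse⁻ (cast∈ (sym (reverse-path v q' c)) i))
        pW : ∀ {y} → y ∈ (p ++ [ u ]) → y ∈ W
        pW i = cast∈ (sym eqW') (++-mono p id (λ { (here e) → here e }) i)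
        vW : ∀ {y} → y ∈ (v ∷ q') → y ∈ W
        vW i = cast∈ (sym eqW') (∈-++⁺ʳ p (there i))
        crB : ∀ {x y} → x ∈ (a ∷ Z ++ [ z ]) → y ∈ (b ∷ p ++ [ u ]) → Cross a z b u x y
        crB (here refl) (here refl) = inj₁ (refl , refl)
        crB (here refl) (there j) = inj₂ (inj₂ (at a##W (here refl) (pW j)))
        crB (there i) (here refl) = inj₂ (inj₂ (Z#b i))
        crB (there i) (there j) with ∈-++⁻ Z i | ∈-++⁻ p j
        ... | inj₁ k | _ = inj₂ (inj₂ (at ZW k (pW j)))
        ... | inj₂ (here refl) | inj₁ k = inj₂ (inj₂ (at h (here refl) (there (∈-++⁺ˡ k))))
        ... | inj₂ (here refl) | inj₂ (here refl) = inj₂ (inj₁ (refl , refl))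
        crC : ∀ {x y} → x ∈ (a ∷ Z ++ [ z ]) → (y ≡ v) ⊎ (y ∈ q') ⊎ (y ≡ c) → Cross a z c v x y
        crC (here refl) (inj₂ (inj₂ refl)) = inj₁ (refl , refl)
        crC (there i) (inj₂ (inj₂ refl)) = inj₂ (inj₂ (Z#c i))
        crC (here refl) (inj₁ refl) = inj₂ (inj₂ (at a##W (here refl) (vW (here refl))))
        crC (here refl) (inj₂ (inj₁ j)) = inj₂ (inj₂ (at a##W (here refl) (vW (there j))))
        crC (there i) (inj₁ refl) with ∈-++⁻ Z i
        ... | inj₁ k = inj₂ (inj₂ (at ZW k (vW (here refl))))
        ... | inj₂ (here refl) = inj₂ (inj₁ (refl , refl))
        crC (there i) (inj₂ (inj₁ j)) with ∈-++⁻ Z i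
        ... | inj₁ k = inj₂ (inj₂ (at ZW k (vW (there j))))
        ... | inj₂ (here refl) = inj₂ (inj₂ (at h (here refl) (there (∈-++⁺ʳ p (∈-++⁺ˡ j)))))
        b## : (b ∷ p) ## (v ∷ q')
        b## = proj₂ (proj₂ (IP-split (b ∷ p) ipbW))
        u## : [ u ] ## (q' ++ [ c ])
        u## = IP-anti (IP-++ʳ p ipWc)
        p##c : p ## [ c ]
        p##c = ##-⊆ʳ (λ { (here refl) → there (∈-++⁺ʳ q' (here refl)) }) (proj₂ (proj₂ (IP-split p ipWc)))
        crBC : ∀ {x y} → x ∈ (b ∷ p ++ [ u ]) → (y ≡ v) ⊎ (y ∈ q') ⊎ (y ≡ c) → Cross b u c v x y
        crBC (here refl) (inj₂ (inj₂ refl)) = inj₁ (refl , refl)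
        crBC (here refl) (inj₁ refl) = inj₂ (inj₂ (at b## (here refl) (here refl)))
        crBC (here refl) (inj₂ (inj₁ j)) = inj₂ (inj₂ (at b## (here refl) (there j)))
        crBC (there i) y with ∈-++⁻ p i
        crBC (there i) (inj₁ refl) | inj₁ k = inj₂ (inj₂ (at b## (there k) (here refl)))
        crBC (there i) (inj₂ (inj₁ j)) | inj₁ k = inj₂ (inj₂ (at b## (there k) (there j)))
        crBC (there i) (inj₂ (inj₂ refl)) | inj₁ k = inj₂ (inj₂ (at p##c k (here refl)))
        crBC (there i) (inj₁ refl) | inj₂ (here refl) = inj₂ (inj₁ (refl , refl))
        crBC (there i) (inj₂ (inj₁ j)) | inj₂ (here refl) = inj₂ (inj₂ (at u## (here refl) (∈-++⁺ˡ j)))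
        crBC (there i) (inj₂ (inj₂ refl)) | inj₂ (here refl) = inj₂ (inj₂ (at u## (here refl) (∈-++⁺ʳ q' (here refl))))

  PrismOn : V → V → V → Set
  PrismOn a b c = Σ (List V) λ R → Σ V λ s → Σ (List V) λ B → Σ V λ t → Σ (List V) λ C → Σ V λ u → Prism a R s b B t c C u

  T-rot : ∀ {a b c v : V} → v ∉ (b ∷ a ∷ c ∷ []) → v ∉ (a ∷ b ∷ c ∷ [])
  T-rot h (here e) = h (there (here e))
  T-rot h (there (here e)) = h (here e)
  T-rot h (there (there i)) = h (there (there i))

  T-rot' : ∀ {a b c v : V} → v ∉ (c ∷ a ∷ b ∷ []) → v ∉ (a ∷ b ∷ c ∷ [])
  T-rot' h (here e) = h (there (here e))
  T-rot' h (there (here e)) = h (there (there (here e)))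
  T-rot' h (there (there (here e))) = h (here e)

  T-rot'' : ∀ {a b c v : V} → v ∉ (a ∷ b ∷ c ∷ []) → v ∉ (c ∷ a ∷ b ∷ [])
  T-rot'' h (here e) = h (there (there (here e)))
  T-rot'' h (there (here e)) = h (here e)
  T-rot'' h (there (there (here e))) = h (there (here e))

  T-swap : ∀ {a b c v : V} → v ∉ (a ∷ b ∷ c ∷ []) → v ∉ (a ∷ c ∷ b ∷ [])
  T-swap h (here e) = h (here e)
  T-swap h (there (here e)) = h (there (there (here e)))
  T-swap h (there (there (here e))) = h (there (here e))

  -- Each corner has a neighbour outside the triangle. A path between those of `b` and `c` makes a
  -- hole through the edge `b c`, and a second path joins `a` to it. If the second path meets a
  -- neighbour of `b` or `c` there is a wheel; otherwise `net` applies.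
  prism-exists : ∀ {a b c w} → a ~ b → a ~ c → b ~ c → w ∉ (a ∷ b ∷ c ∷ []) → ¬ ¬ PrismOn a b c
  prism-exists {a} {b} {c} {w} ab ac bc w∉ k =
    nbr-outside ab ac bc w∉ λ (a' , aa' , a'∉) →
    nbr-outside (~-sym ab) bc ac (T-rot w∉) λ (b' , bb' , b'∉) →
    nbr-outside (~-sym ac) (~-sym bc) ab (T-rot'' w∉) λ (c' , cc' , c'∉) →
    connected-avoiding noC (a ∷ b ∷ c ∷ []) (T-clique ab ac bc) (T-rot b'∉) (T-rot' c'∉) λ pth →
    let W , hp , Wo , x , xW = hole-through ab ac bc (T-rot b'∉) (~-sym bb') (~-sym cc') pth in
    connected-avoiding noC (a ∷ b ∷ c ∷ []) (T-clique ab ac bc) a'∉ (Wo xW) λ pth' →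
    let Z , z , ip , Zo , ZW , z∉ , an = approach ab ac bc hp Wo a'∉ aa' xW pth' in
    finish W hp Wo Z z ip Zo ZW z∉ an
    where
    anyrev : ∀ {z} {W : List V} → Any (z ~_) W → Any (z ~_) (reverse W)
    anyrev h = let _ , i , e = Any⇒∈ h in ∈⇒Any (reverse⁺ i) e
    finish : ∀ W → Hole b W c → (∀ {x} → x ∈ W → x ∉ (a ∷ b ∷ c ∷ [])) → ∀ Z z → IP (a ∷ Z ++ [ z ]) → (∀ {x} → x ∈ (Z ++ [ z ]) → x ∉ (a ∷ b ∷ c ∷ [])) → Z ## W → z ∉ W → Any (z ~_) W → ⊥
    finish W hp Wo Z z ip Zo ZW z∉ an with Any.any? (λ x → (b ~? x) ⊎-dec (c ~? x)) (Z ++ [ z ])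
    ... | no ¬any = let B , t , C , u , P = net ab ac bc hp Wo ip Zo ZW z∉ an (λ i e → ¬any (∈⇒Any i (inj₁ e))) (λ i e → ¬any (∈⇒Any i (inj₂ e))) in k (Z , z , B , t , C , u , P)
    ... | yes any with firstSat (λ x → (b ~? x) ⊎-dec (c ~? x)) any
    ... | q₁ , y , q₂ , eq , inj₁ by , h = no-b ab ac bc hp Wo ip Zo ZW z∉ an q₁ eq (λ i e → h i (inj₂ e)) by
    ... | q₁ , y , q₂ , eq , inj₂ cy , h = no-b ac ab (~-sym bc) (Hole-rev hp) (λ i → T-swap (Wo (rev⊆ W i))) ip (λ i → T-swap (Zo i)) (##-revʳ W ZW) (λ i → z∉ (rev⊆ W i)) (anyrev an) q₁ eq (λ i e → h i (inj₁ e)) cy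

-- Deciding cutsets

¬¬-all : ∀ {k} {P : Fin k → Set} → (∀ i → ¬ ¬ P i) → ¬ ¬ (∀ i → P i)
¬¬-all {zero} h n = n λ ()
¬¬-all {suc k} {P} h n = h zero λ p → ¬¬-all {k} {P ∘ suc} (λ i → h (suc i)) λ q → n λ { zero → p ; (suc i) → q i }

-- Inside a refutation, finitely many propositions may be taken as decided all at once; in this way
-- reachability becomes a subset.
¬¬-decide : ∀ {k} (P : Fin k → Set) → ¬ ¬ (∀ i → Dec (P i))
¬¬-decide P = ¬¬-all λ i n → n (no λ p → n (yes p))

module Positions {A : Set} (_≟ᴬ_ : (x y : A) → Dec (x ≡ y)) where

  pos : A → List A → ℕ
  pos x [] = 0
  pos x (y ∷ l) = if does (x ≟ᴬ y) then 0 else suc (pos x l)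

  pos-inj : ∀ {x y l} → x ∈ l → y ∈ l → pos x l ≡ pos y l → x ≡ y
  pos-inj {x} {y} {z ∷ l} i j e with x ≟ᴬ z | y ≟ᴬ z
  ... | yes refl | yes refl = refl
  pos-inj {x} {y} {z ∷ l} (here e') j e | no ne | no _ = ⊥-elim (ne e')
  pos-inj {x} {y} {z ∷ l} (there i) (here e') e | no _ | no ne = ⊥-elim (ne e')
  pos-inj {x} {y} {z ∷ l} (there i) (there j) e | no _ | no _ = pos-inj i j (suc-injective e)

  pos-mid : ∀ p {x q} → Unique (p ++ x ∷ q) → pos x (p ++ x ∷ q) ≡ length p
  pos-mid [] {x} u with x ≟ᴬ x
  ... | yes _ = refl
  ... | no ne = ⊥-elim (ne refl)
  pos-mid (y ∷ p) {x} (a ∷ u) with x ≟ᴬ y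
  ... | yes refl = ⊥-elim (All.lookup a (∈-++⁺ʳ p (here refl)) refl)
  ... | no _ = cong suc (pos-mid p u)

  Next : ℕ → ℕ → Set
  Next i j = (j ≡ suc i) ⊎ (i ≡ suc j)

  -- Turns adjacency on an induced path into integers that differ by one, for which triangles and
  -- third neighbours are absurd.
  consec-pos : ∀ {l u v} → Unique l → ConsecIn l u v → Next (pos u l) (pos v l)
  consec-pos {l} {u} {v} uq (p , q , inj₁ refl) = inj₁ (trans (later p uq) (cong suc (sym (pos-mid p uq))))
    where
    later : ∀ p → Unique (p ++ u ∷ v ∷ q) → pos v (p ++ u ∷ v ∷ q) ≡ suc (length p)
    later p uq = trans (cong (pos v) (sym (++-assoc p [ u ] (v ∷ q)))) (trans (pos-mid (p ++ [ u ]) (subst Unique (sym (++-assoc p [ u ] (v ∷ q))) uq)) (trans (length-++ p) (+-comm (length p) 1)))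
  consec-pos {l} {u} {v} uq (p , q , inj₂ refl) = inj₂ (trans (later p uq) (cong suc (sym (pos-mid p uq))))
    where
    later : ∀ p → Unique (p ++ v ∷ u ∷ q) → pos u (p ++ v ∷ u ∷ q) ≡ suc (length p)
    later p uq = trans (cong (pos u) (sym (++-assoc p [ v ] (u ∷ q)))) (trans (pos-mid (p ++ [ v ]) (subst Unique (sym (++-assoc p [ v ] (u ∷ q))) uq)) (trans (length-++ p) (+-comm (length p) 1)))

  no-triangle : ∀ {i j k} → Next i j → Next i k → Next j k → ⊥
  no-triangle (inj₁ refl) (inj₁ refl) (inj₁ ())
  no-triangle (inj₁ refl) (inj₁ refl) (inj₂ ())
  no-triangle (inj₁ refl) (inj₂ refl) (inj₁ ())
  no-triangle (inj₁ refl) (inj₂ refl) (inj₂ ())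
  no-triangle (inj₂ refl) (inj₁ refl) (inj₁ ())
  no-triangle (inj₂ refl) (inj₁ refl) (inj₂ ())
  no-triangle (inj₂ refl) (inj₂ refl) (inj₁ ())
  no-triangle (inj₂ refl) (inj₂ refl) (inj₂ ())

  two-next : ∀ {i j k m} → Next i j → Next i k → Next i m → (j ≡ k) ⊎ (j ≡ m) ⊎ (k ≡ m)
  two-next (inj₁ refl) (inj₁ refl) _ = inj₁ refl
  two-next (inj₁ refl) (inj₂ refl) (inj₁ refl) = inj₂ (inj₁ refl)
  two-next (inj₁ refl) (inj₂ refl) (inj₂ refl) = inj₂ (inj₂ refl)
  two-next (inj₂ refl) (inj₁ refl) (inj₁ refl) = inj₂ (inj₂ refl)
  two-next (inj₂ refl) (inj₁ refl) (inj₂ refl) = inj₂ (inj₁ refl)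
  two-next (inj₂ refl) (inj₂ refl) _ = inj₁ refl

module TwoCuts (G : Graph) where
  open Basics G
  open Paths G using (does-true; does-false)
  open Positions {V} _≟_

  -- A proper 2-cutset certified by a triangle on one side and a branching on the other, which makes it decidable.
  module _ (a b : V) (S : Subset (n G)) where

    inX inY : V → Set
    inX v = (v ≢ a) × (v ≢ b) × (lookup S v ≡ true)
    inY v = (v ≢ a) × (v ≢ b) × (lookup S v ≡ false)

    -- An induced path from `a` to `b` has no triangle, no vertex with three neighbours and only one
    -- neighbour of its end `a`. The corners in `TriangleY` may be `a` or `b` themselves.
    TriangleY BranchX : Set
    TriangleY = Σ V λ x → Σ V λ y → Σ V λ z → (x ~ y) × (x ~ z) × (y ~ z) × (¬ inX x) × (¬ inX y) × (¬ inX z)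
    BranchX = (Σ V λ x → Σ V λ p → Σ V λ q → Σ V λ r → inX x × (x ~ p) × (x ~ q) × (x ~ r) × (p ≢ q) × (p ≢ r) × (q ≢ r))
      ⊎ (Σ V λ p → Σ V λ q → inX p × inX q × (p ≢ q) × (a ~ p) × (a ~ q))

    Certified : Set
    Certified = (a ≢ b) × (¬ (a ~ b)) × (∀ u v → inX u → inY v → ¬ (u ~ v)) × TriangleY × BranchX

    inX? : ∀ v → Dec (inX v)
    inX? v = ¬? (v ≟ a) ×-dec ¬? (v ≟ b) ×-dec (lookup S v Bool.≟ true)

    inY? : ∀ v → Dec (inY v)
    inY? v = ¬? (v ≟ a) ×-dec ¬? (v ≟ b) ×-dec (lookup S v Bool.≟ false)

    certified? : Dec Certified
    certified? = ¬? (a ≟ b) ×-dec ¬? (a ~? b) ×-dec (all? λ u → all? λ v → inX? u →-dec (inY? v →-dec ¬? (u ~? v)))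
      ×-dec (any? λ x → any? λ y → any? λ z → (x ~? y) ×-dec (x ~? z) ×-dec (y ~? z) ×-dec ¬? (inX? x) ×-dec ¬? (inX? y) ×-dec ¬? (inX? z))
      ×-dec ((any? λ x → any? λ p → any? λ q → any? λ r → inX? x ×-dec (x ~? p) ×-dec (x ~? q) ×-dec (x ~? r) ×-dec ¬? (p ≟ q) ×-dec ¬? (p ≟ r) ×-dec ¬? (q ≟ r))
        ⊎-dec (any? λ p → any? λ q → inX? p ×-dec inX? q ×-dec ¬? (p ≟ q) ×-dec (a ~? p) ×-dec (a ~? q)))

  HasCertified2Cut : Set
  HasCertified2Cut = Σ V λ a → Σ V λ b → Σ (Subset (n G)) λ S → Certified a b S

  certified2Cut? : Dec HasCertified2Cut
  certified2Cut? = any? λ a → any? λ b → anySubset? λ S → certified? a b S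

  module _ {a b : V} {S : Subset (n G)} where

    X∌⇒Y : ∀ {v} → ¬ inX a b S v → (v ≡ a) ⊎ (v ≡ b) ⊎ inY a b S v
    X∌⇒Y {v} h with v ≟ a | v ≟ b | lookup S v
    ... | yes p | _ | _ = inj₁ p
    ... | no _ | yes p | _ = inj₂ (inj₁ p)
    ... | no p | no q | true = ⊥-elim (h (p , q , refl))
    ... | no p | no q | false = inj₂ (inj₂ (p , q , refl))

    Y∌⇒X : ∀ {v} → ¬ inY a b S v → (v ≡ a) ⊎ (v ≡ b) ⊎ inX a b S v
    Y∌⇒X {v} h with v ≟ a | v ≟ b | lookup S v
    ... | yes p | _ | _ = inj₁ p
    ... | no _ | yes p | _ = inj₂ (inj₁ p)
    ... | no p | no q | true = inj₂ (inj₂ (p , q , refl))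
    ... | no p | no q | false = ⊥-elim (h (p , q , refl))

    certified⇒proper : Certified a b S → IsProper2Cutset G a b
    certified⇒proper (a≢b , a≁b , sep , (t₁ , t₂ , t₃ , e₁₂ , e₁₃ , e₂₃ , o₁ , o₂ , o₃) , br) =
        a≢b , ≁ a≁b , lookup S , neX br , neY , sep , notX br , notY
      where
      ≁ : ∀ {x y} → ¬ (x ~ y) → adj G x y ≡ false
      ≁ {x} {y} h with adj G x y
      ... | true = ⊥-elim (h refl)
      ... | false = refl
      neX : BranchX a b S → Σ V (inX a b S)
      neX (inj₁ (x , _ , _ , _ , h , _)) = x , h
      neX (inj₂ (p , _ , h , _)) = p , h
      neY : Σ V (inY a b S)
      neY with X∌⇒Y o₁ | X∌⇒Y o₂
      ... | inj₂ (inj₂ h) | _ = t₁ , h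
      ... | _ | inj₂ (inj₂ h) = t₂ , h
      ... | inj₁ refl | inj₁ refl = ⊥-elim (~-irr e₁₂)
      ... | inj₁ refl | inj₂ (inj₁ refl) = ⊥-elim (a≁b e₁₂)
      ... | inj₂ (inj₁ refl) | inj₁ refl = ⊥-elim (a≁b (~-sym e₁₂))
      ... | inj₂ (inj₁ refl) | inj₂ (inj₁ refl) = ⊥-elim (~-irr e₁₂)
      notY : ¬ InducedPathOn G a b (λ v → (v ≡ a) ⊎ (v ≡ b) ⊎ inY a b S v)
      notY (l , (_ , uq , _) , mem , ind) = no-triangle (nx (X∌⇒Y o₁) (X∌⇒Y o₂) e₁₂) (nx (X∌⇒Y o₁) (X∌⇒Y o₃) e₁₃) (nx (X∌⇒Y o₂) (X∌⇒Y o₃) e₂₃)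
        where
        nx : ∀ {u v} → (u ≡ a) ⊎ (u ≡ b) ⊎ inY a b S u → (v ≡ a) ⊎ (v ≡ b) ⊎ inY a b S v → u ~ v → Next (pos u l) (pos v l)
        nx {u} {v} i j e = consec-pos uq (ind u v (Equivalence.to (mem u) i) (Equivalence.to (mem v) j) e)
      notX : BranchX a b S → ¬ InducedPathOn G a b (λ v → (v ≡ a) ⊎ (v ≡ b) ⊎ inX a b S v)
      notX (inj₁ (x , p , q , r , xX , xp , xq , xr , p≢q , p≢r , q≢r)) (l , (_ , uq , _) , mem , ind)
        = case two-next (nx p xp) (nx q xq) (nx r xr) of λ
          { (inj₁ e) → p≢q (pos-inj (nb p xp) (nb q xq) e)
          ; (inj₂ (inj₁ e)) → p≢r (pos-inj (nb p xp) (nb r xr) e)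
          ; (inj₂ (inj₂ e)) → q≢r (pos-inj (nb q xq) (nb r xr) e) }
        where
        nb : ∀ v → x ~ v → v ∈ l
        nb v e = Equivalence.to (mem v) (Y∌⇒X λ y → sep x v xX y e)
        nx : ∀ v → x ~ v → Next (pos x l) (pos v l)
        nx v e = consec-pos uq (ind x v (Equivalence.to (mem x) (inj₂ (inj₂ xX))) (nb v e) e)
      notX (inj₂ (p , q , pX , qX , p≢q , ap , aq)) (l , ((inner , refl) , uq , _) , mem , ind) =
          p≢q (pos-inj (Equivalence.to (mem p) (inj₂ (inj₂ pX))) (Equivalence.to (mem q) (inj₂ (inj₂ qX))) (trans (one (nx p pX ap)) (sym (one (nx q qX aq)))))
        where
        nx : ∀ v → inX a b S v → a ~ v → Next 0 (pos v l)
        nx v h e = subst (λ i → Next i (pos v l)) (pos-mid [] uq) (consec-pos uq (ind a v (here refl) (Equivalence.to (mem v) (inj₂ (inj₂ h))) e))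
        one : ∀ {j} → Next 0 j → j ≡ 1
        one (inj₁ e) = e
        one (inj₂ ())

  SubsetOf : ∀ {P : V → Set} → (∀ v → Dec (P v)) → Subset (n G)
  SubsetOf d = Vec.tabulate λ v → does (d v)

  SubsetOf-true : ∀ {P : V → Set} (d : ∀ v → Dec (P v)) {v} → lookup (SubsetOf d) v ≡ true → P v
  SubsetOf-true d {v} e = does-true (d v) (trans (sym (lookup∘tabulate (λ v → does (d v)) v)) e)

  SubsetOf-false : ∀ {P : V → Set} (d : ∀ v → Dec (P v)) {v} → lookup (SubsetOf d) v ≡ false → ¬ P v
  SubsetOf-false d {v} e = does-false (d v) (trans (sym (lookup∘tabulate (λ v → does (d v)) v)) e)

  SubsetOf⁺ : ∀ {P : V → Set} (d : ∀ v → Dec (P v)) {v} → P v → lookup (SubsetOf d) v ≡ true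
  SubsetOf⁺ d {v} p = trans (lookup∘tabulate (λ v → does (d v)) v) (dec-true (d v) p)

  -- The set `X`, closed under adjacency outside `K`, stands in for the negated reachability, so
  -- that a finite search over two subsets decides the matter.
  Certified1Cut : Subset (n G) → Subset (n G) → Set
  Certified1Cut K X = (∀ x y → lookup K x ≡ true → lookup K y ≡ true → x ≢ y → x ~ y)
    × (Σ V λ u → (lookup K u ≡ false) × (lookup X u ≡ true)) × (Σ V λ v → (lookup K v ≡ false) × (lookup X v ≡ false))
    × (∀ u v → lookup X u ≡ true → lookup K v ≡ false → u ~ v → lookup X v ≡ true)

  cliqueCutset? : Dec (HasCliqueCutset G)
  cliqueCutset? with anySubset? (λ K → anySubset? λ X → cert? K X)
    where
    _=?_ : ∀ (x y : Bool) → Dec (x ≡ y)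
    _=?_ = Bool._≟_
    cert? : ∀ K X → Dec (Certified1Cut K X)
    cert? K X = (all? λ x → all? λ y → (lookup K x =? true) →-dec ((lookup K y =? true) →-dec (¬? (x ≟ y) →-dec (x ~? y))))
      ×-dec (any? λ u → (lookup K u =? false) ×-dec (lookup X u =? true)) ×-dec (any? λ v → (lookup K v =? false) ×-dec (lookup X v =? false))
      ×-dec (all? λ u → all? λ v → (lookup X u =? true) →-dec ((lookup K v =? false) →-dec ((u ~? v) →-dec (lookup X v =? true))))
  ... | yes (K , X , cl , (u , Ku , Xu) , (v , Kv , Xv) , closed) = yes (lookup K , cl , u , v , Ku , Kv , λ r → case trans (sym (stay Xu r)) Xv of λ ())
    where
    stay : ∀ {u v} → lookup X u ≡ true → Reach G (λ w → lookup K w ≡ false) u v → lookup X v ≡ true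
    stay Xu here = Xu
    stay Xu (step e o r) = stay (closed _ _ Xu o e) r
  -- For `X` take the component of `u`. Membership in it is undecided, but the goal is a
  -- contradiction.
  ... | no ¬c = no λ (K , cl , u , v , Ku , Kv , ¬r) → ¬¬-decide (λ w → Reach G (λ w → K w ≡ false) u w) λ d →
      let tk = lookup∘tabulate K in
      ¬c (Vec.tabulate K , SubsetOf d , (λ x y ex ey → cl x y (trans (sym (tk x)) ex) (trans (sym (tk y)) ey)) ,
        (u , trans (tk u) Ku , SubsetOf⁺ d here) , (v , trans (tk v) Kv , trans (lookup∘tabulate (λ w → does (d w)) v) (dec-false (d v) ¬r)) ,
        λ x y Xx Ky e → SubsetOf⁺ d (snoc (SubsetOf-true d Xx) e (trans (sym (tk y)) Ky)))
    where
    snoc : ∀ {ok u v w} → Reach G ok u v → v ~ w → ok w → Reach G ok u w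
    snoc here e o = step e o here
    snoc (step e' o' r) e o = step e' o' (snoc r e o)

-- Corners of triangles

module Reachability (G : Graph) where
  open Basics G
  open Paths G

  reach-snoc : ∀ {ok u v w} → Reach G ok u v → v ~ w → ok w → Reach G ok u w
  reach-snoc here e o = step e o here
  reach-snoc (step e' o' r) e o = step e' o' (reach-snoc r e o)

  reach-trans : ∀ {ok u v w} → Reach G ok u v → Reach G ok v w → Reach G ok u w
  reach-trans here r = r
  reach-trans (step e o r) r' = step e o (reach-trans r r')

  reach-sym : ∀ {ok u v} → ok u → Reach G ok u v → Reach G ok v u
  reach-sym o here = here
  reach-sym o (step e o' r) = reach-snoc (reach-sym o' r) (~-sym e) o

  reach-end : ∀ {ok u v} → ok u → Reach G ok u v → ok v
  reach-end o here = o
  reach-end o (step _ o' r) = reach-end o' r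

  IP-reach : ∀ {ok x} l → IP (x ∷ l) → (∀ {y} → y ∈ l → ok y) → ∀ {v} → v ∈ (x ∷ l) → Reach G ok x v
  IP-reach l ip o (here refl) = here
  IP-reach (y ∷ l) ip o (there i) = step (IP-head ip) (o (here refl)) (IP-reach l (IP-tail ip) (o ∘ there) i)

module Corners (G : Graph) (noI : ¬ HasISK4 G) (noW : ¬ HasWheel G) (noC : ¬ HasCliqueCutset G) (no2 : ¬ TwoCuts.HasCertified2Cut G) where
  open Basics G
  open Paths G
  open Reachability G
  open Diamonds G noW noC
  open Prisms G
  open ConnectorEnds G noI noW diamondFree
  open Rerouting G noI noW diamondFree
  open Attachments G noI noW diamondFree
  open PrismExists G noI noW noC
  open TwoCuts G

  module _ {a R s b B t c C u} (P : Prism a R s b B t c C u) (IH : Shorter a R) where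

    outK : V → Set
    outK x = ¬ InR P x × ¬ InY P x

    InK? : ∀ x → Dec (InR P x ⊎ InY P x)
    InK? x = (x ∈? _) ⊎-dec ((x ∈? _) ⊎-dec (x ∈? _))

    -- `local` speaks of induced paths; two attachments of one component are joined by such a path
    -- inside it.
    local-reach : ∀ {w w' r y} → outK w → Reach G outK w w' → w ~ r → w' ~ y → InR P r → InY P y → Loc P r y
    local-reach {w} {w'} o rc wr w'y ri yi with reach⇒path rc
    ... | record { tl = l ; ip = ip ; oks = oks ; ini = ini ; ends = ends } =
      local P IH (length (w ∷ l)) (w ∷ l) ≤-refl ip (λ { (here refl) → o ; (there i) → oks i }) (here refl) (cast∈ (sym ends) (∈-++⁺ʳ ini (here refl))) ri yi wr w'y

    first-in-K : ∀ {z v} → outK z → (InR P v ⊎ InY P v) → ∀ {ok} → PathIn ok z v →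
      Σ V λ w → Σ V λ k → Reach G outK z w × (w ~ k) × ok k × (InR P k ⊎ InY P k)
    first-in-K {z} {v} o vK record { tl = l ; ip = ip ; oks = oks ; ini = ini ; ends = ends } with firstSat InK? {z ∷ l} (∈⇒Any (cast∈ (sym ends) (∈-++⁺ʳ ini (here refl))) vK)
    ... | [] , .z , q , refl , kK , h = ⊥-elim (case kK of λ { (inj₁ i) → proj₁ o i ; (inj₂ i) → proj₂ o i })
    ... | .z ∷ p , k , q , refl , kK , h with snoc-view z p
    ... | E , w , eqE = w , k , IP-reach p (IP-++ˡ (z ∷ p) ip) (λ i → (λ j → h (there i) (inj₁ j)) , λ j → h (there i) (inj₂ j)) (cast∈ (sym eqE) (∈-++⁺ʳ E (here refl))) ,
         IP-head (IP-++ʳ E {w ∷ k ∷ q} (subst IP (trans (cong (_++ (k ∷ q)) eqE) (++-assoc E [ w ] (k ∷ q))) ip)) , oks (∈-++⁺ʳ p (here refl)) , kK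

    s∉T : s ∉ (a ∷ b ∷ c ∷ [])
    s∉T (here e) = path-≢ (ipR P) (sym e)
    s∉T (there (here e)) = ladder-≢ (RB P) (last∈ R) (here refl) e
    s∉T (there (there (here e))) = ladder-≢ (RC P) (last∈ R) (here refl) e

    aR≢s : ∀ {x} → x ∈ (a ∷ R) → x ≢ s
    aR≢s i = unique-≢ (a ∷ R) (IP-uniq (ipR P)) i (here refl)

    -- otherwise the component of z would see only the triangle abc, a clique cutset
    no-Y : ∀ {x z w y} → x ∈ (a ∷ R) → x ~ z → outK z → Reach G outK z w → InY P y → w ~ y → ⊥
    no-Y {x} {z} {w} {y} xi xz o rc yi wy with local-reach o rc (~-sym xz) wy (∈-++⁺ˡ xi) yi
    ... | inj₂ (e , _) = aR≢s xi e
    ... | inj₁ (refl , y∈) = connected-avoiding noC (a ∷ b ∷ c ∷ []) (T-clique (Ladder.ab (RB P)) (Ladder.ab (RC P)) (Ladder.ab (BC P))) z∉T s∉T λ pth →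
          case first-in-K o (inj₁ (last∈ R)) pth of λ
          { (w' , k , rc' , w'k , k∉T , inj₁ kR) → case local-reach (reach-end o rc') (reach-trans (reach-sym o rc') rc) w'k wy kR yi of λ
              { (inj₁ (e , _)) → k∉T (here e) ; (inj₂ (_ , e)) → clash y∈ e }
          ; (w' , k , rc' , w'k , k∉T , inj₂ kY) → case local-reach o rc' (~-sym xz) w'k (here refl) kY of λ
              { (inj₁ (_ , inj₁ e)) → k∉T (there (here e)) ; (inj₁ (_ , inj₂ e)) → k∉T (there (there (here e))) ; (inj₂ (e , _)) → path-≢ (ipR P) e } }
      where
      z∉T : z ∉ (a ∷ b ∷ c ∷ [])
      z∉T (here refl) = proj₁ o (here refl)
      z∉T (there (here refl)) = proj₂ o (inj₁ (here refl))
      z∉T (there (there (here refl))) = proj₂ o (inj₂ (here refl))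
      clash : (y ≡ b) ⊎ (y ≡ c) → (y ≡ t) ⊎ (y ≡ u) → ⊥
      clash (inj₁ e) (inj₁ e') = path-≢ (ipB P) (trans (sym e) e')
      clash (inj₁ e) (inj₂ e') = ladder-≢ (BC P) (here refl) (last∈ C) (trans (sym e) e')
      clash (inj₂ e) (inj₁ e') = ladder-≢ (BC P) (last∈ B) (here refl) (trans (sym e') e)
      clash (inj₂ e) (inj₂ e') = path-≢ (ipC P) (trans (sym e) e')

    away : V → Set
    away w = (w ≢ a) × (w ≢ s)

    b-away : away b
    b-away = (λ e → ~⇒≢ (Ladder.ab (RB P)) (sym e)) , λ e → ladder-≢ (RB P) (last∈ R) (here refl) (sym e)

    R##Y' : ∀ {x y} → x ∈ R → InY P y → x # y
    R##Y' i (inj₁ j) with Ladder.cr (RB P) (mid∈ i) j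
    ... | inj₁ (e , _) = ⊥-elim (path-a∉ (ipR P) (subst (_∈ R) e i))
    ... | inj₂ (inj₁ (e , _)) = ⊥-elim (path-s∉ (ipR P) (subst (_∈ R) e i))
    ... | inj₂ (inj₂ h) = h
    R##Y' i (inj₂ j) with Ladder.cr (RC P) (mid∈ i) j
    ... | inj₁ (e , _) = ⊥-elim (path-a∉ (ipR P) (subst (_∈ R) e i))
    ... | inj₂ (inj₁ (e , _)) = ⊥-elim (path-s∉ (ipR P) (subst (_∈ R) e i))
    ... | inj₂ (inj₂ h) = h

    -- Between its last vertex in R or equal to `z` and the next vertex on the other rungs, the path
    -- runs outside the prism. If that piece starts in R it violates locality, which asks for an end
    -- of the rung; if it starts at `z` it contradicts `no-Y`.
    separated : ∀ {x z} → x ∈ (a ∷ R) → x ~ z → outK z → ∀ {v} → (v ∈ R) ⊎ (v ≡ z) → PathIn away v b → ⊥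
    separated {x} {z} xi xz o {v} vi record { tl = l ; ip = ip ; oks = oks ; ini = ini ; ends = ends } with lastSat (λ w → (w ∈? R) ⊎-dec (w ≟ z)) {v ∷ l} (here vi)
    ... | p , v₁ , q , eq , v₁i , h with suffix-last ini p (trans (sym ends) eq)
    ... | l' , eq' with firstSat (λ w → (w ∈? _) ⊎-dec (w ∈? _)) {v₁ ∷ q} (∈⇒Any (cast∈ (sym eq') (∈-++⁺ʳ l' (here refl))) (bY))
      where
      bY : InY P b
      bY = inj₁ (here refl)
    ... | [] , .v₁ , .q , refl , yY , _ = case v₁i of λ { (inj₁ i) → proj₁ (R##Y' i yY) refl ; (inj₂ refl) → proj₂ o yY }
    ... | .v₁ ∷ p₁ , y , q₁ , refl , yY , h' = fin v₁i
      where
      ipv : IP (v₁ ∷ p₁ ++ y ∷ q₁)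
      ipv = IP-++ʳ p (subst IP eq ip)
      tail⊆ : ∀ p {x r} → v ∷ l ≡ p ++ x ∷ r → ∀ {w} → w ∈ r → w ∈ l
      tail⊆ [] refl i = i
      tail⊆ (_ ∷ p) refl i = ∈-++⁺ʳ p (there i)
      p₁out : ∀ {w} → w ∈ p₁ → outK w
      p₁out {w} i = (λ j → case ∈-path⁻ R j of λ
          { (inj₁ e) → proj₁ (oks (tail⊆ p eq (∈-++⁺ˡ i))) e ; (inj₂ (inj₁ k)) → h (∈-++⁺ˡ i) (inj₁ k) ; (inj₂ (inj₂ e)) → proj₂ (oks (tail⊆ p eq (∈-++⁺ˡ i))) e })
        , λ j → h' (there i) j
      before : ∀ x m → IP (x ∷ m ++ y ∷ q₁) → (∀ {w} → w ∈ m → outK w) → Σ V λ w → Reach G outK x w × (w ~ y)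
      before x m ipm om with snoc-view x m
      ... | E , w , eqE = w , IP-reach m (IP-++ˡ (x ∷ m) ipm) om (cast∈ (sym eqE) (∈-++⁺ʳ E (here refl))) ,
          IP-head (IP-++ʳ E {w ∷ y ∷ q₁} (subst IP (trans (cong (_++ (y ∷ q₁)) eqE) (++-assoc E [ w ] (y ∷ q₁))) ipm))
      fromR : ∀ p₁ → IP (v₁ ∷ p₁ ++ y ∷ q₁) → (∀ {w} → w ∈ p₁ → outK w) → v₁ ∈ R → ⊥
      fromR [] ipv _ i = proj₂ (R##Y' i yY) (IP-head ipv)
      fromR (w₁ ∷ p₂) ipv om i with before w₁ p₂ (IP-tail ipv) (om ∘ there)
      ... | w , rc , wy with local-reach (om (here refl)) rc (~-sym (IP-head ipv)) wy (mid∈ i) yY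
      ... | inj₁ (e , _) = path-a∉ (ipR P) (subst (_∈ R) e i)
      ... | inj₂ (e , _) = path-s∉ (ipR P) (subst (_∈ R) e i)
      fin : (v₁ ∈ R) ⊎ (v₁ ≡ z) → ⊥
      fin (inj₁ i) = fromR p₁ ipv p₁out i
      fin (inj₂ refl) with before v₁ p₁ ipv p₁out
      ... | w , rc , wy = no-Y xi xz o rc yY wy

    -- If `a` and `s` are adjacent, they form a clique cutset between `z` and `b`. If not, they are
    -- a certified 2-cutset: X consists of the vertices that cannot reach `b` without them, and
    -- `a b c` is the triangle on the other side.
    no-exit : ∀ {x z} → x ∈ (a ∷ R) → x ~ z → outK z → ⊥
    no-exit {x} {z} xi xz o with a ~? s
    ... | yes as = connected-avoiding noC (a ∷ s ∷ []) (edge-clique as) z∉ (λ { (here e) → proj₁ b-away e ; (there (here e)) → proj₂ b-away e })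
          λ pth → separated xi xz o (inj₂ refl) (record { PathIn pth ; oks = λ i → (λ e → PathIn.oks pth i (here e)) , λ e → PathIn.oks pth i (there (here e)) })
      where
      z∉ : z ∉ (a ∷ s ∷ [])
      z∉ (here refl) = proj₁ o (here refl)
      z∉ (there (here refl)) = proj₁ o (last∈ R)
    ... | no a≁s = ¬¬-decide (λ v → ¬ Reach G away v b) λ d → no2 (a , s , SubsetOf d , path-≢ (ipR P) , a≁s , sep d , tri' d , branch d)
      where
      inX⁺ : ∀ d {v} → away v → ¬ Reach G away v b → inX a s (SubsetOf d) v
      inX⁺ d (p , q) h = p , q , SubsetOf⁺ d h
      sep : ∀ d u v → inX a s (SubsetOf d) u → inY a s (SubsetOf d) v → ¬ (u ~ v)
      sep d u v (p , q , Xu) (p' , q' , Yv) e = SubsetOf-false d Yv λ r → SubsetOf-true d Xu (step e (p' , q') r)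
      tri' : ∀ d → TriangleY a s (SubsetOf d)
      tri' d = a , b , c , Ladder.ab (RB P) , Ladder.ab (RC P) , Ladder.ab (BC P) , (λ (h , _) → h refl) , (λ (_ , _ , h) → SubsetOf-true d h here) ,
        λ (_ , _ , h) → SubsetOf-true d h (step (~-sym (Ladder.ab (BC P))) b-away here)
      z-away : away z
      z-away = (λ { refl → proj₁ o (here refl) }) , λ { refl → proj₁ o (last∈ R) }
      zX : ∀ d → inX a s (SubsetOf d) z
      zX d = inX⁺ d z-away λ r → separated xi xz o (inj₂ refl) (reach⇒path r)
      RX : ∀ d {v} → v ∈ R → inX a s (SubsetOf d) v
      RX d i = inX⁺ d ((λ { refl → path-a∉ (ipR P) i }) , λ { refl → path-s∉ (ipR P) i }) λ r → separated xi xz o (inj₁ i) (reach⇒path r)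
      first : ∀ R' → R ≡ R' → Σ V λ r → (r ∈ R) × (a ~ r)
      first [] refl = ⊥-elim (a≁s (IP-head (ipR P)))
      first (r ∷ R') refl = r , here refl , IP-head (ipR P)
      z≢ : ∀ {v} → v ∈ (a ∷ R ++ [ s ]) → v ≢ z
      z≢ i refl = proj₁ o i
      branch' : ∀ d → x ∈ (a ∷ R) → BranchX a s (SubsetOf d)
      -- For x = a the branching consists of `z` and the first vertex of R, which exists because `a`
      -- and `s` are not adjacent; for x in R it consists of both neighbours on the rung and `z`.
      branch' d (here refl) = let r , ri , ar = first R refl in inj₂ (z , r , zX d , RX d ri , (λ e → z≢ (mid∈ ri) (sym e)) , xz , ar)
      branch' d (there i) with ∈-∃++ i
      ... | p , q , eq with snoc-view a p | nextOf q
        where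
        nextOf : ∀ q → Σ V λ y → Σ (List V) λ q' → q ++ [ s ] ≡ y ∷ q'
        nextOf [] = s , [] , refl
        nextOf (y ∷ q) = y , q ++ [ s ] , refl
      ... | E , w , eqE | y , q' , eqq = inj₁ (x , w , y , z , RX d i , ~-sym (IP-head ipw) , IP-head (IP-tail ipw) , xz ,
            unique-≢ [ w ] (IP-uniq ipw) (here refl) (there (here refl)) , z≢ (cast∈ (sym eqra) (∈-++⁺ʳ E (here refl))) , z≢ (cast∈ (sym eqra) (∈-++⁺ʳ E (there (there (here refl))))))
        where
        eqra : a ∷ R ++ [ s ] ≡ E ++ w ∷ x ∷ y ∷ q'
        eqra = trans (cong (λ l → a ∷ l ++ [ s ]) eq) (trans (cong (a ∷_) (++-assoc p (x ∷ q) [ s ])) (trans (cong (λ l → a ∷ p ++ x ∷ l) eqq) (trans (cong (_++ (x ∷ y ∷ q')) eqE) (++-assoc E [ w ] (x ∷ y ∷ q')))))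
        ipw : IP (w ∷ x ∷ y ∷ q')
        ipw = IP-++ʳ E (subst IP eqra (ipR P))
      branch : ∀ d → BranchX a s (SubsetOf d)
      branch d = branch' d xi

  -- What is kept of a minimal prism: one rung and its two end triangles. `closed` says that `a` and
  -- the inner vertices have no neighbours but the evident ones.
  record CornerPath (a : V) : Set where
    field
      {b c s t u} : V
      {R} : List V
      ab : a ~ b
      ac : a ~ c
      bc : b ~ c
      st : s ~ t
      su : s ~ u
      tu : t ~ u
      ipR : IP (a ∷ R ++ [ s ])
      closed : ∀ {x y} → x ∈ (a ∷ R) → x ~ y → ((x ≡ a) × ((y ≡ b) ⊎ (y ≡ c))) ⊎ (y ∈ (a ∷ R ++ [ s ]))

  prism⇒corner-path : ∀ {a R s b B t c C u} → Prism a R s b B t c C u → Shorter a R → CornerPath a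
  prism⇒corner-path {a} {R} {s} {b} {B} {t} {c} {C} {u} P IH = record
    { ab = Ladder.ab (RB P) ; ac = Ladder.ab (RC P) ; bc = Ladder.ab (BC P) ; st = Ladder.st (RB P) ; su = Ladder.st (RC P) ; tu = Ladder.st (BC P) ; ipR = ipR P ; closed = closed }
    where
    closed : ∀ {x y} → x ∈ (a ∷ R) → x ~ y → ((x ≡ a) × ((y ≡ b) ⊎ (y ≡ c))) ⊎ (y ∈ (a ∷ R ++ [ s ]))
    closed {x} {y} i e with y ∈? (a ∷ R ++ [ s ]) | (x ≟ a) ×-dec ((y ≟ b) ⊎-dec (y ≟ c))
    ... | yes j | _ = inj₂ j
    ... | no _ | yes h = inj₁ h
    ... | no ¬j | no ¬h = ⊥-elim (no-exit P IH i e (¬j , λ { (inj₁ k) → notY (Ladder.cr (RB P) (∈-++⁺ˡ i) k) inj₁ ; (inj₂ k) → notY (Ladder.cr (RC P) (∈-++⁺ˡ i) k) inj₂ }))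
      where
      notY : ∀ {b' t'} → Cross a s b' t' x y → (∀ {w} → w ≡ b' → (w ≡ b) ⊎ (w ≡ c)) → ⊥
      notY (inj₁ (p , q)) f = ¬h (p , f q)
      notY (inj₂ (inj₁ (p , _))) f = aR≢s P IH i p
      notY (inj₂ (inj₂ h)) f = proj₂ h e

  -- Descent on the first rung: if there were no corner path at `a`, the recursion itself would
  -- supply the minimality from which one is obtained.
  minimal : ∀ {a} → ¬ CornerPath a → ∀ k {R s b B t c C u} → Prism a R s b B t c C u → length R < k → ⊥
  minimal ng (suc k) P (s≤s le) = ng (prism⇒corner-path P λ P' lt → minimal ng k P' (≤-trans lt le))

  corner-path : ∀ {a b c w} → a ~ b → a ~ c → b ~ c → w ∉ (a ∷ b ∷ c ∷ []) → ¬ ¬ CornerPath a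
  corner-path ab ac bc w∉ ng = prism-exists ab ac bc w∉ λ (R , s , B , t , C , u , P) → minimal ng (suc (length R)) P ≤-refl

  record Claw : Set where
    field
      v x y z : V
      vx : v ~ x
      vy : v ~ y
      vz : v ~ z
      xy : x # y
      xz : x # z
      yz : y # z

  InTriangle : V → Set
  InTriangle a = Σ V λ b → Σ V λ c → (a ~ b) × (a ~ c) × (b ~ c)

  -- Both ends of a corner path lie in triangles, so the second alternative is confined to inner
  -- vertices.
  Reached : V → Set
  Reached x = InTriangle x ⊎ (Σ V λ a → Σ (CornerPath a) λ g → x ∈ CornerPath.R g)

  open Positions {V} _≟_

  -- The vertices in triangles and on the paths leaving them are closed under adjacency, so they are all vertices.
  module _ (K : Claw) where
    open Claw K

    -- A triangle cannot contain two non-adjacent leaves of the claw, so it leaves out a vertex, as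
    -- `corner-path` requires.
    outside : ∀ {a b c} → a ~ b → a ~ c → b ~ c → Σ V λ w → w ∉ (a ∷ b ∷ c ∷ [])
    outside {a} {b} {c} ab ac bc with x ∈? (a ∷ b ∷ c ∷ []) | y ∈? (a ∷ b ∷ c ∷ [])
    ... | no h | _ = x , h
    ... | yes _ | no h = y , h
    ... | yes i | yes j = ⊥-elim (proj₂ xy (T-clique ab ac bc i j (proj₁ xy)))

    spread : ∀ {p q} → Reached p → p ~ q → ¬ ¬ Reached q
    spread (inj₁ (b , c , ab , ac , bc)) pq k = corner-path ab ac bc (proj₂ (outside ab ac bc)) λ g → let open CornerPath g renaming (R to R') in
      case closed (here refl) pq of λ
        { (inj₁ (_ , inj₁ refl)) → k (inj₁ (_ , _ , ~-sym (CornerPath.ab g) , CornerPath.bc g , CornerPath.ac g))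
        ; (inj₁ (_ , inj₂ refl)) → k (inj₁ (_ , _ , ~-sym (CornerPath.ac g) , ~-sym (CornerPath.bc g) , CornerPath.ab g))
        ; (inj₂ i) → case ∈-path⁻ R' i of λ { (inj₁ refl) → ~-irr pq ; (inj₂ (inj₁ j)) → k (inj₂ (_ , g , j)) ; (inj₂ (inj₂ refl)) → k (inj₁ (_ , _ , st , su , tu)) } }
    spread (inj₂ (a , g , i)) pq k = let open CornerPath g renaming (R to R') in
      case closed (there i) pq of λ
        { (inj₁ (refl , _)) → path-a∉ (CornerPath.ipR g) i
        ; (inj₂ j) → case ∈-path⁻ R' j of λ { (inj₁ refl) → k (inj₁ (_ , _ , CornerPath.ab g , CornerPath.ac g , CornerPath.bc g)) ; (inj₂ (inj₁ j)) → k (inj₂ (_ , g , j)) ; (inj₂ (inj₂ refl)) → k (inj₁ (_ , _ , st , su , tu)) } }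

    -- The neighbours of a corner are two adjacent vertices and the one at position 1 of its path;
    -- those of an inner vertex are its two neighbours on the path. Three pairwise non-adjacent ones
    -- do not fit.
    no-claw-at : Reached v → ⊥
    no-claw-at (inj₁ (b , c , ab , ac , bc)) = corner-path ab ac bc (proj₂ (outside ab ac bc)) λ g → at-corner g
      where
      at-corner : CornerPath v → ⊥
      at-corner g = go (one vx) (one vy) (one vz)
        where
        open CornerPath g using (closed) renaming (R to R'; s to s'; b to b'; c to c'; ipR to ipR')
        Side : V → Set
        Side w = (w ∈ (b' ∷ c' ∷ [])) ⊎ ((w ∈ (v ∷ R' ++ [ s' ])) × (pos w (v ∷ R' ++ [ s' ]) ≡ 1))
        one : ∀ {w} → v ~ w → Side w
        one {w} e with closed (here refl) e
        ... | inj₁ (_ , inj₁ h) = inj₁ (here h)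
        ... | inj₁ (_ , inj₂ h) = inj₁ (there (here h))
        ... | inj₂ i with subst (λ k → Next k (pos w (v ∷ R' ++ [ s' ]))) (pos-mid [] (IP-uniq ipR')) (consec-pos (IP-uniq ipR') (IP-ConsecIn ipR' (here refl) i e))
        ... | inj₁ h = inj₂ (i , h)
        ... | inj₂ ()
        two : ∀ {p q} → p # q → p ∈ (b' ∷ c' ∷ []) → q ∈ (b' ∷ c' ∷ []) → ⊥
        two pq i j = proj₂ pq (edge-clique (CornerPath.bc g) i j (proj₁ pq))
        same : ∀ {p q : V} → p # q → (p ∈ (v ∷ R' ++ [ s' ])) × (pos p (v ∷ R' ++ [ s' ]) ≡ 1) → (q ∈ (v ∷ R' ++ [ s' ])) × (pos q (v ∷ R' ++ [ s' ]) ≡ 1) → ⊥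
        same pq (i , e) (j , e') = proj₁ pq (pos-inj i j (trans e (sym e')))
        go : Side x → Side y → Side z → ⊥
        go (inj₁ i) (inj₁ j) _ = two xy i j
        go (inj₁ i) (inj₂ j) (inj₁ k) = two xz i k
        go (inj₁ i) (inj₂ j) (inj₂ k) = same yz j k
        go (inj₂ i) (inj₁ j) (inj₁ k) = two yz j k
        go (inj₂ i) (inj₁ j) (inj₂ k) = same xz i k
        go (inj₂ i) (inj₂ j) _ = same xy i j
    no-claw-at (inj₂ (a , g , i)) = case two-next (nx vx) (nx vy) (nx vz) of λ
        { (inj₁ e) → proj₁ xy (pos-inj (mem vx) (mem vy) e) ; (inj₂ (inj₁ e)) → proj₁ xz (pos-inj (mem vx) (mem vz) e) ; (inj₂ (inj₂ e)) → proj₁ yz (pos-inj (mem vy) (mem vz) e) }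
      where
      open CornerPath g using (closed) renaming (R to R'; s to s'; ipR to ipR')
      mem : ∀ {w} → v ~ w → w ∈ (a ∷ R' ++ [ s' ])
      mem e with closed (there i) e
      ... | inj₁ (refl , _) = ⊥-elim (path-a∉ ipR' i)
      ... | inj₂ j = j
      nx : ∀ {w} → v ~ w → Next (pos v (a ∷ R' ++ [ s' ])) (pos w (a ∷ R' ++ [ s' ]))
      nx e = consec-pos (IP-uniq ipR') (IP-ConsecIn ipR' (mid∈ i) (mem e) e)

    triangle⇒⊥ : ∀ {a} → InTriangle a → ⊥
    -- The empty clique is not a cutset, so a path leads from the triangle to the centre of the
    -- claw.
    triangle⇒⊥ {a} T = connected-avoiding noC [] (λ ()) {a} {v} (λ ()) (λ ()) λ pth →
        let open PathIn pth in along tl ip (inj₁ T) (cast∈ (sym ends) (∈-++⁺ʳ ini (here refl)))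
      where
      along : ∀ {x} l → IP (x ∷ l) → Reached x → v ∈ (x ∷ l) → ⊥
      along l ip h (here refl) = no-claw-at h
      along (y ∷ l) ip h (there i) = spread h (IP-head ip) λ h' → along l (IP-tail ip) h' i

-- Line graphs

module Chords {A : Set} (Adj : A → A → Set) where

  -- The cycle cut at `u` and `v` into two arcs with non-empty interiors. `meas` says that nothing
  -- was lost in the rotation, in the form in which lengths, vertex counts and neighbour counts are
  -- transferred.
  record TwoArcs (c : List A) (u v : A) : Set where
    field
      m q  : List A
      m≢[] : m ≢ []
      q≢[] : q ≢ []
      uq   : Unique (u ∷ m ++ v ∷ q)
      arc₁ : Consec Adj (u ∷ m ++ [ v ])
      arc₂ : Consec Adj (v ∷ q ++ [ u ])
      meas : ∀ (f : List A → ℕ) → (∀ l l' → f (l ++ l') ≡ f l + f l') → f (u ∷ m ++ v ∷ q) ≡ f c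

  consec-++ʳ : ∀ p {q} → Consec Adj (p ++ q) → Consec Adj q
  consec-++ʳ [] h = h
  consec-++ʳ (x ∷ []) {[]} h = tt
  consec-++ʳ (x ∷ []) {y ∷ q} (_ , h) = h
  consec-++ʳ (x ∷ y ∷ p) (_ , h) = consec-++ʳ (y ∷ p) h

  consec-++ˡ : ∀ p {q} → Consec Adj (p ++ q) → Consec Adj p
  consec-++ˡ [] h = tt
  consec-++ˡ (x ∷ []) h = tt
  consec-++ˡ (x ∷ y ∷ p) (e , h) = e , consec-++ˡ (y ∷ p) h

  consec-glue : ∀ p {y q} → Consec Adj (p ++ [ y ]) → Consec Adj (y ∷ q) → Consec Adj (p ++ y ∷ q)
  consec-glue [] h h' = h'
  consec-glue (x ∷ []) (e , _) h' = e , h'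
  consec-glue (x ∷ x' ∷ p) (e , h) h' = e , consec-glue (x' ∷ p) h h'

  unique-rot : ∀ p {q : List A} → Unique (p ++ q) → Unique (q ++ p)
  unique-rot p {q} u = UP.++⁺ (unique-++ʳ p u) (UPl p u) λ (i , j) → unique-≢ p u j i refl
    where
    UPl : ∀ p → Unique (p ++ q) → Unique p
    UPl [] u = []
    UPl (x ∷ p) (a ∷ u) = All.tabulate (λ i → All.lookup a (∈-++⁺ˡ i)) ∷ UPl p u

  meas-rot : ∀ (f : List A → ℕ) → (∀ l l' → f (l ++ l') ≡ f l + f l') → ∀ p q → f (q ++ p) ≡ f (p ++ q)
  meas-rot f f-++ p q = trans (f-++ q p) (trans (+-comm (f q) _) (sym (f-++ p q)))

  ordered : ∀ x p {r u m v q} → x ∷ r ≡ p ++ u ∷ m ++ v ∷ q → Unique (x ∷ r) → Consec Adj ((x ∷ r) ++ [ x ]) →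
    ConsecIn ((x ∷ r) ++ [ x ]) u v ⊎ TwoArcs (x ∷ r) u v
  ordered x p {u = u} {[]} {v} {q} e un co = inj₁ (p , q ++ [ x ] , inj₁ (trans (cong (_++ [ x ]) e) (++-assoc p (u ∷ v ∷ q) [ x ])))
  ordered x [] {u = .x} {m₀ ∷ m} {v} {[]} refl un co = inj₁ (x ∷ m₀ ∷ m , [] , inj₂ (cong (λ l → x ∷ m₀ ∷ l) (++-assoc m [ v ] [ x ])))
  ordered x [] {u = .x} {m₀ ∷ m} {v} {q₀ ∷ q} refl un co = inj₂ record { m = m₀ ∷ m ; q = q₀ ∷ q ; m≢[] = λ () ; q≢[] = λ () ; uq = un
    ; arc₁ = consec-++ˡ (x ∷ m₀ ∷ m ++ [ v ]) (subst (Consec Adj) (cong (λ l → x ∷ m₀ ∷ l) (trans (++-assoc m (v ∷ q₀ ∷ q) [ x ]) (sym (++-assoc m [ v ] (q₀ ∷ q ++ [ x ]))))) co)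
    ; arc₂ = consec-++ʳ (x ∷ m₀ ∷ m) (subst (Consec Adj) (cong (λ l → x ∷ m₀ ∷ l) (++-assoc m (v ∷ q₀ ∷ q) [ x ])) co) ; meas = λ _ _ → refl }
  ordered x (.x ∷ p) {u = u} {m₀ ∷ m} {v} {q} refl un co = inj₂ record { m = m₀ ∷ m ; q = q ++ x ∷ p ; m≢[] = λ () ; q≢[] = ne q
    ; uq = subst Unique rot≡ (unique-rot (x ∷ p) un)
    ; arc₁ = consec-++ˡ (u ∷ m₀ ∷ m ++ [ v ]) (subst (Consec Adj) (cong (λ l → u ∷ m₀ ∷ l) (trans (++-assoc m (v ∷ q) [ x ]) (sym (++-assoc m [ v ] (q ++ [ x ]))))) co₂)
    ; arc₂ = subst (Consec Adj) (cong (v ∷_) (sym (++-assoc q (x ∷ p) [ u ]))) (consec-glue (v ∷ q) (consec-++ʳ (u ∷ m₀ ∷ m) (subst (Consec Adj) (cong (λ l → u ∷ m₀ ∷ l) (++-assoc m (v ∷ q) [ x ])) co₂))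
        (consec-++ˡ (x ∷ p ++ [ u ]) (subst (Consec Adj) (cong (x ∷_) (trans (++-assoc p (u ∷ m₀ ∷ m ++ v ∷ q) [ x ]) (sym (++-assoc p [ u ] _)))) co)))
    ; meas = λ f f-++ → trans (cong f (sym rot≡)) (meas-rot f f-++ (x ∷ p) _) }
    where
    rot≡ : (u ∷ m₀ ∷ m ++ v ∷ q) ++ x ∷ p ≡ u ∷ m₀ ∷ m ++ v ∷ q ++ x ∷ p
    rot≡ = cong (λ l → u ∷ m₀ ∷ l) (++-assoc m (v ∷ q) (x ∷ p))
    ne : ∀ q → q ++ x ∷ p ≢ []
    ne [] ()
    ne (_ ∷ _) ()
    co₂ : Consec Adj (u ∷ m₀ ∷ (m ++ v ∷ q) ++ [ x ])
    co₂ = consec-++ʳ (x ∷ p) (subst (Consec Adj) (cong (x ∷_) (++-assoc p (u ∷ m₀ ∷ m ++ v ∷ q) [ x ])) co)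

  arcs-sym : ∀ {c u v} → TwoArcs c u v → TwoArcs c v u
  arcs-sym {c} {u} {v} t = record { m = TwoArcs.q t ; q = TwoArcs.m t ; m≢[] = TwoArcs.q≢[] t ; q≢[] = TwoArcs.m≢[] t
    ; uq = unique-rot (u ∷ TwoArcs.m t) (TwoArcs.uq t) ; arc₁ = TwoArcs.arc₂ t ; arc₂ = TwoArcs.arc₁ t
    ; meas = λ f f-++ → trans (meas-rot f f-++ (u ∷ TwoArcs.m t) _) (TwoArcs.meas t f f-++) }

  chord-or-consec : ∀ {x r u v} → Unique (x ∷ r) → Consec Adj ((x ∷ r) ++ [ x ]) → u ∈ (x ∷ r) → v ∈ (x ∷ r) → u ≢ v →
    ConsecIn ((x ∷ r) ++ [ x ]) u v ⊎ TwoArcs (x ∷ r) u v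
  chord-or-consec {x} {r} {u} {v} un co i j u≢v with ∈-∃++ i
  ... | p , q , e with ∈-++⁻ p (cast∈ e j)
  ... | inj₂ (here e') = ⊥-elim (u≢v (sym e'))
  ... | inj₂ (there k) with ∈-∃++ k
  ... | m , q' , refl = ordered x p e un co
  chord-or-consec {x} {r} {u} {v} un co i j u≢v | p , q , e | inj₁ k with ∈-∃++ k
  ... | p' , m , refl with ordered x p' {u = v} {m} {u} {q} (trans e (++-assoc p' (v ∷ m) (u ∷ q))) un co
  ... | inj₁ h = inj₁ (ConsecIn-sym h)
  ... | inj₂ t = inj₂ (arcs-sym t)

module Quotient {k : ℕ} {_≈_ : Fin k → Fin k → Set} (_≈?_ : ∀ x y → Dec (x ≈ y)) (≈-refl : ∀ {x} → x ≈ x)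
  (≈-sym : ∀ {x y} → x ≈ y → y ≈ x) (≈-trans : ∀ {x y z} → x ≈ y → y ≈ z → x ≈ z) where

  -- The first element of a class in `allFin k` represents it, which turns equivalence into
  -- equality.
  least : ∀ x → Σ (List (Fin k)) λ p → Σ (Fin k) λ y → Σ (List (Fin k)) λ q → (allFin k ≡ p ++ y ∷ q) × (y ≈ x) × (∀ {z} → z ∈ p → ¬ (z ≈ x))
  least x = firstSat (_≈? x) (∈⇒Any (∈-allFin x) ≈-refl)

  first-unique : ∀ {A : Set} {P : A → Set} p {y q} p' {y' q'} → p ++ y ∷ q ≡ p' ++ y' ∷ q' → P y → P y' → (∀ {z} → z ∈ p → ¬ P z) → (∀ {z} → z ∈ p' → ¬ P z) → y ≡ y'
  first-unique [] [] e _ _ _ _ = ∷-injectiveˡ e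
  first-unique {P = P} [] (x ∷ p') e py py' h h' = ⊥-elim (h' (here refl) (subst P (∷-injectiveˡ e) py))
  first-unique {P = P} (x ∷ p) [] e py py' h h' = ⊥-elim (h (here refl) (subst P (sym (∷-injectiveˡ e)) py'))
  first-unique (x ∷ p) (x' ∷ p') e py py' h h' = first-unique p p' (∷-injectiveʳ e) py py' (h ∘ there) (h' ∘ there)

  abstract
    rep : Fin k → Fin k
    rep x = proj₁ (proj₂ (least x))

    rep≈ : ∀ x → rep x ≈ x
    rep≈ x = proj₁ (proj₂ (proj₂ (proj₂ (proj₂ (least x)))))

    rep-cong : ∀ {x x'} → x ≈ x' → rep x ≡ rep x'
    rep-cong {x} {x'} e with least x | least x'
    ... | p , y , q , eq , yx , h | p' , y' , q' , eq' , yx' , h' =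
      first-unique {P = _≈ x} p p' (trans (sym eq) eq') yx (≈-trans yx' (≈-sym e)) h (λ i z → h' i (≈-trans z e))

    rep-inj : ∀ {x x'} → rep x ≡ rep x' → x ≈ x'
    rep-inj {x} {x'} e = ≈-trans (≈-sym (rep≈ x)) (subst (_≈ x') (sym e) (rep≈ x'))

module LineGraph (G : Graph) (noW : ¬ HasWheel G) (DF : DiamondFree G)
  (noClaw : ∀ {v x y z} → E G v x → E G v y → E G v z → x ≢ y → x ≢ z → y ≢ z → E G x y ⊎ E G x z ⊎ E G y z) where
  open Basics G

  near : ∀ v → Dec (Σ V (v ~_)) → V → Bool
  near v (no _) w = true
  near v (yes (m , _)) w = does ((w ≟ m) ⊎-dec (w ~? m))

  abstract
    -- The neighbourhood of v is covered by two cliques: the one of a chosen neighbour, and the rest.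
    side : V → V → Bool
    side v w = near v (any? (v ~?_)) w

    -- If just one of `w`, `w'` were near the chosen neighbour `m`, say `w`, then `w'` and `m` would
    -- both see the edge `v w`.
    side-same : ∀ {v w w'} → v ~ w → v ~ w' → w ~ w' → side v w ≡ side v w'
    side-same {v} {w} {w'} vw vw' ww' with any? (v ~?_)
    ... | no h = refl
    ... | yes (m , vm) with w ≟ m | w' ≟ m | w ~? m | w' ~? m
    ... | yes _ | yes _ | _ | _ = refl
    ... | yes refl | no _ | _ | yes _ = refl
    ... | yes refl | no _ | _ | no h = ⊥-elim (h (~-sym ww'))
    ... | no _ | yes refl | yes _ | _ = refl
    ... | no _ | yes refl | no h | _ = ⊥-elim (h ww')
    ... | no _ | no _ | yes _ | yes _ = refl
    ... | no _ | no _ | no _ | no _ = refl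
    ... | no _ | no h | yes wm | no _ = ⊥-elim (h (DF vw (~-sym vw') (~-sym ww') (~-sym vm) (~-sym wm)))
    ... | no h | no _ | no _ | yes w'm = ⊥-elim (h (DF vw' (~-sym vw) ww' (~-sym vm) (~-sym w'm)))

    -- Two neighbours of the chosen `m` coincide by diamond-freeness, and two non-neighbours must be
    -- adjacent, or they would form a claw with `m` at `v`.
    same-side : ∀ {v w w'} → v ~ w → v ~ w' → side v w ≡ side v w' → w ≢ w' → w ~ w'
    same-side {v} {w} {w'} vw vw' e ne with any? (v ~?_)
    ... | no h = ⊥-elim (h (w , vw))
    ... | yes (m , vm) with w ≟ m | w' ≟ m | w ~? m | w' ~? m
    ... | yes refl | yes refl | _ | _ = ⊥-elim (ne refl)
    ... | yes refl | no _ | _ | yes h = ~-sym h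
    same-side vw vw' () ne | yes (m , vm) | yes refl | no _ | _ | no h
    ... | no _ | yes refl | yes h | _ = h
    same-side vw vw' () ne | yes (m , vm) | no _ | yes refl | no h | _
    ... | no _ | no _ | yes wm | yes w'm = ⊥-elim (ne (DF vm (~-sym vw) wm (~-sym vw') w'm))
    same-side vw vw' () ne | yes (m , vm) | no _ | no _ | yes _ | no _
    same-side vw vw' () ne | yes (m , vm) | no _ | no _ | no _ | yes _
    ... | no h | no h' | no wm | no w'm = case noClaw vw vw' vm ne h h' of λ { (inj₁ x) → x ; (inj₂ (inj₁ x)) → ⊥-elim (wm x) ; (inj₂ (inj₂ x)) → ⊥-elim (w'm x) }

  End : Set
  End = V × Bool

  -- A vertex of G becomes an edge of H with one end for each of the two cliques around it. Adjacent
  -- `v` and `w` are glued at the end of `v` on whose side `w` lies and the end of `w` on whose side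
  -- `v` lies.
  _≈ᴱ_ : End → End → Set
  (v , i) ≈ᴱ (w , j) = ((v ≡ w) × (i ≡ j)) ⊎ ((v ~ w) × (side v w ≡ i) × (side w v ≡ j))

  ≈ᴱ-sym : ∀ {p q} → p ≈ᴱ q → q ≈ᴱ p
  ≈ᴱ-sym (inj₁ (refl , refl)) = inj₁ (refl , refl)
  ≈ᴱ-sym (inj₂ (e , x , y)) = inj₂ (~-sym e , y , x)

  -- `v` and `x` lie on the same side of `w`, hence are adjacent or equal; in the triangle `v w x`
  -- the sides then agree at `v` and at `x`.
  ≈ᴱ-trans : ∀ {p q r} → p ≈ᴱ q → q ≈ᴱ r → p ≈ᴱ r
  ≈ᴱ-trans (inj₁ (refl , refl)) h = h
  ≈ᴱ-trans (inj₂ h) (inj₁ (refl , refl)) = inj₂ h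
  ≈ᴱ-trans {v , i} {w , j} {x , k} (inj₂ (vw , refl , wv)) (inj₂ (wx , wx' , refl)) with v ≟ x
  ... | yes refl = inj₁ (refl , refl)
  ... | no ne = inj₂ (vx , side-same vx vw (~-sym wx) , side-same (~-sym vx) (~-sym wx) vw)
    where
    vx : v ~ x
    vx = same-side (~-sym vw) wx (trans wv (sym wx')) ne

  m : ℕ
  m = n G + n G

  code : End → Fin m
  code (v , false) = v ↑ˡ n G
  code (v , true) = n G ↑ʳ v

  fromSum : V ⊎ V → End
  fromSum (inj₁ v) = v , false
  fromSum (inj₂ v) = v , true

  decode : Fin m → End
  decode p = fromSum (splitAt (n G) p)

  decode-code : ∀ e → decode (code e) ≡ e
  decode-code (v , false) = cong fromSum (splitAt-↑ˡ (n G) v (n G))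
  decode-code (v , true) = cong fromSum (splitAt-↑ʳ (n G) (n G) v)

  _≈?_ : ∀ p q → Dec (decode p ≈ᴱ decode q)
  p ≈? q with decode p | decode q
  ... | v , i | w , j = ((v ≟ w) ×-dec (i Bool.≟ j)) ⊎-dec ((v ~? w) ×-dec (side v w Bool.≟ i) ×-dec (side w v Bool.≟ j))

  open Quotient {m} {λ p q → decode p ≈ᴱ decode q} _≈?_ (inj₁ (refl , refl)) ≈ᴱ-sym ≈ᴱ-trans

  abstract
    r : V → Bool → Fin m
    r v i = rep (code (v , i))

    r-cong : ∀ {v i w j} → (v , i) ≈ᴱ (w , j) → r v i ≡ r w j
    r-cong {v} {i} {w} {j} h = rep-cong (subst₂ _≈ᴱ_ (sym (decode-code (v , i))) (sym (decode-code (w , j))) h)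

    r-inj : ∀ {v i w j} → r v i ≡ r w j → (v , i) ≈ᴱ (w , j)
    r-inj {v} {i} {w} {j} e = subst₂ _≈ᴱ_ (decode-code (v , i)) (decode-code (w , j)) (rep-inj e)

  r-same : ∀ {v i j} → r v i ≡ r v j → i ≡ j
  r-same {v} {i} {j} e with r-inj {v} {i} {v} {j} e
  ... | inj₁ (_ , h) = h
  ... | inj₂ (h , _) = ⊥-elim (~-irr h)

  r-share : ∀ {v i w j} → v ≢ w → r v i ≡ r w j → v ~ w
  r-share {v} {i} {w} {j} ne e with r-inj {v} {i} {w} {j} e
  ... | inj₁ (h , _) = ⊥-elim (ne h)
  ... | inj₂ (h , _) = h

  IsEdge : V → Fin m → Fin m → Set
  IsEdge v p q = ((p ≡ r v false) × (q ≡ r v true)) ⊎ ((p ≡ r v true) × (q ≡ r v false))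

  isEdge? : ∀ p q → Dec (Σ V λ v → IsEdge v p q)
  isEdge? p q = any? λ v → ((p ≟ _) ×-dec (q ≟ _)) ⊎-dec ((p ≟ _) ×-dec (q ≟ _))

  IsEdge-sym : ∀ {v p q} → IsEdge v p q → IsEdge v q p
  IsEdge-sym (inj₁ (x , y)) = inj₂ (y , x)
  IsEdge-sym (inj₂ (x , y)) = inj₁ (y , x)

  does-⇔ : ∀ {P Q : Set} (d : Dec P) (d' : Dec Q) → (P → Q) → (Q → P) → does d ≡ does d'
  does-⇔ (yes _) (yes _) f g = refl
  does-⇔ (no _) (no _) f g = refl
  does-⇔ (yes p) (no h) f g = ⊥-elim (h (f p))
  does-⇔ (no h) (yes q) f g = ⊥-elim (h (g q))

  -- All codes of ends are vertices; those that represent no class are isolated.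
  H : Graph
  H = record { n = m ; adj = λ p q → does (isEdge? p q)
    ; adj-sym = λ p q → does-⇔ (isEdge? p q) (isEdge? q p) (λ (v , h) → v , IsEdge-sym h) (λ (v , h) → v , IsEdge-sym h)
    ; adj-irr = λ p → irr p (isEdge? p p) }
    where
    irr : ∀ p (d : Dec (Σ V λ v → IsEdge v p p)) → does d ≡ false
    irr p (no _) = refl
    irr p (yes (v , inj₁ (e , e'))) = case r-same (trans (sym e) e') of λ ()
    irr p (yes (v , inj₂ (e , e'))) = case r-same (trans (sym e) e') of λ ()

  edge⁻ : ∀ {p q} → E H p q → Σ V λ v → IsEdge v p q
  edge⁻ {p} {q} e with isEdge? p q
  ... | yes h = h
  edge⁻ () | no _

  edge⁺ : ∀ {p q v} → IsEdge v p q → E H p q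
  edge⁺ {p} {q} {v} h = dec-true (isEdge? p q) (v , h)

  HasEnd : V → Fin m → Set
  HasEnd v p = Σ Bool λ i → r v i ≡ p

  ends : ∀ {v p q x} → IsEdge v p q → HasEnd v x → (x ≡ p) ⊎ (x ≡ q)
  ends (inj₁ (refl , refl)) (false , refl) = inj₁ refl
  ends (inj₁ (refl , refl)) (true , refl) = inj₂ refl
  ends (inj₂ (refl , refl)) (false , refl) = inj₂ refl
  ends (inj₂ (refl , refl)) (true , refl) = inj₁ refl

  endˡ : ∀ {v p q} → IsEdge v p q → HasEnd v p
  endˡ (inj₁ (e , _)) = false , sym e
  endˡ (inj₂ (e , _)) = true , sym e

  endʳ : ∀ {v p q} → IsEdge v p q → HasEnd v q
  endʳ h = endˡ (IsEdge-sym h)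

  share~ : ∀ {v w p} → HasEnd v p → HasEnd w p → v ≢ w → v ~ w
  share~ (i , e) (j , e') ne = r-share ne (trans e (sym e'))

  ~share : ∀ {v w} → v ~ w → Σ (Fin m) λ p → HasEnd v p × HasEnd w p
  ~share {v} {w} e = r v (side v w) , (side v w , refl) , (side w v , sym (r-cong (inj₂ (e , refl , refl))))

  apart : ∀ {v w} → (∀ {p} → HasEnd v p → HasEnd w p → ⊥) → v # w
  apart h = (λ { refl → h (false , refl) (false , refl) }) , λ e → let _ , x , y = ~share e in h x y

  -- H has no parallel edges: adjacency of `u` and `v` singles out one end of each, so they cannot
  -- share both `p` and `q`.
  same-ends : ∀ {u v p q} → p ≢ q → HasEnd u p → HasEnd v p → HasEnd u q → HasEnd v q → u ≡ v
  same-ends {u} {v} p≢q (i , e₁) (i' , e₂) (j , e₃) (j' , e₄) with u ≟ v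
  ... | yes e = e
  ... | no ne with r-inj {u} {i} {v} {i'} (trans e₁ (sym e₂)) | r-inj {u} {j} {v} {j'} (trans e₃ (sym e₄))
  ... | inj₁ (e , _) | _ = ⊥-elim (ne e)
  ... | inj₂ _ | inj₁ (e , _) = ⊥-elim (ne e)
  ... | inj₂ (_ , refl , _) | inj₂ (_ , refl , _) = ⊥-elim (p≢q (trans (sym e₁) e₃))

  pairOf : V → Fin m × Fin m
  pairOf v with <ꟳ-cmp (r v false) (r v true)
  ... | tri< _ _ _ = r v false , r v true
  -- Impossible, as the two ends of `v` differ; `pairOf-<` refutes it.
  ... | tri≈ _ _ _ = r v false , r v true
  ... | tri> _ _ _ = r v true , r v false

  pairOf-< : ∀ v → proj₁ (pairOf v) F.< proj₂ (pairOf v)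
  pairOf-< v with <ꟳ-cmp (r v false) (r v true)
  ... | tri< h _ _ = h
  ... | tri≈ _ e _ = case r-same e of λ ()
  ... | tri> _ _ h = h

  pairOf-edge : ∀ v → IsEdge v (proj₁ (pairOf v)) (proj₂ (pairOf v))
  pairOf-edge v with <ꟳ-cmp (r v false) (r v true)
  ... | tri< _ _ _ = inj₁ (refl , refl)
  ... | tri≈ _ _ _ = inj₁ (refl , refl)
  ... | tri> _ _ _ = inj₂ (refl , refl)

  <⇒≢ᴴ : ∀ {p q : Fin m} → p F.< q → p ≢ q
  <⇒≢ᴴ h refl = <-irrefl refl h

  isLine : IsLineGraphOf G H
  isLine = pairOf , (λ v → pairOf-< v , edge⁺ (pairOf-edge v)) , inj , surj , λ u v → mk⇔ (to u v) (from u v)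
    where
    inj : ∀ u v → pairOf u ≡ pairOf v → u ≡ v
    inj u v e = same-ends (<⇒≢ᴴ (pairOf-< u)) (endˡ (pairOf-edge u)) (subst (λ x → HasEnd v (proj₁ x)) (sym e) (endˡ (pairOf-edge v)))
      (endʳ (pairOf-edge u)) (subst (λ x → HasEnd v (proj₂ x)) (sym e) (endʳ (pairOf-edge v)))
    surj : ∀ a b → a F.< b → E H a b → Σ V λ v → pairOf v ≡ (a , b)
    surj a b a<b e with edge⁻ e
    ... | v , h with ends (pairOf-edge v) (endˡ h) | ends (pairOf-edge v) (endʳ h)
    ... | inj₁ refl | inj₁ e' = ⊥-elim (<⇒≢ᴴ a<b (sym e'))
    ... | inj₁ refl | inj₂ refl = v , refl
    ... | inj₂ refl | inj₁ refl = ⊥-elim (<-asym a<b (pairOf-< v))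
    ... | inj₂ refl | inj₂ e' = ⊥-elim (<⇒≢ᴴ a<b (sym e'))
    to : ∀ u v → u ~ v → (u ≢ v) × ShareEnd (pairOf u) (pairOf v)
    to u v e with ~share e
    ... | p , x , y with ends (pairOf-edge u) x | ends (pairOf-edge v) y
    ... | inj₁ a | inj₁ b = ~⇒≢ e , inj₁ (trans (sym a) b)
    ... | inj₁ a | inj₂ b = ~⇒≢ e , inj₂ (inj₁ (trans (sym a) b))
    ... | inj₂ a | inj₁ b = ~⇒≢ e , inj₂ (inj₂ (inj₁ (trans (sym a) b)))
    ... | inj₂ a | inj₂ b = ~⇒≢ e , inj₂ (inj₂ (inj₂ (trans (sym a) b)))
    from : ∀ u v → (u ≢ v) × ShareEnd (pairOf u) (pairOf v) → u ~ v
    from u v (ne , inj₁ e) = share~ (endˡ (pairOf-edge u)) (subst (HasEnd v) (sym e) (endˡ (pairOf-edge v))) ne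
    from u v (ne , inj₂ (inj₁ e)) = share~ (endˡ (pairOf-edge u)) (subst (HasEnd v) (sym e) (endʳ (pairOf-edge v))) ne
    from u v (ne , inj₂ (inj₂ (inj₁ e))) = share~ (endʳ (pairOf-edge u)) (subst (HasEnd v) (sym e) (endˡ (pairOf-edge v))) ne
    from u v (ne , inj₂ (inj₂ (inj₂ e))) = share~ (endʳ (pairOf-edge u)) (subst (HasEnd v) (sym e) (endʳ (pairOf-edge v))) ne

  ∈-filterᵇ⁻ : ∀ {A : Set} (f : A → Bool) {x} l → x ∈ filterᵇ f l → f x ≡ true
  ∈-filterᵇ⁻ f (y ∷ l) i with f y in e
  ∈-filterᵇ⁻ f (y ∷ l) (here refl) | true = e
  ∈-filterᵇ⁻ f (y ∷ l) (there i) | true = ∈-filterᵇ⁻ f l i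
  ∈-filterᵇ⁻ f (y ∷ l) i | false = ∈-filterᵇ⁻ f l i

  -- The edges of H at `a` are pairwise adjacent vertices of G. Among four of them, two distinct
  -- ones would see both ends of the edge between the other two.
  maxDegree : MaxDegree≤3 H
  maxDegree a = bound (filterᵇ (adj H a) (allFin m)) (UP.filter⁺ (T? ∘ adj H a) (UP.allFin⁺ m)) (λ {q} i → edge⁻ (∈-filterᵇ⁻ (adj H a) (allFin m) i))
    where
    bound : ∀ l → Unique l → (∀ {q} → q ∈ l → Σ V λ v → IsEdge v a q) → length l ≤ 3
    bound [] _ _ = z≤n
    bound (_ ∷ []) _ _ = s≤s z≤n
    bound (_ ∷ _ ∷ []) _ _ = s≤s (s≤s z≤n)
    bound (_ ∷ _ ∷ _ ∷ []) _ _ = s≤s (s≤s (s≤s z≤n))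
    bound (q₁ ∷ q₂ ∷ q₃ ∷ q₄ ∷ l) ((n₁₂ ∷ n₁₃ ∷ n₁₄ ∷ _) ∷ (n₂₃ ∷ n₂₄ ∷ _) ∷ (n₃₄ ∷ _) ∷ _) h
      with h (here refl) | h (there (here refl)) | h (there (there (here refl))) | h (there (there (there (here refl))))
    ... | v₁ , e₁ | v₂ , e₂ | v₃ , e₃ | v₄ , e₄ =
      ⊥-elim (dist n₃₄ e₃ e₄ (DF (adj' n₁₂ e₁ e₂) (adj' (≢-sym n₁₃) e₃ e₁) (adj' (≢-sym n₂₃) e₃ e₂) (adj' (≢-sym n₁₄) e₄ e₁) (adj' (≢-sym n₂₄) e₄ e₂)))
      where
      dist : ∀ {p q v w} → p ≢ q → IsEdge v a p → IsEdge w a q → v ≢ w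
      dist p≢q e e' refl with ends e (endʳ e')
      ... | inj₂ h = p≢q (sym h)
      dist p≢q e (inj₁ (x , y)) refl | inj₁ h = case r-same (trans (sym x) (trans (sym h) y)) of λ ()
      dist p≢q e (inj₂ (x , y)) refl | inj₁ h = case r-same (trans (sym x) (trans (sym h) y)) of λ ()
      adj' : ∀ {p q v w} → p ≢ q → IsEdge v a p → IsEdge w a q → v ~ w
      adj' ne e e' = share~ (endˡ e) (endˡ e') (dist ne e e')

  open Chords (E H)

  edgesOf : ∀ l → Consec (E H) l → List V
  edgesOf [] h = []
  edgesOf (p ∷ []) h = []
  edgesOf (p ∷ q ∷ l) (e , h) = proj₁ (edge⁻ e) ∷ edgesOf (q ∷ l) h

  edgesOf-ends : ∀ l (h : Consec (E H) l) {g} → g ∈ edgesOf l h → ∀ {p} → HasEnd g p → p ∈ l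
  edgesOf-ends (p ∷ q ∷ l) (e , h) (here refl) x with ends (proj₂ (edge⁻ e)) x
  ... | inj₁ refl = here refl
  ... | inj₂ refl = there (here refl)
  edgesOf-ends (p ∷ q ∷ l) (e , h) (there i) x = there (edgesOf-ends (q ∷ l) h i x)

  -- Edges of a path with distinct vertices share an end only when they are consecutive, so in the
  -- line graph they form an induced path.
  edgesOf-IP : ∀ l (h : Consec (E H) l) → Unique l → IP (edgesOf l h)
  edgesOf-IP [] h u = tt
  edgesOf-IP (p ∷ []) h u = tt
  edgesOf-IP (p ∷ q ∷ []) h u = tt
  edgesOf-IP (p ∷ q ∷ o ∷ l) (e , e' , h) (a ∷ u@(a' ∷ _)) =
      share~ (endʳ (proj₂ (edge⁻ e))) (endˡ (proj₂ (edge⁻ e'))) (λ eq → All.lookup a (edgesOf-ends (q ∷ o ∷ l) (e' , h) (here eq) (endˡ (proj₂ (edge⁻ e)))) refl) ,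
      mk[]## (λ i → apart λ x y → case ends (proj₂ (edge⁻ e)) x of λ
        { (inj₁ refl) → All.lookup a (there (edgesOf-ends (o ∷ l) h i y)) refl ; (inj₂ refl) → All.lookup a' (edgesOf-ends (o ∷ l) h i y) refl }) ,
      edgesOf-IP (q ∷ o ∷ l) (e' , h) u

  -- `edgesOf` reads the edges off the adjacency proofs. Proofs of the same adjacency are equalities
  -- of booleans and therefore agree.
  edgesOf-snoc : ∀ l {x y} (h : Consec (E H) (l ++ x ∷ y ∷ [])) (h' : Consec (E H) (l ++ [ x ])) → Σ V λ g → IsEdge g x y × (edgesOf (l ++ x ∷ y ∷ []) h ≡ edgesOf (l ++ [ x ]) h' ++ [ g ])
  edgesOf-snoc [] (e , _) h' = proj₁ (edge⁻ e) , proj₂ (edge⁻ e) , refl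
  edgesOf-snoc (z ∷ []) (e , e' , _) (e'' , _) with trans (sym e) e | same-bool e e''
    where
    same-bool : ∀ {b c : Bool} (p q : b ≡ c) → p ≡ q
    same-bool refl refl = refl
  ... | _ | refl = proj₁ (edge⁻ e') , proj₂ (edge⁻ e') , refl
  edgesOf-snoc (z ∷ z' ∷ l) {x} {y} (e , h) (e'' , h') with edgesOf-snoc (z' ∷ l) h h' | same-bool e e''
    where
    same-bool : ∀ {b c : Bool} (p q : b ≡ c) → p ≡ q
    same-bool refl refl = refl
  ... | g , ge , eq | refl = g , ge , cong (_ ∷_) eq

  edgesOf-into : ∀ p v q (h : Consec (E H) (p ++ v ∷ q)) → p ≢ [] → Σ V λ g → (g ∈ edgesOf (p ++ v ∷ q) h) × HasEnd g v
  edgesOf-into [] v q h ne = ⊥-elim (ne refl)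
  edgesOf-into (x ∷ []) v q (e , h) ne = _ , here refl , endʳ (proj₂ (edge⁻ e))
  edgesOf-into (x ∷ x' ∷ p) v q (e , h) ne = let g , i , y = edgesOf-into (x' ∷ p) v q h (λ ()) in g , there i , y

  -- The edges of a cycle with a chord uv form a hole in which the chord has at least three neighbours.
  chord⇒wheel : ∀ {c u v} → E H u v → TwoArcs c u v → ⊥
  chord⇒wheel {c} {u} {v} uv record { m = [] ; m≢[] = ne } = ne refl
  chord⇒wheel {c} {u} {v} uv record { q = [] ; q≢[] = ne } = ne refl
  chord⇒wheel {c} {u} {v} uv record { m = m₀ ∷ m' ; q = q₀ ∷ q' ; uq = (au ∷ uq@(am ∷ uqL)) ; arc₁ = (e₀ , arc₁) ; arc₂ = arc₂ }
    with snoc-view q₀ q'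
  -- `g₀` and `gk` are the cycle edges at `u`, and the third edge is one at `v`; the chord `f` meets
  -- all three.
  ... | q'' , x , eqq = noW (Hole-wheel hole f∉ (here refl) g'∈L gk∈ (λ e → unique-≢ [ g₀ ] (Hole-uniq hole) (here refl) (∈-++⁺ˡ g'i) e)
        (~⇒≢ g₀gk) (unique-≢ (g₀ ∷ mids) (Hole-uniq hole) (there g'i) (here refl))
        (share~ (endˡ fE) (endˡ g₀E) (λ e → f∉ (here e))) (share~ (endʳ fE) g'v (λ e → f∉ (subst∈ (sym e) g'∈L))) (share~ (endˡ fE) (endʳ gkE) (λ e → f∉ (subst∈ (sym e) gk∈))))
    where
    L : List (Fin m)
    L = m' ++ v ∷ q''
    eqL : m₀ ∷ m' ++ v ∷ q₀ ∷ q' ≡ m₀ ∷ L ++ [ x ]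
    eqL = cong (m₀ ∷_) (trans (cong (λ l → m' ++ v ∷ l) eqq) (sym (++-assoc m' (v ∷ q'') [ x ])))
    cL : Consec (E H) (m₀ ∷ L ++ x ∷ u ∷ [])
    cL = subst (Consec (E H)) (cong (m₀ ∷_) (trans (cong (λ l → m' ++ v ∷ l) (trans (cong (_++ [ u ]) eqq) (++-assoc q'' [ x ] [ u ]))) (sym (++-assoc m' (v ∷ q'') (x ∷ u ∷ []))))) (consec-glue (m₀ ∷ m') arc₁ arc₂)
    cLx : Consec (E H) (m₀ ∷ L ++ [ x ])
    cLx = consec-++ˡ (m₀ ∷ L ++ [ x ]) (subst (Consec (E H)) (cong (m₀ ∷_) (sym (++-assoc L [ x ] [ u ]))) cL)
    g₀ : V
    g₀ = proj₁ (edge⁻ e₀)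
    g₀E : IsEdge g₀ u m₀
    g₀E = proj₂ (edge⁻ e₀)
    f : V
    f = proj₁ (edge⁻ uv)
    fE : IsEdge f u v
    fE = proj₂ (edge⁻ uv)
    mids : List V
    mids = edgesOf (m₀ ∷ L ++ [ x ]) cLx
    sn = edgesOf-snoc (m₀ ∷ L) cL cLx
    gk : V
    gk = proj₁ sn
    gkE : IsEdge gk x u
    gkE = proj₁ (proj₂ sn)
    unL : Unique (m₀ ∷ L ++ [ x ])
    unL = subst Unique eqL uq
    u∉L : u ∉ (m₀ ∷ L ++ [ x ])
    u∉L i = All.lookup au (cast∈ (sym eqL) i) refl
    x≢m₀ : x ≢ m₀
    x≢m₀ e = unique-≢ (m₀ ∷ L) unL (here refl) (here refl) (sym e)
    g₀gk : g₀ ~ gk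
    g₀gk = share~ (endˡ g₀E) (endʳ gkE) λ e → case ends g₀E (subst (λ g → HasEnd g x) (sym e) (endˡ gkE)) of λ { (inj₁ h) → u∉L (subst∈ h (∈-++⁺ʳ (m₀ ∷ L) (here refl))) ; (inj₂ h) → x≢m₀ h }
    hole : Hole g₀ mids gk
    hole = mkHole (edgesOf-IP (u ∷ m₀ ∷ L ++ [ x ]) (e₀ , cLx) (subst (λ l → Unique (u ∷ l)) eqL (au ∷ uq)))
      (subst IP (proj₂ (proj₂ sn)) (edgesOf-IP (m₀ ∷ L ++ x ∷ u ∷ []) cL (subst Unique (cong (m₀ ∷_) (++-assoc L [ x ] [ u ])) (UP.++⁺ unL ([] ∷ []) (λ { (i , here refl) → u∉L i }))))) g₀gk
    eqv : m₀ ∷ L ++ [ x ] ≡ (m₀ ∷ m') ++ v ∷ (q'' ++ [ x ])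
    eqv = cong (m₀ ∷_) (++-assoc m' (v ∷ q'') [ x ])
    into : Σ V λ g → (g ∈ mids) × HasEnd g v
    into = go (m₀ ∷ L ++ [ x ]) eqv cLx
      where
      go : ∀ l → l ≡ (m₀ ∷ m') ++ v ∷ (q'' ++ [ x ]) → (h : Consec (E H) l) → Σ V λ g → (g ∈ edgesOf l h) × HasEnd g v
      go l refl h = edgesOf-into (m₀ ∷ m') v (q'' ++ [ x ]) h (λ ())
    g'i = proj₁ (proj₂ into)
    g'v = proj₂ (proj₂ into)
    g'∈L : proj₁ into ∈ (g₀ ∷ mids ++ [ gk ])
    g'∈L = there (∈-++⁺ˡ g'i)
    gk∈ : gk ∈ (g₀ ∷ mids ++ [ gk ])
    gk∈ = there (∈-++⁺ʳ mids (here refl))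
    v∈L : v ∈ (m₀ ∷ L ++ [ x ])
    v∈L = cast∈ (sym eqv) (∈-++⁺ʳ (m₀ ∷ m') (here refl))
    v≢u : v ≢ u
    v≢u refl = u∉L v∈L
    f∉ : f ∉ (g₀ ∷ mids ++ [ gk ])
    f∉ (here e) with ends g₀E (subst (λ g → HasEnd g v) e (endʳ fE))
    ... | inj₁ h = v≢u h
    ... | inj₂ h = unique-≢ [ m₀ ] (subst Unique eqv unL) (here refl) (∈-++⁺ʳ m' (here refl)) (sym h)
    f∉ (there i) with ∈-++⁻ mids i
    ... | inj₁ j = u∉L (edgesOf-ends (m₀ ∷ L ++ [ x ]) cLx j (endˡ fE))
    ... | inj₂ (here e) with ends gkE (subst (λ g → HasEnd g v) e (endʳ fE))
    ... | inj₁ h = unique-≢ ((m₀ ∷ m') ++ [ v ]) (subst Unique (trans eqv (sym (++-assoc (m₀ ∷ m') [ v ] (q'' ++ [ x ])))) unL) (∈-++⁺ʳ (m₀ ∷ m') (here refl)) (∈-++⁺ʳ q'' (here refl)) h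
    ... | inj₂ h = v≢u h

  chordless : ChordlessGraph H
  chordless .(x ∷ rest) (x , rest , refl , _ , un , co) u v i j uv with chord-or-consec un co i j (~⇒≢ᴴ uv)
    where
    ~⇒≢ᴴ : ∀ {u v} → E H u v → u ≢ v
    ~⇒≢ᴴ {u} e refl with trans (sym e) (adj-irr H u)
    ... | ()
  ... | inj₁ h = h
  ... | inj₂ t = ⊥-elim (chord⇒wheel uv t)

-- Smallest subdivisions of K4 in triangle-free graphs

record K33 (G : Graph) : Set where
  field
    x y   : Fin 3 → Fin (n G)
    x-inj : ∀ {i j} → i ≢ j → x i ≢ x j
    y-inj : ∀ {i j} → i ≢ j → y i ≢ y j
    edge  : ∀ i j → E G (x i) (y j)

module Minimal (G : Graph) (noI : ¬ HasISK4 G) (noW : ¬ HasWheel G)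
  (noT : ∀ {x y z} → E G x y → E G x z → E G y z → ⊥) (noK : ¬ K33 G) where
  open Basics G
  open K4Subdivisions G
  open Multiset {V}
  open Count {n G}
  open Chords _~_

  -- Minimality: each lemma that follows takes this together with a subdivision on at most `N`
  -- vertices.
  Below : ℕ → Set
  Below N = ∀ {b₁ b₂ b₃ b₄ l₁₂ l₁₃ l₁₄ l₂₃ l₂₄ l₃₄} → K4At b₁ b₂ b₃ b₄ l₁₂ l₁₃ l₁₄ l₂₃ l₂₄ l₃₄ → length (verts b₁ b₂ b₃ b₄ l₁₂ l₁₃ l₁₄ l₂₃ l₂₄ l₃₄) < N → ⊥

  vertsE : ∀ {k} → (b₁ b₂ b₃ b₄ l₁₂ l₁₃ l₁₄ l₂₃ l₂₄ l₃₄ : Ex k) → Ex k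
  vertsE b₁ b₂ b₃ b₄ l₁₂ l₁₃ l₁₄ l₂₃ l₂₄ l₃₄ = b₁ ⊕ b₂ ⊕ b₃ ⊕ b₄ ⊕ l₁₂ ⊕ l₁₃ ⊕ l₁₄ ⊕ l₂₃ ⊕ l₂₄ ⊕ l₃₄ ⊕ ∅

  -- The new arrangement fits into the old one with a non-empty cell to spare.
  dropped : ∀ {k} (ρ : Vec (List V) k) new old {d : List V} (i : Fin k) → {_ : T (sub (flatten (new ⊕ var i)) (flatten old))} →
    lookup ρ i ≡ d → d ≢ [] → length (⟦ new ⟧ ρ) < length (⟦ old ⟧ ρ)
  dropped ρ new old i {t} eq ne with lookup ρ i | mono length-additive ρ (new ⊕ var i) old {t}
  dropped ρ new old i refl ne | [] | _ = ⊥-elim (ne refl)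
  dropped ρ new old i refl ne | x ∷ l | le = ≤-trans (≤-trans (≤-reflexive (+-comm 1 _)) (≤-trans (+-monoʳ-≤ _ (s≤s z≤n)) (≤-reflexive (sym (length-++ (⟦ new ⟧ ρ)))))) le

  link-[] : ∀ {x l y} → Link x l y → ¬ (l ≢ []) → x ~ y
  link-[] {l = []} (e , _) h = e
  link-[] {l = _ ∷ _} _ h = ⊥-elim (h λ ())

  σ₁₂ : ∀ {b₁ b₂ b₃ b₄ l₁₂ l₁₃ l₁₄ l₂₃ l₂₄ l₃₄} → K4At b₁ b₂ b₃ b₄ l₁₂ l₁₃ l₁₄ l₂₃ l₂₄ l₃₄ → K4At b₂ b₁ b₃ b₄ (reverse l₁₂) l₂₃ l₂₄ l₁₃ l₁₄ l₃₄
  σ₁₂ {b₁} {b₂} {b₃} {b₄} {l₁₂} {l₁₃} {l₁₄} {l₂₃} {l₂₄} {l₃₄} (mkK4 k₁₂ k₁₃ k₁₄ k₂₃ k₂₄ k₃₄ uq) = mkK4 (link-rev l₁₂ k₁₂) k₂₃ k₂₄ k₁₃ k₁₄ k₃₄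
    λ x → ≤-trans (mono (cnt-additive x) (cells b₁ b₂ b₃ b₄ l₁₂ l₁₃ l₁₄ l₂₃ l₂₄ l₃₄)
      (vertsE (var 1F) (var 0F) (var 2F) (var 3F) (rv (var 4F)) (var 7F) (var 8F) (var 5F) (var 6F) (var 9F)) all10) (uq x)

  σ₂₃ : ∀ {b₁ b₂ b₃ b₄ l₁₂ l₁₃ l₁₄ l₂₃ l₂₄ l₃₄} → K4At b₁ b₂ b₃ b₄ l₁₂ l₁₃ l₁₄ l₂₃ l₂₄ l₃₄ → K4At b₁ b₃ b₂ b₄ l₁₃ l₁₂ l₁₄ (reverse l₂₃) l₃₄ l₂₄
  σ₂₃ {b₁} {b₂} {b₃} {b₄} {l₁₂} {l₁₃} {l₁₄} {l₂₃} {l₂₄} {l₃₄} (mkK4 k₁₂ k₁₃ k₁₄ k₂₃ k₂₄ k₃₄ uq) = mkK4 k₁₃ k₁₂ k₁₄ (link-rev l₂₃ k₂₃) k₃₄ k₂₄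
    λ x → ≤-trans (mono (cnt-additive x) (cells b₁ b₂ b₃ b₄ l₁₂ l₁₃ l₁₄ l₂₃ l₂₄ l₃₄)
      (vertsE (var 0F) (var 2F) (var 1F) (var 3F) (var 5F) (var 4F) (var 6F) (rv (var 7F)) (var 9F) (var 8F)) all10) (uq x)

  σ₂₃-size : ∀ {b₁ b₂ b₃ b₄} l₁₂ l₁₃ l₁₄ l₂₃ l₂₄ l₃₄ → length (verts b₁ b₃ b₂ b₄ l₁₃ l₁₂ l₁₄ (reverse l₂₃) l₃₄ l₂₄) ≤ length (verts b₁ b₂ b₃ b₄ l₁₂ l₁₃ l₁₄ l₂₃ l₂₄ l₃₄)
  σ₂₃-size {b₁} {b₂} {b₃} {b₄} l₁₂ l₁₃ l₁₄ l₂₃ l₂₄ l₃₄ = mono length-additive (cells b₁ b₂ b₃ b₄ l₁₂ l₁₃ l₁₄ l₂₃ l₂₄ l₃₄)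
      (vertsE (var 0F) (var 2F) (var 1F) (var 3F) (var 5F) (var 4F) (var 6F) (rv (var 7F)) (var 9F) (var 8F)) all10

  σ₁₂-size : ∀ {b₁ b₂ b₃ b₄} l₁₂ l₁₃ l₁₄ l₂₃ l₂₄ l₃₄ → length (verts b₂ b₁ b₃ b₄ (reverse l₁₂) l₂₃ l₂₄ l₁₃ l₁₄ l₃₄) ≤ length (verts b₁ b₂ b₃ b₄ l₁₂ l₁₃ l₁₄ l₂₃ l₂₄ l₃₄)
  σ₁₂-size {b₁} {b₂} {b₃} {b₄} l₁₂ l₁₃ l₁₄ l₂₃ l₂₄ l₃₄ = mono length-additive (cells b₁ b₂ b₃ b₄ l₁₂ l₁₃ l₁₄ l₂₃ l₂₄ l₃₄)
      (vertsE (var 1F) (var 0F) (var 2F) (var 3F) (rv (var 4F)) (var 7F) (var 8F) (var 5F) (var 6F) (var 9F)) all10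

  -- chord between two paths with a common end: the part of the first path between that end and the chord is superfluous
  superfluous-part : ∀ {N b₁ b₂ b₃ b₄} A {u} B C {w} D {l₁₄ l₂₃ l₂₄ l₃₄} → Below N → K4At b₁ b₂ b₃ b₄ (A ++ u ∷ B) (C ++ w ∷ D) l₁₄ l₂₃ l₂₄ l₃₄ →
    length (verts b₁ b₂ b₃ b₄ (A ++ u ∷ B) (C ++ w ∷ D) l₁₄ l₂₃ l₂₄ l₃₄) ≤ N → u ~ w → ¬ (A ≢ [])
  superfluous-part {N} {b₁} {b₂} {b₃} {b₄} A {u} B C {w} D {l₁₄} {l₂₃} {l₂₄} {l₃₄} IH (mkK4 k₁₂ k₁₃ k₁₄ k₂₃ k₂₄ k₃₄ uq) sz uw ne =
      -- `w` takes over from `b₁`: it reaches `b₂` over the chord, `b₃` directly and `b₄` back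
      -- through `b₁`.
      IH (mkK4 (~-sym uw , proj₂ (link-split A k₁₂)) (proj₂ (link-split C k₁₃)) (link-join (reverse C) (link-rev C (proj₁ (link-split C k₁₃))) k₁₄) k₂₃ k₂₄ k₃₄
        (λ x → ≤-trans (mono (cnt-additive x) ρ new old) (uq x))) (≤-trans (dropped ρ new old 4F refl ne) sz)
    where
    ρ : Vec (List V) 14
    ρ = [ b₁ ] ∷ [ b₂ ] ∷ [ b₃ ] ∷ [ b₄ ] ∷ A ∷ [ u ] ∷ B ∷ C ∷ [ w ] ∷ D ∷ l₁₄ ∷ l₂₃ ∷ l₂₄ ∷ l₃₄ ∷ []
    v = var {14}
    new old : Ex 14
    new = vertsE (v 8F) (v 1F) (v 2F) (v 3F) (v 5F ⊕ v 6F) (v 9F) (rv (v 7F) ⊕ v 0F ⊕ v (suc 9F)) (v (suc (suc 9F))) (v (suc (suc (suc 9F)))) (v (suc (suc (suc (suc 9F)))))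
    old = vertsE (v 0F) (v 1F) (v 2F) (v 3F) (v 4F ⊕ v 5F ⊕ v 6F) (v 7F ⊕ v 8F ⊕ v 9F) (v (suc 9F)) (v (suc (suc 9F))) (v (suc (suc (suc 9F)))) (v (suc (suc (suc (suc 9F)))))

  adjacent-paths-chord : ∀ {N b₁ b₂ b₃ b₄ l₁₂ l₁₃ l₁₄ l₂₃ l₂₄ l₃₄ u w} → Below N → K4At b₁ b₂ b₃ b₄ l₁₂ l₁₃ l₁₄ l₂₃ l₂₄ l₃₄ →
    length (verts b₁ b₂ b₃ b₄ l₁₂ l₁₃ l₁₄ l₂₃ l₂₄ l₃₄) ≤ N → u ∈ l₁₂ → w ∈ l₁₃ → u ~ w → ⊥
  adjacent-paths-chord {b₁ = b₁} {b₂} {b₃} {b₄} {l₁₄ = l₁₄} {l₂₃} {l₂₄} {l₃₄} {u} {w} IH K sz i j uw with ∈-∃++ i | ∈-∃++ j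
  ... | A , B , refl | C , D , refl = noT (link-[] (proj₁ (link-split A (K4At.k₁₂ K))) (superfluous-part A B C D IH K sz uw))
        (link-[] (proj₁ (link-split C (K4At.k₁₃ K))) (superfluous-part C D A B IH (σ₂₃ K) (≤-trans (σ₂₃-size {b₁} {b₂} {b₃} {b₄} (A ++ u ∷ B) (C ++ w ∷ D) l₁₄ l₂₃ l₂₄ l₃₄) sz) (~-sym uw))) uw

  record K33At (x₁ x₂ x₃ y₁ y₂ y₃ : V) (a₁ a₂ a₃ b₁ b₂ b₃ c₁ c₂ c₃ : List V) : Set where
    constructor mkK33
    field
      ka₁ : Link x₁ a₁ y₁
      ka₂ : Link x₁ a₂ y₂
      ka₃ : Link x₁ a₃ y₃
      kb₁ : Link x₂ b₁ y₁
      kb₂ : Link x₂ b₂ y₂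
      kb₃ : Link x₂ b₃ y₃
      kc₁ : Link x₃ c₁ y₁
      kc₂ : Link x₃ c₂ y₂
      kc₃ : Link x₃ c₃ y₃
    vs : List V
    vs = x₁ ∷ x₂ ∷ x₃ ∷ y₁ ∷ y₂ ∷ y₃ ∷ a₁ ++ a₂ ++ a₃ ++ b₁ ++ b₂ ++ b₃ ++ c₁ ++ c₂ ++ c₃
    field
      uq : ∀ x → cnt x vs ≤ 1

  module _ {x₁ x₂ x₃ y₁ y₂ y₃ : V} {a₁ a₂ a₃ b₁ b₂ b₃ c₁ c₂ c₃ : List V} where
    private
      ρ : Vec (List V) 15
      ρ = [ x₁ ] ∷ [ x₂ ] ∷ [ x₃ ] ∷ [ y₁ ] ∷ [ y₂ ] ∷ [ y₃ ] ∷ a₁ ∷ a₂ ∷ a₃ ∷ b₁ ∷ b₂ ∷ b₃ ∷ c₁ ∷ c₂ ∷ c₃ ∷ []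
      X₁ X₂ X₃ Y₁ Y₂ Y₃ A₁ A₂ A₃ B₁ B₂ B₃ C₁ C₂ C₃ : Ex 15
      X₁ = var 0F
      X₂ = var 1F
      X₃ = var 2F
      Y₁ = var 3F
      Y₂ = var 4F
      Y₃ = var 5F
      A₁ = var 6F
      A₂ = var 7F
      A₃ = var 8F
      B₁ = var 9F
      B₂ = var (suc 9F)
      B₃ = var (suc (suc 9F))
      C₁ = var (suc (suc (suc 9F)))
      C₂ = var (suc (suc (suc (suc 9F))))
      C₃ = var (suc (suc (suc (suc (suc 9F)))))
      old : Ex 15
      old = X₁ ⊕ X₂ ⊕ X₃ ⊕ Y₁ ⊕ Y₂ ⊕ Y₃ ⊕ A₁ ⊕ A₂ ⊕ A₃ ⊕ B₁ ⊕ B₂ ⊕ B₃ ⊕ C₁ ⊕ C₂ ⊕ C₃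

    -- K3,3 minus an edge is a subdivided K4 with branch vertices `x₂`, `x₃`, `y₂`, `y₃`; the two
    -- remaining vertices subdivide opposite edges.
    drop₁₁ : ∀ {N} → Below N → (K : K33At x₁ x₂ x₃ y₁ y₂ y₃ a₁ a₂ a₃ b₁ b₂ b₃ c₁ c₂ c₃) → length (K33At.vs K) ≤ N → ¬ (a₁ ≢ [])
    drop₁₁ IH K sz ne = IH {x₂} {x₃} {y₂} {y₃} {b₁ ++ y₁ ∷ reverse c₁} {b₂} {b₃} {c₂} {c₃} {reverse a₂ ++ x₁ ∷ a₃}
        (mkK4 (link-join b₁ kb₁ (link-rev c₁ kc₁)) kb₂ kb₃ kc₂ kc₃ (link-join (reverse a₂) (link-rev a₂ ka₂) ka₃)
          (λ x → ≤-trans (mono (cnt-additive x) ρ new old) (uq x))) (≤-trans (dropped ρ new old 6F refl ne) sz)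
      where
      open K33At K
      new : Ex 15
      new = vertsE X₂ X₃ Y₂ Y₃ (B₁ ⊕ Y₁ ⊕ rv C₁) B₂ B₃ C₂ C₃ (rv A₂ ⊕ X₁ ⊕ A₃)

    row₁₂ : (K : K33At x₁ x₂ x₃ y₁ y₂ y₃ a₁ a₂ a₃ b₁ b₂ b₃ c₁ c₂ c₃) → Σ (K33At x₂ x₁ x₃ y₁ y₂ y₃ b₁ b₂ b₃ a₁ a₂ a₃ c₁ c₂ c₃) λ K' → length (K33At.vs K') ≤ length (K33At.vs K)
    row₁₂ K = mkK33 kb₁ kb₂ kb₃ ka₁ ka₂ ka₃ kc₁ kc₂ kc₃ (λ x → ≤-trans (mono (cnt-additive x) ρ new old) (uq x)) , mono length-additive ρ new old
      where
      open K33At K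
      new : Ex 15
      new = X₂ ⊕ X₁ ⊕ X₃ ⊕ Y₁ ⊕ Y₂ ⊕ Y₃ ⊕ B₁ ⊕ B₂ ⊕ B₃ ⊕ A₁ ⊕ A₂ ⊕ A₃ ⊕ C₁ ⊕ C₂ ⊕ C₃

    row₁₃ : (K : K33At x₁ x₂ x₃ y₁ y₂ y₃ a₁ a₂ a₃ b₁ b₂ b₃ c₁ c₂ c₃) → Σ (K33At x₃ x₂ x₁ y₁ y₂ y₃ c₁ c₂ c₃ b₁ b₂ b₃ a₁ a₂ a₃) λ K' → length (K33At.vs K') ≤ length (K33At.vs K)
    row₁₃ K = mkK33 kc₁ kc₂ kc₃ kb₁ kb₂ kb₃ ka₁ ka₂ ka₃ (λ x → ≤-trans (mono (cnt-additive x) ρ new old) (uq x)) , mono length-additive ρ new old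
      where
      open K33At K
      new : Ex 15
      new = X₃ ⊕ X₂ ⊕ X₁ ⊕ Y₁ ⊕ Y₂ ⊕ Y₃ ⊕ C₁ ⊕ C₂ ⊕ C₃ ⊕ B₁ ⊕ B₂ ⊕ B₃ ⊕ A₁ ⊕ A₂ ⊕ A₃

    col₁₂ : (K : K33At x₁ x₂ x₃ y₁ y₂ y₃ a₁ a₂ a₃ b₁ b₂ b₃ c₁ c₂ c₃) → Σ (K33At x₁ x₂ x₃ y₂ y₁ y₃ a₂ a₁ a₃ b₂ b₁ b₃ c₂ c₁ c₃) λ K' → length (K33At.vs K') ≤ length (K33At.vs K)
    col₁₂ K = mkK33 ka₂ ka₁ ka₃ kb₂ kb₁ kb₃ kc₂ kc₁ kc₃ (λ x → ≤-trans (mono (cnt-additive x) ρ new old) (uq x)) , mono length-additive ρ new old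
      where
      open K33At K
      new : Ex 15
      new = X₁ ⊕ X₂ ⊕ X₃ ⊕ Y₂ ⊕ Y₁ ⊕ Y₃ ⊕ A₂ ⊕ A₁ ⊕ A₃ ⊕ B₂ ⊕ B₁ ⊕ B₃ ⊕ C₂ ⊕ C₁ ⊕ C₃

    col₁₃ : (K : K33At x₁ x₂ x₃ y₁ y₂ y₃ a₁ a₂ a₃ b₁ b₂ b₃ c₁ c₂ c₃) → Σ (K33At x₁ x₂ x₃ y₃ y₂ y₁ a₃ a₂ a₁ b₃ b₂ b₁ c₃ c₂ c₁) λ K' → length (K33At.vs K') ≤ length (K33At.vs K)
    col₁₃ K = mkK33 ka₃ ka₂ ka₁ kb₃ kb₂ kb₁ kc₃ kc₂ kc₁ (λ x → ≤-trans (mono (cnt-additive x) ρ new old) (uq x)) , mono length-additive ρ new old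
      where
      open K33At K
      new : Ex 15
      new = X₁ ⊕ X₂ ⊕ X₃ ⊕ Y₃ ⊕ Y₂ ⊕ Y₁ ⊕ A₃ ⊕ A₂ ⊕ A₁ ⊕ B₃ ⊕ B₂ ⊕ B₁ ⊕ C₃ ⊕ C₂ ⊕ C₁

  top-row : ∀ {N x₁ x₂ x₃ y₁ y₂ y₃ a₁ a₂ a₃ b₁ b₂ b₃ c₁ c₂ c₃} → Below N → (K : K33At x₁ x₂ x₃ y₁ y₂ y₃ a₁ a₂ a₃ b₁ b₂ b₃ c₁ c₂ c₃) → length (K33At.vs K) ≤ N →
    (x₁ ~ y₁) × (x₁ ~ y₂) × (x₁ ~ y₃)
  top-row IH K sz = link-[] (K33At.ka₁ K) (drop₁₁ IH K sz) ,
    link-[] (K33At.ka₂ K) (drop₁₁ IH (proj₁ (col₁₂ K)) (≤-trans (proj₂ (col₁₂ K)) sz)) ,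
    link-[] (K33At.ka₃ K) (drop₁₁ IH (proj₁ (col₁₃ K)) (≤-trans (proj₂ (col₁₃ K)) sz))

  K33At-⊥ : ∀ {N x₁ x₂ x₃ y₁ y₂ y₃ a₁ a₂ a₃ b₁ b₂ b₃ c₁ c₂ c₃} → Below N → (K : K33At x₁ x₂ x₃ y₁ y₂ y₃ a₁ a₂ a₃ b₁ b₂ b₃ c₁ c₂ c₃) → length (K33At.vs K) ≤ N → ⊥
  K33At-⊥ {N} {x₁} {x₂} {x₃} {y₁} {y₂} {y₃} IH K sz = noK record { x = x ; y = y ; x-inj = λ {i} {j} → x-inj i j ; y-inj = λ {i} {j} → y-inj i j ; edge = edge }
    where
    u6 : Unique (K33At.vs K)
    u6 = cnt≤1⇒Unique (K33At.uq K)
    x y : Fin 3 → V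
    x = lookup (x₁ ∷ x₂ ∷ x₃ ∷ [])
    y = lookup (y₁ ∷ y₂ ∷ y₃ ∷ [])
    x-inj : ∀ i j → i ≢ j → x i ≢ x j
    x-inj 0F 0F ne = ⊥-elim (ne refl)
    x-inj 1F 1F ne = ⊥-elim (ne refl)
    x-inj 2F 2F ne = ⊥-elim (ne refl)
    x-inj 0F 1F _ = unique-≢ [ x₁ ] u6 (here refl) (here refl)
    x-inj 0F 2F _ = unique-≢ [ x₁ ] u6 (here refl) (there (here refl))
    x-inj 1F 2F _ = unique-≢ (x₁ ∷ x₂ ∷ []) u6 (there (here refl)) (here refl)
    x-inj 1F 0F _ = ≢-sym (x-inj 0F 1F λ ())
    x-inj 2F 0F _ = ≢-sym (x-inj 0F 2F λ ())
    x-inj 2F 1F _ = ≢-sym (x-inj 1F 2F λ ())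
    u3 : Unique (y₁ ∷ y₂ ∷ y₃ ∷ _)
    u3 = unique-++ʳ (x₁ ∷ x₂ ∷ x₃ ∷ []) u6
    y-inj : ∀ i j → i ≢ j → y i ≢ y j
    y-inj 0F 0F ne = ⊥-elim (ne refl)
    y-inj 1F 1F ne = ⊥-elim (ne refl)
    y-inj 2F 2F ne = ⊥-elim (ne refl)
    y-inj 0F 1F _ = unique-≢ [ y₁ ] u3 (here refl) (here refl)
    y-inj 0F 2F _ = unique-≢ [ y₁ ] u3 (here refl) (there (here refl))
    y-inj 1F 2F _ = unique-≢ (y₁ ∷ y₂ ∷ []) u3 (there (here refl)) (here refl)
    y-inj 1F 0F _ = ≢-sym (y-inj 0F 1F λ ())
    y-inj 2F 0F _ = ≢-sym (y-inj 0F 2F λ ())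
    y-inj 2F 1F _ = ≢-sym (y-inj 1F 2F λ ())
    r₁ = top-row IH K sz
    r₂ = top-row IH (proj₁ (row₁₂ K)) (≤-trans (proj₂ (row₁₂ K)) sz)
    r₃ = top-row IH (proj₁ (row₁₃ K)) (≤-trans (proj₂ (row₁₃ K)) sz)
    pick : ∀ {z} → (z ~ y₁) × (z ~ y₂) × (z ~ y₃) → ∀ j → z ~ y j
    pick (p , q , r) 0F = p
    pick (p , q , r) 1F = q
    pick (p , q , r) 2F = r
    edge : ∀ i j → x i ~ y j
    edge 0F j = pick r₁ j
    edge 1F j = pick r₂ j
    edge 2F j = pick r₃ j

  -- On the same vertices, `b₁ b₂ w` and `b₃ b₄ u` are the sides of a subdivided K3,3 in which the
  -- chord is one of the paths.
  opposite-paths-chord : ∀ {N b₁ b₂ b₃ b₄ l₁₂ l₁₃ l₁₄ l₂₃ l₂₄ l₃₄ u w} → Below N → K4At b₁ b₂ b₃ b₄ l₁₂ l₁₃ l₁₄ l₂₃ l₂₄ l₃₄ →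
    length (verts b₁ b₂ b₃ b₄ l₁₂ l₁₃ l₁₄ l₂₃ l₂₄ l₃₄) ≤ N → u ∈ l₁₂ → w ∈ l₃₄ → u ~ w → ⊥
  opposite-paths-chord {N} {b₁} {b₂} {b₃} {b₄} {l₁₃ = l₁₃} {l₁₄} {l₂₃} {l₂₄} {u = u} {w} IH K sz i j uw with ∈-∃++ i | ∈-∃++ j
  ... | A , B , refl | C , D , refl = K33At-⊥ {x₁ = b₁} {b₂} {w} {b₃} {b₄} {u} {l₁₃} {l₁₄} {A} {l₂₃} {l₂₄} {reverse B} {reverse C} {D} {[]} IH
        (mkK33 k₁₃ k₁₄ (proj₁ (link-split A k₁₂)) k₂₃ k₂₄ (link-rev B (proj₂ (link-split A k₁₂))) (link-rev C (proj₁ (link-split C k₃₄))) (proj₂ (link-split C k₃₄)) (~-sym uw , tt)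
          (λ x → ≤-trans (mono (cnt-additive x) ρ new old) (uq x)))
        (≤-trans (mono length-additive ρ new old) sz)
    where
    open K4At K
    ρ : Vec (List V) 14
    ρ = [ b₁ ] ∷ [ b₂ ] ∷ [ b₃ ] ∷ [ b₄ ] ∷ A ∷ [ u ] ∷ B ∷ C ∷ [ w ] ∷ D ∷ l₁₃ ∷ l₁₄ ∷ l₂₃ ∷ l₂₄ ∷ []
    v = var {14}
    L₁₃ L₁₄ L₂₃ L₂₄ new old : Ex 14
    L₁₃ = v (suc 9F)
    L₁₄ = v (suc (suc 9F))
    L₂₃ = v (suc (suc (suc 9F)))
    L₂₄ = v (suc (suc (suc (suc 9F))))
    new = v 0F ⊕ v 1F ⊕ v 8F ⊕ v 2F ⊕ v 3F ⊕ v 5F ⊕ L₁₃ ⊕ L₁₄ ⊕ v 4F ⊕ L₂₃ ⊕ L₂₄ ⊕ rv (v 6F) ⊕ rv (v 7F) ⊕ v 9F ⊕ ∅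
    old = vertsE (v 0F) (v 1F) (v 2F) (v 3F) (v 4F ⊕ v 5F ⊕ v 6F) L₁₃ L₁₄ L₂₃ L₂₄ (v 7F ⊕ v 8F ⊕ v 9F)

  nb : V → List V → ℕ
  nb h l = length (filterᵇ (adj G h) l)

  nb-++ : ∀ h l l' → nb h (l ++ l') ≡ nb h l + nb h l'
  nb-++ h [] l' = refl
  nb-++ h (x ∷ l) l' with adj G h x
  ... | true = cong suc (nb-++ h l l')
  ... | false = nb-++ h l l'

  nb-∷ : ∀ {h x l} → h ~ x → nb h (x ∷ l) ≡ suc (nb h l)
  nb-∷ {h} {x} e with adj G h x
  nb-∷ refl | true = refl

  nb-∈ : ∀ {h x l} → x ∈ l → h ~ x → 1 ≤ nb h l
  nb-∈ {h} i e = ∈-length (∈-filterᵇ⁺ (adj G h) i e)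

  pick-nb : ∀ {h k} l → suc k ≤ nb h l → Σ (List V) λ p → Σ V λ y → Σ (List V) λ q → (l ≡ p ++ y ∷ q) × (h ~ y) × (k ≤ nb h q)
  pick-nb {h} (x ∷ l) le with adj G h x in e
  pick-nb {h} (x ∷ l) (s≤s le) | true = [] , x , l , refl , e , le
  ... | false = let p , y , q , eq , hy , k = pick-nb l le in x ∷ p , y , q , cong (x ∷_) eq , hy , k

  wrap : ∀ p {x r y s z t} → x ∷ r ≡ p ++ y ∷ s ++ z ∷ t → Consec _~_ ((x ∷ r) ++ [ x ]) → Link z (t ++ p) y
  wrap [] {y = y} {s} {z} {t} refl co = subst (λ l → Link z l y) (sym (++-identityʳ t)) (consec-++ʳ (y ∷ s) (subst (Consec _~_) (cong (y ∷_) (++-assoc s (z ∷ t) [ y ])) co))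
  wrap (x ∷ p) {y = y} {s} {z} {t} refl co = link-join t
      (consec-++ʳ (x ∷ p ++ y ∷ s) (subst (Consec _~_) (cong (x ∷_) (trans (++-assoc p (y ∷ s ++ z ∷ t) [ x ]) (trans (cong (λ l → p ++ y ∷ l) (++-assoc s (z ∷ t) [ x ])) (sym (++-assoc p (y ∷ s) (z ∷ t ++ [ x ])))))) co))
      (consec-++ˡ (x ∷ p ++ [ y ]) (subst (Consec _~_) (cong (x ∷_) (trans (++-assoc p (y ∷ s ++ z ∷ t) [ x ]) (sym (++-assoc p [ y ] ((s ++ z ∷ t) ++ [ x ]))))) co))

  link-in : ∀ p {x r y s z t} → x ∷ r ≡ p ++ y ∷ s ++ z ∷ t → Consec _~_ ((x ∷ r) ++ [ x ]) → Link y s z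
  link-in p {x} {y = y} {s} {z} {t} e co = consec-++ˡ (y ∷ s ++ [ z ]) {t ++ [ x ]} (consec-++ʳ p (subst (Consec _~_)
    (trans (cong (_++ [ x ]) e) (trans (++-assoc p (y ∷ s ++ z ∷ t) [ x ]) (cong (λ l → p ++ y ∷ l) (trans (++-assoc s (z ∷ t) [ x ]) (sym (++-assoc s [ z ] (t ++ [ x ]))))))) co))

  -- A cycle, chordless or not, with a vertex that has three neighbours on it contains a subdivision
  -- of K4; `2 + length r` is the number of vertices involved.
  three-nbrs : ∀ {N h x r} → Below N → Unique (h ∷ x ∷ r) → Consec _~_ ((x ∷ r) ++ [ x ]) → 3 ≤ nb h (x ∷ r) → 2 + length r < N → ⊥
  three-nbrs {N} {h} {x} {r} IH un co le sz with pick-nb (x ∷ r) le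
  ... | p₁ , n₁ , D₁ , e₁ , h₁ , le₁ with pick-nb D₁ le₁
  ... | p₂ , n₂ , D₂ , refl , h₂ , le₂ with pick-nb D₂ le₂
  ... | p₃ , n₃ , p₄ , refl , h₃ , _ = IH {h} {n₁} {n₂} {n₃} {[]} {[]} {[]} {p₂} {reverse (p₄ ++ p₁)} {p₃}
        (mkK4 (h₁ , tt) (h₂ , tt) (h₃ , tt) (link-in p₁ e₁ co) (link-rev (p₄ ++ p₁) (wrap p₁ {s = p₂ ++ n₂ ∷ p₃} (trans e₁ (cong (λ l → p₁ ++ n₁ ∷ l) (sym (++-assoc p₂ (n₂ ∷ p₃) (n₃ ∷ p₄))))) co))
          (link-in (p₁ ++ n₁ ∷ p₂) (trans e₁ (sym (++-assoc p₁ (n₁ ∷ p₂) (n₂ ∷ p₃ ++ n₃ ∷ p₄)))) co)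
          (λ z → ≤-trans (mono (cnt-additive z) ρ new old) (subst (λ l → cnt z (h ∷ l) ≤ 1) e₁ (Unique⇒cnt≤1 un z))))
        (≤-trans (s≤s (≤-trans (mono length-additive ρ new old) (≤-reflexive (cong (suc ∘ length) (sym e₁))))) sz)
    where
    ρ : Vec (List V) 8
    ρ = [ h ] ∷ [ n₁ ] ∷ [ n₂ ] ∷ [ n₃ ] ∷ p₁ ∷ p₂ ∷ p₃ ∷ p₄ ∷ []
    v = var {8}
    new old : Ex 8
    new = vertsE (v 0F) (v 1F) (v 2F) (v 3F) ∅ ∅ ∅ (v 5F) (rv (v 7F ⊕ v 4F)) (v 6F)
    old = v 0F ⊕ (v 4F ⊕ v 1F ⊕ v 5F ⊕ v 2F ⊕ v 6F ⊕ v 3F ⊕ v 7F)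

  nonempty-length : ∀ {l : List V} → l ≢ [] → 1 ≤ length l
  nonempty-length {[]} ne = ⊥-elim (ne refl)
  nonempty-length {_ ∷ _} ne = s≤s z≤n

  hub-two-each-side : ∀ {N h u m v q} → Below N → (∀ z → cnt z (h ∷ u ∷ m ++ v ∷ q) ≤ 1) → length (h ∷ u ∷ m ++ v ∷ q) ≤ N → u ~ v →
    Link u m v → Link v q u → 2 ≤ nb h m → 2 ≤ nb h q → ⊥
  hub-two-each-side {N} {h} {u} {m} {v} {q} IH cnt-all size uv arc₁ arc₂ nm nq with pick-nb m nm | pick-nb q nq
  ... | m₁ , n₁ , D , refl , h₁ , le₁ | q₁ , n₃ , q₂ , refl , h₃ , le₃ with pick-nb D le₁
  ... | m₂ , n₂ , m₃ , refl , h₂ , _ = IH {h} {n₁} {n₂} {v} {[]} {[]} {n₃ ∷ reverse q₁} {m₂} {reverse m₁ ++ u ∷ []} {m₃}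
        (mkK4 (h₁ , tt) (h₂ , tt) (h₃ , link-rev q₁ (proj₁ (link-split q₁ arc₂))) (proj₁ (link-split m₂ tailm)) (link-join (reverse m₁) (link-rev m₁ (proj₁ (link-split m₁ arc₁))) (uv , tt)) (proj₂ (link-split m₂ tailm))
          (λ z → ≤-trans (mono (cnt-additive z) ρ new old) (cnt-all z)))
        (≤-trans (dropped ρ new old (suc 9F) refl λ { refl → case le₃ of λ () }) size)
    where
    tailm : Link n₁ (m₂ ++ n₂ ∷ m₃) v
    tailm = proj₂ (link-split m₁ arc₁)
    ρ : Vec (List V) 11
    ρ = [ h ] ∷ [ u ] ∷ [ v ] ∷ [ n₁ ] ∷ [ n₂ ] ∷ [ n₃ ] ∷ m₁ ∷ m₂ ∷ m₃ ∷ q₁ ∷ q₂ ∷ []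
    w = var {11}
    new old : Ex 11
    new = vertsE (w 0F) (w 3F) (w 4F) (w 2F) ∅ ∅ (w 5F ⊕ rv (w 9F)) (w 7F) (rv (w 6F) ⊕ w 1F) (w 8F)
    old = w 0F ⊕ w 1F ⊕ (w 6F ⊕ w 3F ⊕ w 7F ⊕ w 4F ⊕ w 8F) ⊕ w 2F ⊕ w 9F ⊕ w 5F ⊕ w (suc 9F)

  -- If an arc together with `u` and `v` contains three neighbours of `h`, the chord closes it to a
  -- smaller wheel-like subdivision. Otherwise each closed arc has at most two of the four, so each
  -- open arc has at least two.
  hub-chord : ∀ {N h c u v} → Below N → Unique (h ∷ c) → suc (length c) ≤ N → 4 ≤ nb h c → u ~ v → TwoArcs c u v → ⊥
  hub-chord {N} {h} {c} {u} {v} IH un sz le uv record { m = m ; q = q ; m≢[] = m≢ ; q≢[] = q≢ ; uq = uq ; arc₁ = arc₁ ; arc₂ = arc₂ ; meas = meas }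
    = go (3 ≤? nb h (u ∷ m ++ [ v ])) (3 ≤? nb h (v ∷ q ++ [ u ]))
    where
    ρ : Vec (List V) 5
    ρ = [ h ] ∷ [ u ] ∷ m ∷ [ v ] ∷ q ∷ []
    H U M W Q : Ex 5
    H = var 0F
    U = var 1F
    M = var 2F
    W = var 3F
    Q = var 4F
    cnt-all : ∀ z → cnt z (h ∷ u ∷ m ++ v ∷ q) ≤ 1
    cnt-all z = ≤-trans (≤-reflexive (cong (δ z h +_) (meas (cnt z) (cnt-++ z)))) (Unique⇒cnt≤1 un z)
    size : suc (length (u ∷ m ++ v ∷ q)) ≤ N
    size = ≤-trans (≤-reflexive (cong suc (meas length (λ l _ → length-++ l)))) sz
    total4 : 4 ≤ nb h (u ∷ m ++ v ∷ q)
    total4 = ≤-trans le (≤-reflexive (sym (meas (nb h) (nb-++ h))))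
    rest : ∀ {a b} → 4 ≤ a + b → ¬ (3 ≤ a) → 2 ≤ b
    rest {0} {suc (suc b)} _ _ = s≤s (s≤s z≤n)
    rest {0} {1} (s≤s ()) _
    rest {1} {suc (suc b)} _ _ = s≤s (s≤s z≤n)
    rest {1} {1} (s≤s (s≤s ())) _
    rest {1} {0} (s≤s ()) _
    rest {2} {suc (suc b)} _ _ = s≤s (s≤s z≤n)
    rest {2} {1} (s≤s (s≤s (s≤s ()))) _
    rest {2} {0} (s≤s (s≤s ())) _
    rest {suc (suc (suc a))} _ h = ⊥-elim (h (s≤s (s≤s (s≤s z≤n))))
    go : Dec (3 ≤ nb h (u ∷ m ++ [ v ])) → Dec (3 ≤ nb h (v ∷ q ++ [ u ])) → ⊥
    go (yes le₁) _ = three-nbrs IH (cnt≤1⇒Unique λ z → ≤-trans (mono (cnt-additive z) ρ (H ⊕ U ⊕ M ⊕ W) (H ⊕ U ⊕ M ⊕ W ⊕ Q)) (cnt-all z)) (Consec-snoc (u ∷ m) arc₁ (~-sym uv)) le₁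
        (≤-trans (s≤s (dropped ρ (U ⊕ M ⊕ W) (U ⊕ M ⊕ W ⊕ Q) 4F refl q≢)) size)
    go (no _) (yes le₂) = three-nbrs IH (cnt≤1⇒Unique λ z → ≤-trans (mono (cnt-additive z) ρ (H ⊕ W ⊕ Q ⊕ U) (H ⊕ U ⊕ M ⊕ W ⊕ Q)) (cnt-all z)) (Consec-snoc (v ∷ q) arc₂ uv) le₂
        (≤-trans (s≤s (dropped ρ (W ⊕ Q ⊕ U) (U ⊕ M ⊕ W ⊕ Q) 2F refl m≢)) size)
    go (no nle₁) (no nle₂) = hub-two-each-side IH cnt-all size uv arc₁ arc₂
      (rest (≤-trans total4 (≤-reflexive (trans (meas-rot (nb h) (nb-++ h) (v ∷ q) (u ∷ m)) (trans (cong (nb h) (cong (v ∷_) (sym (++-assoc q [ u ] m)))) (nb-++ h (v ∷ q ++ [ u ]) m))))) nle₂)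
      (rest (≤-trans total4 (≤-reflexive (trans (cong (nb h) (cong (u ∷_) (sym (++-assoc m [ v ] q)))) (nb-++ h (u ∷ m ++ [ v ]) q)))) nle₁)

  module _ {N : ℕ} {b₁ b₂ b₃ b₄ : V} {l₁₃ l₁₄ l₂₃ l₂₄ l₃₄ : List V} (IH : Below N) where

    -- `w` becomes a branch vertex in place of `b₃`, which now lies inside the path from `b₁` to
    -- `b₂`.
    drop₃₄ : ∀ A {w} B → K4At b₁ b₂ b₃ b₄ (A ++ w ∷ B) l₁₃ l₁₄ l₂₃ l₂₄ l₃₄ → length (verts b₁ b₂ b₃ b₄ (A ++ w ∷ B) l₁₃ l₁₄ l₂₃ l₂₄ l₃₄) ≤ N → b₄ ~ w → ¬ (l₃₄ ≢ [])
    drop₃₄ A {w} B (mkK4 k₁₂ k₁₃ k₁₄ k₂₃ k₂₄ k₃₄ uq) sz bw ne = IH {b₁} {b₂} {w} {b₄} {l₁₃ ++ b₃ ∷ reverse l₂₃} {A} {l₁₄} {reverse B} {l₂₄} {[]}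
        (mkK4 (link-join l₁₃ k₁₃ (link-rev l₂₃ k₂₃)) (proj₁ (link-split A k₁₂)) k₁₄ (link-rev B (proj₂ (link-split A k₁₂))) k₂₄ (~-sym bw , tt)
          (λ x → ≤-trans (mono (cnt-additive x) ρ new old) (uq x))) (≤-trans (dropped ρ new old (suc (suc 9F)) refl ne) sz)
      where
      ρ : Vec (List V) 12
      ρ = [ b₁ ] ∷ [ b₂ ] ∷ [ b₃ ] ∷ [ b₄ ] ∷ A ∷ [ w ] ∷ B ∷ l₁₃ ∷ l₁₄ ∷ l₂₃ ∷ l₂₄ ∷ l₃₄ ∷ []
      v = var {12}
      new old : Ex 12
      new = vertsE (v 0F) (v 1F) (v 5F) (v 3F) (v 7F ⊕ v 2F ⊕ rv (v 9F)) (v 4F) (v 8F) (rv (v 6F)) (v (suc 9F)) ∅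
      old = vertsE (v 0F) (v 1F) (v 2F) (v 3F) (v 4F ⊕ v 5F ⊕ v 6F) (v 7F) (v 8F) (v 9F) (v (suc 9F)) (v (suc (suc 9F)))

    -- `w` becomes a branch vertex in place of `b₁`, which now lies inside the path to `b₃`.
    drop₁₄ : ∀ A {w} B → K4At b₁ b₂ b₃ b₄ (A ++ w ∷ B) l₁₃ l₁₄ l₂₃ l₂₄ l₃₄ → length (verts b₁ b₂ b₃ b₄ (A ++ w ∷ B) l₁₃ l₁₄ l₂₃ l₂₄ l₃₄) ≤ N → b₄ ~ w → ¬ (l₁₄ ≢ [])
    drop₁₄ A {w} B (mkK4 k₁₂ k₁₃ k₁₄ k₂₃ k₂₄ k₃₄ uq) sz bw ne = IH {w} {b₂} {b₃} {b₄} {B} {reverse A ++ b₁ ∷ l₁₃} {[]} {l₂₃} {l₂₄} {l₃₄}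
        (mkK4 (proj₂ (link-split A k₁₂)) (link-join (reverse A) (link-rev A (proj₁ (link-split A k₁₂))) k₁₃) (~-sym bw , tt) k₂₃ k₂₄ k₃₄
          (λ x → ≤-trans (mono (cnt-additive x) ρ new old) (uq x))) (≤-trans (dropped ρ new old 8F refl ne) sz)
      where
      ρ : Vec (List V) 12
      ρ = [ b₁ ] ∷ [ b₂ ] ∷ [ b₃ ] ∷ [ b₄ ] ∷ A ∷ [ w ] ∷ B ∷ l₁₃ ∷ l₁₄ ∷ l₂₃ ∷ l₂₄ ∷ l₃₄ ∷ []
      v = var {12}
      new old : Ex 12
      new = vertsE (v 5F) (v 1F) (v 2F) (v 3F) (v 6F) (rv (v 4F) ⊕ v 0F ⊕ v 7F) ∅ (v 9F) (v (suc 9F)) (v (suc (suc 9F)))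
      old = vertsE (v 0F) (v 1F) (v 2F) (v 3F) (v 4F ⊕ v 5F ⊕ v 6F) (v 7F) (v 8F) (v 9F) (v (suc 9F)) (v (suc (suc 9F)))

  -- By minimality `b₄` is adjacent to all three other branch vertices. With `w` it has four
  -- neighbours on the cycle through them, which is chordless by `hub-chord`: a wheel.
  branch-chord : ∀ {N b₁ b₂ b₃ b₄ l₁₂ l₁₃ l₁₄ l₂₃ l₂₄ l₃₄ w} → Below N → K4At b₁ b₂ b₃ b₄ l₁₂ l₁₃ l₁₄ l₂₃ l₂₄ l₃₄ →
    length (verts b₁ b₂ b₃ b₄ l₁₂ l₁₃ l₁₄ l₂₃ l₂₄ l₃₄) ≤ N → w ∈ l₁₂ → b₄ ~ w → ⊥
  branch-chord {N} {b₁} {b₂} {b₃} {b₄} {l₁₂} {l₁₃} {l₁₄} {l₂₃} {l₂₄} {l₃₄} {w} IH K sz wi bw =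
      noW (rim , (b₁ , _ , refl , 2≤ l₁₂ , unique-++ʳ [ b₄ ] un , co) , chordless , b₄ , (λ i → unique-≢ [ b₄ ] un (here refl) i refl) , ≤-trans (s≤s (s≤s (s≤s z≤n))) four)
    where
    open K4At K
    rim : List V
    rim = b₁ ∷ l₁₂ ++ b₂ ∷ l₂₃ ++ b₃ ∷ reverse l₁₃
    e₁ : b₁ ~ b₄
    e₁ with ∈-∃++ wi
    ... | A , B , refl = link-[] k₁₄ (drop₁₄ IH A B K sz bw)
    e₃ : b₃ ~ b₄
    e₃ with ∈-∃++ wi
    ... | A , B , refl = link-[] k₃₄ (drop₃₄ IH A B K sz bw)
    e₂ : b₂ ~ b₄
    e₂ = link-[] k₂₄ (λ ne → go (∈-∃++ (reverse⁺ wi)) ne)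
      where
      go : (Σ (List V) λ p → Σ (List V) λ q → reverse l₁₂ ≡ p ++ w ∷ q) → ¬ (l₂₄ ≢ [])
      go (A , B , e) = drop₁₄ IH A B (subst (λ l → K4At b₂ b₁ b₃ b₄ l l₂₃ l₂₄ l₁₃ l₁₄ l₃₄) e (σ₁₂ K))
        (subst (λ l → length (verts b₂ b₁ b₃ b₄ l l₂₃ l₂₄ l₁₃ l₁₄ l₃₄) ≤ N) e (≤-trans (σ₁₂-size {b₁} {b₂} {b₃} {b₄} l₁₂ l₁₃ l₁₄ l₂₃ l₂₄ l₃₄) sz)) bw
    2≤ : ∀ l → 2 ≤ length (l ++ b₂ ∷ l₂₃ ++ b₃ ∷ reverse l₁₃)
    2≤ l = ≤-trans (≤-trans (s≤s (nonempty-length (ne l₂₃))) (m≤n+m _ (length l))) (≤-reflexive (sym (length-++ l)))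
      where
      ne : ∀ l → l ++ b₃ ∷ reverse l₁₃ ≢ []
      ne [] ()
      ne (_ ∷ _) ()
    ρ = cells b₁ b₂ b₃ b₄ l₁₂ l₁₃ l₁₄ l₂₃ l₂₄ l₃₄
    rimE : Ex 10
    rimE = var 3F ⊕ var 0F ⊕ var 4F ⊕ var 1F ⊕ var 7F ⊕ var 2F ⊕ rv (var 5F)
    un : Unique (b₄ ∷ rim)
    un = cnt≤1⇒Unique λ x → ≤-trans (mono (cnt-additive x) ρ rimE all10) (uq x)
    co : Consec _~_ (rim ++ [ b₁ ])
    co = subst (Consec _~_) (cong (b₁ ∷_) (trans (cong (λ l → l₁₂ ++ b₂ ∷ l) (sym (++-assoc l₂₃ (b₃ ∷ reverse l₁₃) [ b₁ ]))) (sym (++-assoc l₁₂ (b₂ ∷ l₂₃ ++ b₃ ∷ reverse l₁₃) [ b₁ ]))))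
      (consec-glue (b₁ ∷ l₁₂) k₁₂ (consec-glue (b₂ ∷ l₂₃) k₂₃ (link-rev l₁₃ k₁₃)))
    four : 4 ≤ nb b₄ rim
    four = ≤-trans (s≤s (≤-trans (+-mono-≤ (nb-∈ wi bw) (≤-trans (s≤s (≤-trans (≤-trans (s≤s z≤n) (≤-reflexive (sym (nb-∷ (~-sym e₃))))) (≤-trans (m≤n+m _ (nb b₄ l₂₃)) (≤-reflexive (sym (nb-++ b₄ l₂₃ _)))))) (≤-reflexive (sym (nb-∷ (~-sym e₂))))))
      (≤-reflexive (sym (nb-++ b₄ l₁₂ _))))) (≤-reflexive (sym (nb-∷ (~-sym e₁))))
    chordless : CycleChordless G rim
    chordless u v i j uv with chord-or-consec (unique-++ʳ [ b₄ ] un) co i j (~⇒≢ uv)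
    ... | inj₁ h = h
    ... | inj₂ t = ⊥-elim (hub-chord IH un (≤-trans (mono length-additive ρ rimE all10) sz) four uv t)

  -- The chord bypasses `m`. Either end of the chord may be an end of the path, so there are four
  -- shapes of the new interior; additive functions describe them uniformly.
  shortcut : ∀ {b₁ l b₂} p {u m v q} → Link b₁ l b₂ → b₁ ∷ l ++ [ b₂ ] ≡ p ++ u ∷ m ++ v ∷ q → u ~ v →
    Σ (List V) λ l' → Link b₁ l' b₂ × (∀ {f} → Additive f → f l ≡ f l' + f m)
  shortcut {b₁} {l} {b₂} [] {u} {m} {v} {q} k e uv with ∷-injective e
  ... | refl , e' with snoc-split l m e'
  ... | inj₁ (refl , refl , refl) = [] , (uv , tt) , λ {f} ad → cong (_+ f m) (sym (Additive.f-[] ad))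
  ... | inj₂ (q' , refl , refl) = v ∷ q' , (uv , proj₂ (link-split m k)) , λ {f} ad → trans (Additive.f-++ ad m (v ∷ q')) (+-comm (f m) _)
  shortcut {b₁} {l} {b₂} (_ ∷ p) {u} {m} {v} {q} k e uv with ∷-injective e
  ... | refl , e' with snoc-split l (p ++ u ∷ m) (trans e' (sym (++-assoc p (u ∷ m) (v ∷ q))))
  ... | inj₁ (refl , refl , refl) = p ++ [ u ] , link-join p (proj₁ (link-split p k)) (uv , tt) , λ {f} ad → trans (Additive.f-++ ad p (u ∷ m)) (trans (cong (f p +_) (Additive.f-++ ad [ u ] m)) (trans (sym (+-assoc (f p) (f [ u ]) (f m))) (cong (_+ f m) (sym (Additive.f-++ ad p [ u ])))))
  ... | inj₂ (q' , refl , refl) = p ++ u ∷ v ∷ q' , link-join p (proj₁ (link-split p k')) (uv , proj₂ (link-split m (proj₂ (link-split p k')))) ,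
        λ {f} ad → mid {f} ad
    where
    k' : Link b₁ (p ++ u ∷ m ++ v ∷ q') b₂
    k' = subst (λ l → Link b₁ l b₂) (++-assoc p (u ∷ m) (v ∷ q')) k
    mid : ∀ {f} → Additive f → f ((p ++ u ∷ m) ++ v ∷ q') ≡ f (p ++ u ∷ v ∷ q') + f m
    mid {f} ad = ≤-antisym
      (≤-trans (mono ad ρ ((var 0F ⊕ var 1F ⊕ var 2F) ⊕ var 3F ⊕ var 4F) ((var 0F ⊕ var 1F ⊕ var 3F ⊕ var 4F) ⊕ var 2F)) (≤-reflexive (Additive.f-++ ad (p ++ u ∷ v ∷ q') m)))
      (≤-trans (≤-reflexive (sym (Additive.f-++ ad (p ++ u ∷ v ∷ q') m))) (mono ad ρ ((var 0F ⊕ var 1F ⊕ var 3F ⊕ var 4F) ⊕ var 2F) ((var 0F ⊕ var 1F ⊕ var 2F) ⊕ var 3F ⊕ var 4F)))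
      where
      ρ : Vec (List V) 5
      ρ = p ∷ [ u ] ∷ m ∷ [ v ] ∷ q' ∷ []

  cut : ∀ {N b₁ b₂ b₃ b₄ l₁₂ l₁₃ l₁₄ l₂₃ l₂₄ l₃₄} → Below N → K4At b₁ b₂ b₃ b₄ l₁₂ l₁₃ l₁₄ l₂₃ l₂₄ l₃₄ →
    length (verts b₁ b₂ b₃ b₄ l₁₂ l₁₃ l₁₄ l₂₃ l₂₄ l₃₄) ≤ N → ∀ p m {u v q} → b₁ ∷ l₁₂ ++ [ b₂ ] ≡ p ++ u ∷ m ++ v ∷ q → u ~ v → ConsecIn (b₁ ∷ l₁₂ ++ [ b₂ ]) u v
  cut IH K sz p [] {q = q} e uv = p , q , inj₁ e
  cut {N} {b₁} {b₂} {b₃} {b₄} {l₁₂} {l₁₃} {l₁₄} {l₂₃} {l₂₄} {l₃₄} IH K sz p (m₀ ∷ m) {u} {v} {q} e uv with shortcut p {u} {m₀ ∷ m} {v} {q} (K4At.k₁₂ K) e uv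
  ... | l' , k' , eqf = ⊥-elim (IH {b₁} {b₂} {b₃} {b₄} {l'} {l₁₃} {l₁₄} {l₂₃} {l₂₄} {l₃₄} (mkK4 k' k₁₃ k₁₄ k₂₃ k₂₄ k₃₄
        (λ x → ≤-trans (mono (cnt-additive x) ρ' all10' big) (≤-trans (≤-reflexive (swap-l (cnt-additive x) (eqf (cnt-additive x)))) (uq x))))
        (≤-trans (dropped ρ' all10' big (suc 9F) refl (λ ())) (≤-trans (≤-reflexive (swap-l length-additive (eqf length-additive))) sz)))
    where
    open K4At K
    ρ' : Vec (List V) 11
    ρ' = [ b₁ ] ∷ [ b₂ ] ∷ [ b₃ ] ∷ [ b₄ ] ∷ l' ∷ l₁₃ ∷ l₁₄ ∷ l₂₃ ∷ l₂₄ ∷ l₃₄ ∷ (m₀ ∷ m) ∷ []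
    w = var {11}
    all10' big : Ex 11
    all10' = vertsE (w 0F) (w 1F) (w 2F) (w 3F) (w 4F) (w 5F) (w 6F) (w 7F) (w 8F) (w 9F)
    big = vertsE (w 0F) (w 1F) (w 2F) (w 3F) (w 4F ⊕ w (suc 9F)) (w 5F) (w 6F) (w 7F) (w 8F) (w 9F)
    swap-l : ∀ {f} → Additive f → f l₁₂ ≡ f l' + f (m₀ ∷ m) → f (⟦ big ⟧ ρ') ≡ f (verts b₁ b₂ b₃ b₄ l₁₂ l₁₃ l₁₄ l₂₃ l₂₄ l₃₄)
    swap-l {f} ad eq = trans (f-++ (b₁ ∷ b₂ ∷ b₃ ∷ b₄ ∷ []) _) (trans (cong (f (b₁ ∷ b₂ ∷ b₃ ∷ b₄ ∷ []) +_) (trans (f-++ (l' ++ m₀ ∷ m) R) (trans (cong (_+ f R) (trans (f-++ l' (m₀ ∷ m)) (sym eq))) (sym (f-++ l₁₂ R))))) (sym (f-++ (b₁ ∷ b₂ ∷ b₃ ∷ b₄ ∷ []) _)))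
      where
      open Additive ad
      R = l₁₃ ++ l₁₄ ++ l₂₃ ++ l₂₄ ++ l₃₄ ++ []

  same-path-chord : ∀ {N b₁ b₂ b₃ b₄ l₁₂ l₁₃ l₁₄ l₂₃ l₂₄ l₃₄ u v} → Below N → K4At b₁ b₂ b₃ b₄ l₁₂ l₁₃ l₁₄ l₂₃ l₂₄ l₃₄ →
    length (verts b₁ b₂ b₃ b₄ l₁₂ l₁₃ l₁₄ l₂₃ l₂₄ l₃₄) ≤ N → u ∈ (b₁ ∷ l₁₂ ++ [ b₂ ]) → v ∈ (b₁ ∷ l₁₂ ++ [ b₂ ]) → u ~ v → ConsecIn (b₁ ∷ l₁₂ ++ [ b₂ ]) u v
  same-path-chord {u = u} {v} IH K sz i j uv with ∈-∃++ i
  ... | p , q , e with ∈-++⁻ p (cast∈ e j)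
  ... | inj₂ (here e') = ⊥-elim (~⇒≢ uv (sym e'))
  ... | inj₂ (there k) with ∈-∃++ k
  ... | m , q' , refl = cut IH K sz p m e uv
  same-path-chord {u = u} {v} IH K sz i j uv | p , q , e | inj₁ k with ∈-∃++ k
  ... | p' , m , refl = ConsecIn-sym (cut IH K sz p' m (trans e (++-assoc p' (v ∷ m) (u ∷ q))) (~-sym uv))

  JE : Fin 4 → Fin 4 → Ex 10
  JE i j with i F.<? j
  ... | yes _ = var (cix i j)
  ... | no _ = rv (var (cix j i))

  Distinct : (i j k l : Fin 4) → Set
  Distinct i j k l = (i ≢ j) × (i ≢ k) × (i ≢ l) × (j ≢ k) × (j ≢ l) × (k ≢ l)

  distinct? : ∀ i j k l → Dec (Distinct i j k l)
  distinct? i j k l = ¬? (i ≟ j) ×-dec ¬? (i ≟ k) ×-dec ¬? (i ≟ l) ×-dec ¬? (j ≟ k) ×-dec ¬? (j ≟ l) ×-dec ¬? (k ≟ l)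

  -- All relabellings of the branch vertices at once, so each kind of chord has to be treated in one
  -- position only.
  permuteE : (i j k l : Fin 4) → Ex 10
  permuteE i j k l = vertsE (var (bix i)) (var (bix j)) (var (bix k)) (var (bix l)) (JE i j) (JE i k) (JE i l) (JE j k) (JE j l) (JE k l)

  abstract
    perm-sub : ∀ i j k l → Distinct i j k l → T (sub (flatten (permuteE i j k l)) (flatten all10))
    perm-sub = from-yes (all? λ i → all? λ j → all? λ k → all? λ l → distinct? i j k l →-dec T? (sub (flatten (permuteE i j k l)) (flatten all10)))

    fourth : ∀ i j k → i ≢ j → i ≢ k → j ≢ k → Σ (Fin 4) λ l → Distinct i j k l
    fourth = from-yes (all? λ i → all? λ j → all? λ k → ¬? (i ≟ j) →-dec (¬? (i ≟ k) →-dec (¬? (j ≟ k) →-dec any? λ l → distinct? i j k l)))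

    third : ∀ (i j : Fin 4) → i ≢ j → Σ (Fin 4) λ k → (i ≢ k) × (j ≢ k)
    third = from-yes (all? λ (i : Fin 4) → all? λ (j : Fin 4) → ¬? (i ≟ j) →-dec any? λ k → ¬? (i ≟ k) ×-dec ¬? (j ≟ k))

  module Induced {N} (IH : Below N) {b₁ b₂ b₃ b₄ l₁₂ l₁₃ l₁₄ l₂₃ l₂₄ l₃₄} (K : K4At b₁ b₂ b₃ b₄ l₁₂ l₁₃ l₁₄ l₂₃ l₂₄ l₃₄)
    (sz : length (verts b₁ b₂ b₃ b₄ l₁₂ l₁₃ l₁₄ l₂₃ l₂₄ l₃₄) ≤ N) where
    open FromK4At K

    J : Fin 4 → Fin 4 → List V
    J i j = ⟦ JE i j ⟧ ρ

    cell≡ : ∀ i → lookup ρ (bix i) ≡ [ b i ]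
    cell≡ 0F = refl
    cell≡ 1F = refl
    cell≡ 2F = refl
    cell≡ 3F = refl

    ≢⇒> : ∀ (i j : Fin 4) → i ≢ j → ¬ (i F.< j) → j F.< i
    ≢⇒> i j ne h = ≤∧≢⇒< (≮⇒≥ h) (λ e → ne (sym (toℕ-injective e)))

    J-link : ∀ i j → i ≢ j → Link (b i) (J i j) (b j)
    J-link i j ne with i F.<? j
    ... | yes i<j = link i j i<j
    ... | no h = link-rev (I j i) (link j i (≢⇒> i j ne h))

    perm≡ : ∀ i j k l → ⟦ permuteE i j k l ⟧ ρ ≡ verts (b i) (b j) (b k) (b l) (J i j) (J i k) (J i l) (J j k) (J j l) (J k l)
    perm≡ i j k l = cong₂ _++_ (cell≡ i) (cong₂ _++_ (cell≡ j) (cong₂ _++_ (cell≡ k) (cong₂ _++_ (cell≡ l) refl)))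

    perm : ∀ i j k l → Distinct i j k l → K4At (b i) (b j) (b k) (b l) (J i j) (J i k) (J i l) (J j k) (J j l) (J k l)
    perm i j k l d@(ij , ik , il , jk , jl , kl) = mkK4 (J-link i j ij) (J-link i k ik) (J-link i l il) (J-link j k jk) (J-link j l jl) (J-link k l kl)
      λ x → ≤-trans (≤-reflexive (cong (cnt x) (sym (perm≡ i j k l)))) (≤-trans (mono (cnt-additive x) ρ (permuteE i j k l) all10 {perm-sub i j k l d}) (K4At.uq K x))

    perm-size : ∀ i j k l → Distinct i j k l → length (verts (b i) (b j) (b k) (b l) (J i j) (J i k) (J i l) (J j k) (J j l) (J k l)) ≤ N
    perm-size i j k l d = ≤-trans (≤-reflexive (cong length (sym (perm≡ i j k l)))) (≤-trans (mono length-additive ρ (permuteE i j k l) all10 {perm-sub i j k l d}) sz)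

    J< : ∀ {i j} → i F.< j → J i j ≡ I i j
    J< {i} {j} i<j with i F.<? j
    ... | yes _ = refl
    ... | no h = ⊥-elim (h i<j)

    J> : ∀ {i j} → i F.< j → J j i ≡ reverse (I i j)
    J> {i} {j} i<j with j F.<? i
    ... | yes h = ⊥-elim (<-asym i<j h)
    ... | no _ = refl

    Res : V → V → Set
    Res u w = Σ (Fin 4) λ i → Σ (Fin 4) λ j → (i F.< j) × ConsecIn (Pth i j) u w

    rsym : ∀ {u w} → Res u w → Res w u
    rsym (i , j , l , r) = i , j , l , ConsecIn-sym r

    same-path : ∀ {i j u v} → i F.< j → u ∈ Pth i j → v ∈ Pth i j → u ~ v → Res u v
    same-path {i} {j} {u} {v} i<j ui vi uv with third i j (<⇒≢ꟳ i j i<j)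
    ... | k , ik , jk with fourth i j k (<⇒≢ꟳ i j i<j) ik jk
    ... | l , d = i , j , i<j , subst (λ P → ConsecIn P u v) eqP (same-path-chord IH (perm i j k l d) (perm-size i j k l d) (cast∈ (sym eqP) ui) (cast∈ (sym eqP) vi) uv)
      where
      eqP : b i ∷ J i j ++ [ b j ] ≡ Pth i j
      eqP = cong (λ l → b i ∷ l ++ [ b j ]) (J< i<j)

    in-J : ∀ {i j u} → i F.< j → u ∈ I i j → u ∈ J i j
    in-J i<j u = cast∈ (sym (J< i<j)) u

    in-Jʳ : ∀ {i j u} → i F.< j → u ∈ I i j → u ∈ J j i
    in-Jʳ i<j u = cast∈ (sym (J> i<j)) (reverse⁺ u)

    branch-inner : ∀ m {i j v} → i F.< j → v ∈ I i j → b m ~ v → Res (b m) v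
    branch-inner m {i} {j} i<j vi e with m ≟ i | m ≟ j
    ... | yes refl | _ = same-path i<j (here refl) (there (∈-++⁺ˡ vi)) e
    ... | no _ | yes refl = same-path i<j (there (∈-++⁺ʳ (I i j) (here refl))) (there (∈-++⁺ˡ vi)) e
    ... | no mi | no mj with fourth i j m (<⇒≢ꟳ i j i<j) (≢-sym mi) (≢-sym mj)
    ... | l , ij , im , il , jm , jl , ml = ⊥-elim (branch-chord IH (perm i j l m d) (perm-size i j l m d) (in-J i<j vi) e)
      where
      d : Distinct i j l m
      d = ij , il , im , jl , jm , ≢-sym ml

    -- Two paths coincide, share one end (in four ways) or are opposite; a relabelling brings each
    -- case to its standard position.
    inner-inner : ∀ {i j k l u v} → i F.< j → k F.< l → u ∈ I i j → v ∈ I k l → u ~ v → Res u v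
    inner-inner {i} {j} {k} {l} i<j k<l ui vi uv with i ≟ k | j ≟ l
    ... | yes refl | yes refl = same-path i<j (there (∈-++⁺ˡ ui)) (there (∈-++⁺ˡ vi)) uv
    ... | yes refl | no jl with fourth i j l (<⇒≢ꟳ i j i<j) (<⇒≢ꟳ i l k<l) jl
    ... | m , d = ⊥-elim (adjacent-paths-chord IH (perm i j l m d) (perm-size i j l m d) (in-J i<j ui) (in-J k<l vi) uv)
    inner-inner {i} {j} {k} {l} i<j k<l ui vi uv | no ik | yes refl with fourth j i k (≢-sym (<⇒≢ꟳ i j i<j)) (≢-sym (<⇒≢ꟳ k j k<l)) ik
    ... | m , d = ⊥-elim (adjacent-paths-chord IH (perm j i k m d) (perm-size j i k m d) (in-Jʳ i<j ui) (in-Jʳ k<l vi) uv)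
    inner-inner {i} {j} {k} {l} i<j k<l ui vi uv | no ik | no jl with i ≟ l | j ≟ k
    ... | yes refl | _ with fourth i j k (<⇒≢ꟳ i j i<j) ik (λ { refl → <-asym i<j k<l })
    ... | m , d = ⊥-elim (adjacent-paths-chord IH (perm i j k m d) (perm-size i j k m d) (in-J i<j ui) (in-Jʳ k<l vi) uv)
    inner-inner {i} {j} {k} {l} i<j k<l ui vi uv | no ik | no jl | no il | yes refl with fourth j i l (≢-sym (<⇒≢ꟳ i j i<j)) jl il
    ... | m , d = ⊥-elim (adjacent-paths-chord IH (perm j i l m d) (perm-size j i l m d) (in-Jʳ i<j ui) (in-J k<l vi) uv)
    inner-inner {i} {j} {k} {l} i<j k<l ui vi uv | no ik | no jl | no il | no jk =
      ⊥-elim (opposite-paths-chord IH (perm i j k l d) (perm-size i j k l d) (in-J i<j ui) (in-J k<l vi) uv)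
      where
      d : Distinct i j k l
      d = <⇒≢ꟳ i j i<j , ik , il , jk , jl , <⇒≢ꟳ k l k<l

    kind : ∀ i j {v} → i F.< j → v ∈ Pth i j → (Σ (Fin 4) λ m → v ≡ b m) ⊎ (v ∈ I i j)
    kind i j i<j x with ∈Pth⁻ i j x
    ... | inj₁ e = inj₁ (i , e)
    ... | inj₂ (inj₁ e) = inj₁ (j , e)
    ... | inj₂ (inj₂ y) = inj₂ y

    branch-branch : ∀ i j → b i ~ b j → Res (b i) (b j)
    branch-branch i j e with i F.<? j
    ... | yes i<j = same-path i<j (here refl) (there (∈-++⁺ʳ (I i j) (here refl))) e
    ... | no h = rsym (same-path j<i (here refl) (there (∈-++⁺ʳ (I j i) (here refl))) (~-sym e))
      where
      j<i : j F.< i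
      j<i = ≢⇒> i j (λ { refl → ~-irr e }) h

    induced : InducedSub S
    induced u v (i , j , i<j , x) (k , l , k<l , y) uv with kind i j i<j x | kind k l k<l y
    ... | inj₁ (m , refl) | inj₁ (m' , refl) = branch-branch m m' uv
    ... | inj₁ (m , refl) | inj₂ y' = branch-inner m k<l y' uv
    ... | inj₂ x' | inj₁ (m , refl) = rsym (branch-inner m i<j x' (~-sym uv))
    ... | inj₂ x' | inj₂ y' = inner-inner i<j k<l x' y' uv

  -- A subdivision on at most `N` vertices with none below `N` has no chord, so it is an ISK4.
  below : ∀ N → Below N
  below zero K ()
  below (suc N) K (s≤s le) = noI (FromK4At.S K , Induced.induced (below N) K le)

  seriesParallel : SeriesParallel G
  seriesParallel S = below _ (ToK4At.K S) ≤-refl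

-- Complete bipartite graphs

module Ears (G : Graph) (noI : ¬ HasISK4 G) where
  open Basics G
  open K4Subdivisions G
  open Multiset {V}
  open Count {n G}

  -- The 4-cycle `a₁ b₂ a₂ b₃` with the ear `P` between the first two opposite corners and the path
  -- over `a₃` between the others is a subdivision of K4 with these four branch vertices.
  ear : ∀ {a₁ a₂ a₃ b₂ b₃ P} → a₁ ~ b₂ → a₁ ~ b₃ → a₂ ~ b₂ → a₂ ~ b₃ → a₃ ~ b₂ → a₃ ~ b₃ → a₁ # a₃ → a₂ # a₃ → b₂ # b₃ →
    IP (a₁ ∷ P ++ [ a₂ ]) → P ## (b₂ ∷ a₃ ∷ b₃ ∷ []) → ⊥
  ear {a₁} {a₂} {a₃} {b₂} {b₃} {P} e₁₂ e₁₃ e₂₂ e₂₃ e₃₂ e₃₃ a₁₃ a₂₃ b₂₃ ipP P## = noI (FromK4At.S K , ind)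
    where
    L M : List V
    L = a₁ ∷ P ++ [ a₂ ]
    M = b₂ ∷ a₃ ∷ b₃ ∷ []
    ipM : IP M
    ipM = ~-sym e₃₂ , #→## b₂₃ , e₃₃ , ##[] , tt
    disj : ∀ {x} → x ∈ L → x ∈ M → ⊥
    disj (here refl) (here refl) = ~-irr e₁₂
    disj (here refl) (there (here refl)) = proj₁ a₁₃ refl
    disj (here refl) (there (there (here refl))) = ~-irr e₁₃
    disj (there i) j with ∈-++⁻ P i
    ... | inj₁ k = proj₁ (at P## k j) refl
    disj (there i) (here refl) | inj₂ (here refl) = ~-irr e₂₂
    disj (there i) (there (here refl)) | inj₂ (here refl) = proj₁ a₂₃ refl
    disj (there i) (there (there (here refl))) | inj₂ (here refl) = ~-irr e₂₃
    K : K4At a₁ a₂ b₂ b₃ P [] [] [] [] [ a₃ ]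
    K = mkK4 (IP⇒Consec ipP) (e₁₂ , tt) (e₁₃ , tt) (e₂₂ , tt) (e₂₃ , tt) (~-sym e₃₂ , e₃₃ , tt)
      λ x → ≤-trans (mono (cnt-additive x) ([ a₁ ] ∷ [ a₂ ] ∷ [ b₂ ] ∷ [ b₃ ] ∷ P ∷ [ a₃ ] ∷ [])
        (var 0F ⊕ var 1F ⊕ var 2F ⊕ var 3F ⊕ var 4F ⊕ var 5F ⊕ ∅) ((var 0F ⊕ var 4F ⊕ var 1F) ⊕ (var 2F ⊕ var 5F ⊕ var 3F)))
        (Unique⇒cnt≤1 (UP.++⁺ (IP-uniq ipP) (IP-uniq ipM) (λ (i , j) → disj i j)) x)
    open FromK4At K using (Pth)
    a₂∈ : a₂ ∈ L
    a₂∈ = there (∈-++⁺ʳ P (here refl))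
    loc : ∀ i j → i F.< j → ∀ {u} → u ∈ Pth i j → (u ∈ L) ⊎ (u ∈ M)
    loc = pairs-elim inj₁
      (λ { (here refl) → inj₁ (here refl) ; (there (here refl)) → inj₂ (here refl) })
      (λ { (here refl) → inj₁ (here refl) ; (there (here refl)) → inj₂ (there (there (here refl))) })
      (λ { (here refl) → inj₁ a₂∈ ; (there (here refl)) → inj₂ (here refl) })
      (λ { (here refl) → inj₁ a₂∈ ; (there (here refl)) → inj₂ (there (there (here refl))) })
      inj₂
    Res : V → V → Set
    Res u w = Σ (Fin 4) λ i → Σ (Fin 4) λ j → (i F.< j) × ConsecIn (Pth i j) u w
    rsym : ∀ {u w} → Res u w → Res w u
    rsym (i , j , l , r) = i , j , l , ConsecIn-sym r
    cross : ∀ {u w} → u ∈ L → w ∈ M → u ~ w → Res u w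
    cross (here refl) (here refl) e = 0F , 2F , s≤s z≤n , [] , [] , inj₁ refl
    cross (here refl) (there (here refl)) e = ⊥-elim (proj₂ a₁₃ e)
    cross (here refl) (there (there (here refl))) e = 0F , 3F , s≤s z≤n , [] , [] , inj₁ refl
    cross (there i) j e with ∈-++⁻ P i
    ... | inj₁ k = ⊥-elim (proj₂ (at P## k j) e)
    cross (there i) (here refl) e | inj₂ (here refl) = 1F , 2F , s≤s (s≤s z≤n) , [] , [] , inj₁ refl
    cross (there i) (there (here refl)) e | inj₂ (here refl) = ⊥-elim (proj₂ a₂₃ e)
    cross (there i) (there (there (here refl))) e | inj₂ (here refl) = 1F , 3F , s≤s (s≤s z≤n) , [] , [] , inj₁ refl
    ind : InducedSub (FromK4At.S K)
    ind u w (i , j , i<j , x) (k , l , k<l , y) e with loc i j i<j x | loc k l k<l y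
    ... | inj₁ p | inj₁ q = 0F , 1F , s≤s z≤n , IP-ConsecIn ipP p q e
    ... | inj₁ p | inj₂ q = cross p q e
    ... | inj₂ p | inj₁ q = rsym (cross q p (~-sym e))
    ... | inj₂ p | inj₂ q = 2F , 3F , s≤s (s≤s (s≤s z≤n)) , IP-ConsecIn ipM p q e

module Bipartite (G : Graph) (noI : ¬ HasISK4 G) (noT : ∀ {x y z} → E G x y → E G x z → E G y z → ⊥) where
  open Basics G
  open Paths G
  open Reachability G
  open Ears G noI
  open K33

  swapK : K33 G → K33 G
  swapK k = record { x = y k ; y = x k ; x-inj = y-inj k ; y-inj = x-inj k ; edge = λ i j → ~-sym (edge k j i) }

  xs# : ∀ (k : K33 G) {i j} → i ≢ j → x k i # x k j
  xs# k {i} {j} ne = x-inj k ne , λ e → noT e (edge k i 0F) (edge k j 0F)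

  ys# : ∀ (k : K33 G) {i j} → i ≢ j → y k i # y k j
  ys# k = xs# (swapK k)

  A B : K33 G → V → Set
  A k v = (v ~ y k 0F) × (v ~ y k 1F)
  B k v = A (swapK k) v

  A? : ∀ k v → Dec (A k v)
  A? k v = (v ~? y k 0F) ×-dec (v ~? y k 1F)

  -- Otherwise `v` alone is an ear between `y k 0F` and `y k 1F`, with `y k 2F` in the role of `a₃`.
  ext : ∀ k {v} → A k v → ∀ l → v ~ y k l
  ext k (p , q) 0F = p
  ext k (p , q) 1F = q
  ext k {v} (p , q) 2F with v ~? y k 2F
  ... | yes e = e
  ... | no ne = ⊥-elim (ear {y k 0F} {y k 1F} {y k 2F} {x k 0F} {x k 1F} {[ v ]}
        (~-sym (edge k 0F 0F)) (~-sym (edge k 1F 0F)) (~-sym (edge k 0F 1F)) (~-sym (edge k 1F 1F)) (~-sym (edge k 0F 2F)) (~-sym (edge k 1F 2F))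
        (ys# k {0F} {2F} λ ()) (ys# k {1F} {2F} λ ()) (xs# k {0F} {1F} λ ()) (~-sym p , #→## (ys# k {0F} {1F} λ ()) , q , ##[] , tt)
        (mk[]## λ { (here refl) → v#x 0F ; (there (here refl)) → (λ { refl → proj₂ (ys# k {2F} {0F} λ ()) p }) , ne ; (there (there (here refl))) → v#x 1F }))
    where
    v#x : ∀ i → v # x k i
    v#x i = (λ { refl → ne (edge k i 2F) }) , λ e → noT e p (edge k i 0F)

  x∈A : ∀ k i → A k (x k i)
  x∈A k i = edge k i 0F , edge k i 1F

  -- Any further vertex of B can stand in for `y k 2F`; what `ext` says of the third vertex thus
  -- holds for all of B.
  replace-y : ∀ k {w} → B k w → w ≢ y k 0F → w ≢ y k 1F → K33 G
  replace-y k {w} wB n₀ n₁ = record { x = x k ; y = y' ; x-inj = x-inj k ; y-inj = λ {i} {j} → inj i j ; edge = edge' }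
    where
    y' : Fin 3 → V
    y' 0F = y k 0F
    y' 1F = y k 1F
    y' 2F = w
    inj : ∀ i j → i ≢ j → y' i ≢ y' j
    inj 0F 0F ne = ⊥-elim (ne refl)
    inj 1F 1F ne = ⊥-elim (ne refl)
    inj 2F 2F ne = ⊥-elim (ne refl)
    inj 0F 1F ne = y-inj k λ ()
    inj 1F 0F ne = y-inj k λ ()
    inj 0F 2F ne = ≢-sym n₀
    inj 2F 0F ne = n₀
    inj 1F 2F ne = ≢-sym n₁
    inj 2F 1F ne = n₁
    edge' : ∀ i j → x k i ~ y' j
    edge' i 0F = edge k i 0F
    edge' i 1F = edge k i 1F
    edge' i 2F = ~-sym (ext (swapK k) wB i)

  complete : ∀ k {v w} → A k v → B k w → v ~ w
  complete k {v} {w} vA wB with w ≟ y k 0F | w ≟ y k 1F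
  ... | yes refl | _ = proj₁ vA
  ... | no _ | yes refl = proj₂ vA
  ... | no n₀ | no n₁ = ext (replace-y k wB n₀ n₁) vA 2F

  A-indep : ∀ k {v w} → A k v → A k w → ¬ (v ~ w)
  A-indep k (p , _) (q , _) e = noT e p q

  A∩B : ∀ k {v} → A k v → B k v → ⊥
  A∩B k (p , _) (q , _) = noT p q (~-sym (edge k 0F 0F))

  -- Apart from coincidences, `a`, `a'` and `x k i` form a side of another K3,3, and `ext` yields
  -- the neighbour `x k i`.
  two-in-A : ∀ k {w a a'} → A k a → A k a' → a ≢ a' → w ~ a → w ~ a' → B k w
  two-in-A k {w} {a} {a'} aA a'A ne wa wa' = adj' 0F , adj' 1F
    where
    adj' : ∀ i → w ~ x k i
    adj' i with x k i ≟ a | x k i ≟ a'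
    ... | yes e | _ = subst (w ~_) (sym e) wa
    ... | no _ | yes e = subst (w ~_) (sym e) wa'
    ... | no p | no q = ext new (wa , wa') 2F
      where
      y' : Fin 3 → V
      y' 0F = a
      y' 1F = a'
      y' 2F = x k i
      inj : ∀ i j → i ≢ j → y' i ≢ y' j
      inj 0F 0F ne = ⊥-elim (ne refl)
      inj 1F 1F ne = ⊥-elim (ne refl)
      inj 2F 2F ne = ⊥-elim (ne refl)
      inj 0F 1F _ = ne
      inj 1F 0F _ = ≢-sym ne
      inj 0F 2F _ = ≢-sym p
      inj 2F 0F _ = p
      inj 1F 2F _ = ≢-sym q
      inj 2F 1F _ = q
      new : K33 G
      new = record { x = y k ; y = y' ; x-inj = y-inj k ; y-inj = λ {i} {j} → inj i j
        ; edge = λ { j 0F → ~-sym (ext k aA j) ; j 1F → ~-sym (ext k a'A j) ; j 2F → ~-sym (edge k i j) } }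

  Same : K33 G → List V → Set
  Same k W = ∀ {w w' a a'} → w ∈ W → w' ∈ W → A k a → A k a' → w ~ a → w' ~ a' → a ≡ a'

  Out : K33 G → V → Set
  Out k w = ¬ A k w × ¬ B k w

  -- The path is an ear between `a` and `a'`. For `ear` one needs a third vertex of A, which the
  -- path does not see, and two vertices of the other side that `mid` does not see; they exist
  -- because `mid` sees at most one there. The ends `f` and `l` see none, for lack of triangles.
  core : ∀ k {f mid l} → IP (f ∷ mid ++ [ l ]) → (∀ {w} → w ∈ (f ∷ mid ++ [ l ]) → Out k w) → Same k (mid ++ [ l ]) → Same k (f ∷ mid) → Same (swapK k) (f ∷ mid) →
    ∀ {a a'} → A k a → A k a' → f ~ a → l ~ a' → a ≢ a' → ⊥
  core k {f} {mid} {l} ip o St Si SBi {a} {a'} aA a'A fa la' ne with thirdA | twoB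
    where
    thirdA : Σ V λ a₃ → A k a₃ × (a₃ ≢ a) × (a₃ ≢ a')
    thirdA with x k 0F ∈? (a ∷ a' ∷ []) | x k 1F ∈? (a ∷ a' ∷ []) | x k 2F ∈? (a ∷ a' ∷ [])
    ... | no h | _ | _ = x k 0F , x∈A k 0F , (h ∘ here) , (h ∘ there ∘ here)
    ... | yes _ | no h | _ = x k 1F , x∈A k 1F , (h ∘ here) , (h ∘ there ∘ here)
    ... | yes _ | yes _ | no h = x k 2F , x∈A k 2F , (h ∘ here) , (h ∘ there ∘ here)
    ... | yes i₀ | yes i₁ | yes i₂ = case three⇒3≤length (x-inj k {0F} {1F} λ ()) (x-inj k {0F} {2F} λ ()) (x-inj k {1F} {2F} λ ()) i₀ i₁ i₂ of λ { (s≤s (s≤s ())) }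
    Free : V → Set
    Free b = ∀ {w} → w ∈ mid → ¬ (w ~ b)
    other : ∀ {i} j → i ≢ j → Any (_~ y k i) mid → Free (y k j)
    other {i} j ij an wi e with Any⇒∈ an
    ... | w' , w'i , e' = y-inj k ij (SBi (there w'i) (there wi) (x∈A (swapK k) i) (x∈A (swapK k) j) e' e)
    free : ∀ {i} → ¬ Any (_~ y k i) mid → Free (y k i)
    free h wi e = h (∈⇒Any wi e)
    twoB : Σ (Fin 3) λ i → Σ (Fin 3) λ j → (i ≢ j) × Free (y k i) × Free (y k j)
    twoB with Any.any? (_~? y k 0F) mid | Any.any? (_~? y k 1F) mid
    ... | yes h | _ = 1F , 2F , (λ ()) , other 1F (λ ()) h , other 2F (λ ()) h
    ... | no h | yes h' = 0F , 2F , (λ ()) , free h , other 2F (λ ()) h'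
    ... | no h | no h' = 0F , 1F , (λ ()) , free h , free h'
  ... | a₃ , a₃A , n , n' | i , j , ij , Fi , Fj =
    ear {a} {a'} {a₃} {y k i} {y k j} {f ∷ mid ++ [ l ]} (ext k aA i) (ext k aA j) (ext k a'A i) (ext k a'A j) (ext k a₃A i) (ext k a₃A j)
      (≢-sym n , A-indep k aA a₃A) (≢-sym n' , A-indep k a'A a₃A) (ys# k ij) ipa
      (mk## λ w → λ { (here refl) → W#y i Fi w ; (there (here refl)) → W#a₃ w ; (there (there (here refl))) → W#y j Fj w })
    where
    W : List V
    W = f ∷ mid ++ [ l ]
    outA : ∀ {w v} → w ∈ W → A k v → w ≢ v
    outA i h refl = proj₁ (o i) h
    tl : ∀ {w} → w ∈ (mid ++ [ l ]) → l ∈ (mid ++ [ l ])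
    tl _ = ∈-++⁺ʳ mid (here refl)
    ipa : IP (a ∷ W ++ [ a' ])
    ipa = ~-sym fa , ##-++ʳ (mk[]## λ i → (λ e → outA (there i) aA (sym e)) , λ e → ne (St i (tl i) aA a'A (~-sym e) la')) (#→## (ne , A-indep k aA a'A)) ,
      subst IP (cong (f ∷_) (sym (++-assoc mid [ l ] [ a' ]))) (IP-glue (f ∷ mid) ip (la' , ##[] , tt)
        (##-sym (mk[]## λ i → (λ e → outA (∈-++⁺ˡ i) a'A (sym e)) , λ e → ne (Si (here refl) i aA a'A fa (~-sym e)))))
    W#a₃ : ∀ {w} → w ∈ W → w # a₃
    W#a₃ i = outA i a₃A , λ e → case i of λ { (here refl) → n (Si (here refl) (here refl) a₃A aA e fa) ; (there i') → n' (St i' (tl i') a₃A a'A e la') }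
    W#y : ∀ j → (∀ {w} → w ∈ mid → ¬ (w ~ y k j)) → ∀ {w} → w ∈ W → w # y k j
    W#y j F i = (λ { refl → proj₂ (o i) (x∈A (swapK k) j) }) , λ e → case i of λ
      { (here refl) → noT fa e (ext k aA j) ; (there i') → case ∈-++⁻ mid i' of λ { (inj₁ m) → F m e ; (inj₂ (here refl)) → noT la' e (ext k a'A j) } }

  -- Induction on the length for both sides of the K3,3 together: the step for A uses the shorter
  -- path's claim about B.
  same : ∀ k N W → length W ≤ N → IP W → (∀ {w} → w ∈ W → Out k w) → Same k W
  same k N [] _ ip o ()
  same k (suc N) (w ∷ []) _ ip o {a = a} {a'} (here refl) (here refl) aA a'A e e' with a ≟ a'
  ... | yes p = p
  ... | no ne = ⊥-elim (proj₂ (o (here refl)) (two-in-A k aA a'A ne e e'))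
  same k (suc N) (f ∷ w ∷ W) (s≤s le) ip o with snoc-view w W
  ... | mid , l , eq = go
    where
    ip' : IP (f ∷ mid ++ [ l ])
    ip' = subst (λ W → IP (f ∷ W)) eq ip
    o' : ∀ {w} → w ∈ (f ∷ mid ++ [ l ]) → Out k w
    o' i = o (cast∈ (cong (f ∷_) (sym eq)) i)
    len : length (f ∷ mid) ≤ N
    len = ≤-trans (≤-reflexive (trans (sym (trans (length-++ mid) (+-comm _ 1))) (cong length (sym eq)))) le
    flip : ∀ {w} → Out k w → Out (swapK k) w
    flip (p , q) = q , p
    St : Same k (mid ++ [ l ])
    St = same k N (mid ++ [ l ]) (≤-trans (≤-reflexive (cong length (sym eq))) le) (IP-tail ip') (o' ∘ there)
    Si : Same k (f ∷ mid)
    Si = same k N (f ∷ mid) len (IP-++ˡ (f ∷ mid) ip') (o' ∘ ∈-++⁺ˡ)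
    SBi : Same (swapK k) (f ∷ mid)
    SBi = same (swapK k) N (f ∷ mid) len (IP-++ˡ (f ∷ mid) ip') (λ i → flip (o' (∈-++⁺ˡ i)))
    ends : ∀ {a a'} → A k a → A k a' → f ~ a → l ~ a' → a ≡ a'
    ends {a} {a'} aA a'A e e' with a ≟ a'
    ... | yes p = p
    ... | no ne = ⊥-elim (core k ip' o' St Si SBi aA a'A e e' ne)
    go : Same k (f ∷ w ∷ W)
    go i j aA a'A e e' = go' (cast∈ (cong (f ∷_) eq) i) (cast∈ (cong (f ∷_) eq) j) aA a'A e e'
      where
      go' : Same k (f ∷ mid ++ [ l ])
      go' (there i) (there j) aA a'A e e' = St i j aA a'A e e'
      go' (here refl) j aA a'A e e' with ∈-++⁻ (f ∷ mid) j
      ... | inj₁ j' = Si (here refl) j' aA a'A e e'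
      ... | inj₂ (here refl) = ends aA a'A e e'
      go' (there i) (here refl) aA a'A e e' with ∈-++⁻ (f ∷ mid) (there i)
      ... | inj₁ i' = Si i' (here refl) aA a'A e e'
      ... | inj₂ (here refl) = sym (ends a'A aA e' e)

  same-reach : ∀ k {w w' a a'} → Out k w → Reach G (Out k) w w' → A k a → A k a' → w ~ a → w' ~ a' → a ≡ a'
  same-reach k {w} o rc aA a'A e e' with reach⇒path rc
  ... | record { tl = l ; ip = ip ; oks = oks ; ini = ini ; ends = ends } =
    same k (length (w ∷ l)) (w ∷ l) ≤-refl ip (λ { (here refl) → o ; (there i) → oks i }) (here refl) (cast∈ (sym ends) (∈-++⁺ʳ ini (here refl))) aA a'A e e'

  all-covered : ∀ k → (∀ v → A k v ⊎ B k v) → CompleteBipartite G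
  all-covered k cov = side , (x k 0F , dec-true (A? k _) (x∈A k 0F)) , (y k 0F , dec-false (A? k _) (λ h → A∩B k h (x∈A (swapK k) 0F))) , adj≡
    where
    side : V → Bool
    side v = does (A? k v)
    false-adj : ∀ {u v} → ¬ (u ~ v) → adj G u v ≡ false
    false-adj {u} {v} h with adj G u v
    ... | true = ⊥-elim (h refl)
    ... | false = refl
    adj≡ : ∀ u v → adj G u v ≡ side u xor side v
    adj≡ u v with cov u | cov v
    ... | inj₁ p | inj₁ q rewrite dec-true (A? k u) p | dec-true (A? k v) q = false-adj (A-indep k p q)
    ... | inj₁ p | inj₂ q rewrite dec-true (A? k u) p | dec-false (A? k v) (λ h → A∩B k h q) = complete k p q
    ... | inj₂ p | inj₁ q rewrite dec-false (A? k u) (λ h → A∩B k h p) | dec-true (A? k v) q = ~-sym (complete k q p)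
    ... | inj₂ p | inj₂ q rewrite dec-false (A? k u) (λ h → A∩B k h p) | dec-false (A? k v) (λ h → A∩B k h q) = false-adj (A-indep (swapK k) p q)

  -- A component outside A ∪ B sees at most one vertex of A and at most one of B, hence a clique.
  no-K33 : ¬ HasCliqueCutset G → ¬ CompleteBipartite G → ¬ K33 G
  no-K33 noC noB k with all? (λ v → A? k v ⊎-dec A? (swapK k) v)
  ... | yes cov = noB (all-covered k cov)
  ... | no ¬cov = go-out (¬∀⟶∃¬ _ _ (λ v → A? k v ⊎-dec A? (swapK k) v) ¬cov)
    where
    Sees : (V → Set) → V → V → Set
    Sees X z a = X a × (Σ V λ w → Reach G (Out k) z w × (w ~ a))
    go-out : (Σ V λ z → ¬ (A k z ⊎ B k z)) → ⊥
    -- Whether the component of `z` sees A or B at all is undecided; the goal permits distinguishing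
    -- the cases.
    go-out (z , z∉) = dec (Σ V (Sees (A k) z)) λ dA → dec (Σ V (Sees (B k) z)) λ dB → cut dA dB
      where
      dec : ∀ (P : Set) → (Dec P → ⊥) → ⊥
      dec P h = h (no λ p → h (yes p))
      oz : Out k z
      oz = (λ h → z∉ (inj₁ h)) , λ h → z∉ (inj₂ h)
      flip : ∀ {w w'} → Reach G (Out k) w w' → Reach G (Out (swapK k)) w w'
      flip here = here
      flip (step e (p , q) r) = step e (q , p) (flip r)
      uniqueA : ∀ {a a'} → Sees (A k) z a → Sees (A k) z a' → a ≡ a'
      uniqueA (aA , w , r , e) (a'A , w' , r' , e') = same-reach k (reach-end oz r) (reach-trans (reach-sym oz r) r') aA a'A e e'
      uniqueB : ∀ {a a'} → Sees (B k) z a → Sees (B k) z a' → a ≡ a'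
      uniqueB (aA , w , r , e) (a'A , w' , r' , e') = same-reach (swapK k) (let p , q = reach-end oz r in q , p) (flip (reach-trans (reach-sym oz r) r')) aA a'A e e'
      -- On a path from `z` to `t` that avoids `L`, the first vertex of A or B is seen by the
      -- component of `z`, so it lies in `L` after all.
      escape : ∀ L → CliqueList L → z ∉ L → (∀ {a} → Sees (A k) z a → a ∈ L) → (∀ {a} → Sees (B k) z a → a ∈ L) → (Σ V λ t → (t ∉ L) × A k t) → ⊥
      escape L cl z∉L sA sB (t , t∉ , tA) = connected-avoiding noC L cl z∉L t∉ λ pth → first (PathIn.tl pth) (PathIn.ip pth) (PathIn.oks pth) here oz
          (case cast∈ (sym (PathIn.ends pth)) (∈-++⁺ʳ (PathIn.ini pth) (here refl)) of λ { (here refl) → ⊥-elim (proj₁ oz tA) ; (there i) → i })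
        where
        first : ∀ {w} l → IP (w ∷ l) → (∀ {v} → v ∈ l → v ∉ L) → Reach G (Out k) z w → Out k w → t ∈ l → ⊥
        first {w} (v ∷ l) ip o r ow i with A? k v | A? (swapK k) v
        ... | yes vA | _ = o (here refl) (sA (vA , w , r , IP-head ip))
        ... | no _ | yes vB = o (here refl) (sB (vB , w , r , IP-head ip))
        first {w} (v ∷ l) ip o r ow (here refl) | no nA | no nB = nA tA
        first {w} (v ∷ l) ip o r ow (there i) | no nA | no nB = first l (IP-tail ip) (o ∘ there) (reach-snoc r (IP-head ip) (nA , nB)) (nA , nB) i
      freeA : ∀ a → Σ V λ t → (t ≢ a) × A k t
      freeA a with x k 0F ≟ a
      ... | no h = x k 0F , h , x∈A k 0F
      ... | yes refl = x k 1F , x-inj k (λ ()) , x∈A k 1F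
      cut : Dec (Σ V (Sees (A k) z)) → Dec (Σ V (Sees (B k) z)) → ⊥
      cut (no nA) (no nB) = escape [] (λ ()) (λ ()) (λ h → ⊥-elim (nA (_ , h))) (λ h → ⊥-elim (nB (_ , h))) (x k 0F , (λ ()) , x∈A k 0F)
      cut (yes (a , h)) (no nB) = escape [ a ] (λ { (here refl) (here refl) ne → ⊥-elim (ne refl) }) (λ { (here refl) → proj₁ oz (proj₁ h) }) (λ h' → here (uniqueA h' h)) (λ h' → ⊥-elim (nB (_ , h')))
        (let t , t≢ , tA = freeA a in t , (λ { (here e) → t≢ e }) , tA)
      cut (no nA) (yes (b , h)) = escape [ b ] (λ { (here refl) (here refl) ne → ⊥-elim (ne refl) }) (λ { (here refl) → proj₂ oz (proj₁ h) }) (λ h' → ⊥-elim (nA (_ , h'))) (λ h' → here (uniqueB h' h))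
        (x k 0F , (λ { (here refl) → A∩B k (x∈A k 0F) (proj₁ h) }) , x∈A k 0F)
      cut (yes (a , h)) (yes (b , h')) = escape (a ∷ b ∷ []) cl (λ { (here refl) → proj₁ oz (proj₁ h) ; (there (here refl)) → proj₂ oz (proj₁ h') }) (λ s → here (uniqueA s h)) (λ s → there (here (uniqueB s h')))
        (let t , t≢ , tA = freeA a in t , (λ { (here e) → t≢ e ; (there (here refl)) → A∩B k tA (proj₁ h') }) , tA)
        where
        cl : CliqueList (a ∷ b ∷ [])
        cl (here refl) (here refl) ne = ⊥-elim (ne refl)
        cl (here refl) (there (here refl)) _ = complete k (proj₁ h) (proj₁ h')
        cl (there (here refl)) (here refl) _ = ~-sym (complete k (proj₁ h) (proj₁ h'))
        cl (there (here refl)) (there (here refl)) ne = ⊥-elim (ne refl)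

-- Combining the cases

completeBipartite? : ∀ G → Dec (CompleteBipartite G)
completeBipartite? G with anySubset? (λ S → (any? λ u → lookup S u Bool.≟ true) ×-dec (any? λ v → lookup S v Bool.≟ false)
    ×-dec (all? λ u → all? λ v → adj G u v Bool.≟ (lookup S u xor lookup S v)))
... | yes (S , h) = yes (lookup S , h)
... | no ¬h = no λ (side , (u , eu) , (v , ev) , h) → let t = lookup∘tabulate side in
  ¬h (Vec.tabulate side , (u , trans (t u) eu) , (v , trans (t v) ev) , λ x y → trans (h x y) (sym (cong₂ _xor_ (t x) (t y))))

module Decomposition (G : Graph) (noI : ¬ HasISK4 G) (noW : ¬ HasWheel G)
  (noC : ¬ HasCliqueCutset G) (no2 : ¬ TwoCuts.HasCertified2Cut G) where
  open Basics G
  open Diamonds G noW noC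
  open Corners G noI noW noC no2

  _#?_ : ∀ x y → Dec (x # y)
  x #? y = ¬? (x ≟ y) ×-dec ¬? (x ~? y)

  claw? : Dec Claw
  claw? with any? (λ v → any? λ x → any? λ y → any? λ z → (v ~? x) ×-dec (v ~? y) ×-dec (v ~? z) ×-dec (x #? y) ×-dec (x #? z) ×-dec (y #? z))
  ... | yes (v , x , y , z , vx , vy , vz , xy , xz , yz) = yes record { v = v ; x = x ; y = y ; z = z ; vx = vx ; vy = vy ; vz = vz ; xy = xy ; xz = xz ; yz = yz }
  ... | no h = no λ c → let open Claw c in h (v , x , y , z , vx , vy , vz , xy , xz , yz)

  clawFree⇒line : ¬ Claw → Σ Graph λ H → ChordlessGraph H × MaxDegree≤3 H × IsLineGraphOf G H
  clawFree⇒line noClaw = H , chordless , maxDegree , isLine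
    where
    two-adjacent : ∀ {v x y z} → v ~ x → v ~ y → v ~ z → x ≢ y → x ≢ z → y ≢ z → x ~ y ⊎ x ~ z ⊎ y ~ z
    two-adjacent {v} {x} {y} {z} vx vy vz x≢y x≢z y≢z with x ~? y | x ~? z | y ~? z
    ... | yes e | _ | _ = inj₁ e
    ... | no _ | yes e | _ = inj₂ (inj₁ e)
    ... | no _ | no _ | yes e = inj₂ (inj₂ e)
    ... | no p | no q | no r = ⊥-elim (noClaw record { v = v ; x = x ; y = y ; z = z ; vx = vx ; vy = vy ; vz = vz ; xy = x≢y , p ; xz = x≢z , q ; yz = y≢z , r })
    open LineGraph G noW diamondFree two-adjacent

  claw⇒seriesParallel : Claw → ¬ CompleteBipartite G → SeriesParallel G
  claw⇒seriesParallel c noB = Minimal.seriesParallel G noI noW noT (Bipartite.no-K33 G noI noT noC noB)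
    where
    noT : ∀ {x y z} → x ~ y → x ~ z → y ~ z → ⊥
    noT {x} {y} {z} xy xz yz = triangle⇒⊥ c {x} (y , z , xy , xz , yz)

theorem1p2 : (G : Graph) → ¬ HasISK4 G → ¬ HasWheel G →
    SeriesParallel G
    ⊎ (Σ Graph λ H → ChordlessGraph H × MaxDegree≤3 H × IsLineGraphOf G H)
    ⊎ CompleteBipartite G
    ⊎ (HasCliqueCutset G ⊎ HasProper2Cutset G)
theorem1p2 G noI noW = case TwoCuts.cliqueCutset? G of λ
  { (yes c) → inj₂ (inj₂ (inj₂ (inj₁ c)))
  -- The search is for certified 2-cutsets, whose absence is what `no-exit` contradicts.
  ; (no noC) → case TwoCuts.certified2Cut? G of λ
    { (yes (a , b , S , c)) → inj₂ (inj₂ (inj₂ (inj₂ (a , b , TwoCuts.certified⇒proper G {S = S} c))))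
    ; (no no2) → let open Decomposition G noI noW noC no2 in case claw? of λ
      { (no noClaw) → inj₂ (inj₁ (clawFree⇒line noClaw))
      ; (yes c) → case completeBipartite? G of λ
        { (yes h) → inj₂ (inj₂ (inj₁ h))
        ; (no noB) → inj₁ (claw⇒seriesParallel c noB) } } } }
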